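{- Let $n_1,\ldots,n_t$ be positive integers, let $t_e$ and $t_o$ be respectively the number of even and odd integers in the sequence $(n_1,\ldots,n_t)$, and let $f=82\times 35^{2^{t_o}-2}\times 81^{t_e}$. Let $c=\min\{95412,f\}$ if $t=2$ and $c=f$ otherwise. Suppose that $n=\max\{n_1,\ldots,n_t\}$ and that for each $1\leq i\leq t$ we have $n_i\geq 2\lceil \log (nc) \rceil+2$. Then, for sufficiently large $n$, $$\hat{R}(C_{n_1},\ldots,C_{n_t})\leq (\ln c+1)\,c^2\, n.$$
   Context: $C_k$ denotes the cycle on $k$ vertices. For graphs $G_1,\ldots,G_k$, the size-Ramsey number $\hat{R}(G_1,\ldots,G_k)$ is the smallest integer $m$ for which there exists a graph $H$ with $m$ edges such that for every coloring of the edges of $H$ with colors $1,\ldots,k$ there is, for some $i$, a copy of $G_i$ in $H$ all of whose edges have color $i$. $\log$ denotes the logarithm to base $2$ and $\ln$ the natural logarithm. -}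

module Defs where

import Algebra.Definitions.RawSemiring
open import Data.Bool using (Bool; true; false; T; if_then_else_)
open import Data.Fin as Fin using (Fin; toℕ)
import Data.Fin.Properties as Fin
open import Data.Integer as ℤ using (ℤ; +_; -[1+_])
import Data.Integer.Properties as ℤ
import Data.Integer.DivMod as ℤ
open import Data.List using (List; length; filter; allFin; cartesianProduct)
open import Data.Empty using (⊥-elim)
open import Data.Nat as ℕ using (ℕ; zero; suc)
open import Data.Nat.Induction using (<-rec)
import Data.Nat.Properties as ℕ
import Data.Nat.Logarithm as ℕ
import Data.Nat.Coprimality as Coprime
open import Data.Nat.Divisibility using (_∣?_)
open import Data.Product using (∃-syntax; _×_; _,_; proj₁; proj₂)
open import Data.Rational
open import Data.Rational.Properties
open import Data.Rational.Solver using (module +-*-Solver)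
open import Data.Sum as Sum using (_⊎_; inj₁; inj₂)
open import Data.Vec using (Vec; count; foldr′)
open import Function using (_∘_)
open import Function.Bundles using (_⇔_; mk⇔)
open import Function.Definitions using (Injective)
open import Relation.Binary.PropositionalEquality
open import Relation.Nullary using (¬_; Dec; ¬?; isYes; toWitness; fromWitness)
open import Relation.Nullary.Decidable using (_×-dec_; _⊎-dec_; T?)

open Algebra.Definitions.RawSemiring +-*-rawSemiring public using (_^_)

record Graph : Set where
  field
    order  : ℕ
    adj    : Fin order → Fin order → Bool
    symm   : ∀ u v → T (adj u v) → T (adj v u)
    irrefl : ∀ v → ¬ T (adj v v)

  Vertex : Set
  Vertex = Fin order

  Adj : Vertex → Vertex → Set
  Adj u v = T (adj u v)

  -- Each edge is listed once, as the pair (u , v) with u < v.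
  edges : List (Vertex × Vertex)
  edges = filter (λ (u , v) → (u Fin.<? v) ×-dec T? (adj u v))
                 (cartesianProduct (allFin order) (allFin order))

  size : ℕ
  size = length edges

open Graph using (order; Vertex; Adj; size)

module _ (k : ℕ) where

  IsNext : Fin k → Fin k → Set
  IsNext u v = toℕ v ≡ suc (toℕ u) ⊎ (suc (toℕ u) ≡ k × toℕ v ≡ 0)

  CycleAdj : Fin k → Fin k → Set
  CycleAdj u v = u ≢ v × (IsNext u v ⊎ IsNext v u)

  private
    isNext? : ∀ u v → Dec (IsNext u v)
    isNext? u v = (toℕ v ℕ.≟ suc (toℕ u)) ⊎-dec
                  ((suc (toℕ u) ℕ.≟ k) ×-dec (toℕ v ℕ.≟ 0))

  cycleAdj? : ∀ u v → Dec (CycleAdj u v)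
  cycleAdj? u v = ¬? (u Fin.≟ v) ×-dec (isNext? u v ⊎-dec isNext? v u)

-- C k is the cycle 0 , 1 , … , k-1 , 0 for k ≥ 3.  The condition u ≢ v in
-- CycleAdj only matters for the degenerate k = 1, where it removes the loop.
C : ℕ → Graph
C k = record
  { order  = k
  ; adj    = λ u v → isYes (cycleAdj? k u v)
  ; symm   = λ u v e → let (u≢v , nxt) = toWitness {a? = cycleAdj? k u v} e
                       in fromWitness {a? = cycleAdj? k v u} (u≢v ∘ sym , Sum.swap nxt)
  ; irrefl = λ v e → proj₁ (toWitness {a? = cycleAdj? k v v} e) refl
  }

-- The symmetry axiom says that the colour belongs to the unordered pair {u , v}.
record Colouring (H : Graph) (k : ℕ) : Set where
  field
    colour    : ∀ u v → Adj H u v → Fin k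
    symmetric : ∀ u v (e : Adj H u v) (e′ : Adj H v u) → colour u v e ≡ colour v u e′

open Colouring using (colour)

-- A (not necessarily induced) copy of G in H whose edges all have colour i.
record MonochromaticCopy (G H : Graph) {k : ℕ} (χ : Colouring H k) (i : Fin k) : Set where
  field
    embed     : Vertex G → Vertex H
    injective : Injective _≡_ _≡_ embed
    edge      : ∀ u v → Adj G u v → Adj H (embed u) (embed v)
    coloured  : ∀ u v (e : Adj G u v) → colour χ (embed u) (embed v) (edge u v e) ≡ i

Arrows : Graph → {k : ℕ} → (Fin k → Graph) → Set
Arrows H {k} G = (χ : Colouring H k) → ∃[ i ] MonochromaticCopy (G i) H χ i

IsSizeRamseyNumber : {k : ℕ} → (Fin k → Graph) → ℕ → Set
IsSizeRamseyNumber G m =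
  (∃[ H ] size H ≡ m × Arrows H G) ×
  (∀ H → Arrows H G → m ℕ.≤ size H)

fromℕ : ℕ → ℚ
fromℕ n = + n / 1

infixr 8 _^ℤ_
_^ℤ_ : (q : ℚ) → .{{NonZero q}} → ℤ → ℚ
q ^ℤ (+ n)    = q ^ n
q ^ℤ -[1+ n ] = (1/ q) ^ suc n

private

  0≤1 : 0ℚ ≤ 1ℚ
  0≤1 = *≤* (ℤ.+≤+ ℕ.z≤n)

  fromℕ≡mkℚ : ∀ n → fromℕ n ≡ mkℚ (+ n) 0 (Coprime.sym (Coprime.1-coprimeTo n))
  fromℕ≡mkℚ n = normalize-coprime (Coprime.sym (Coprime.1-coprimeTo n))

  fromℕ-suc : ∀ n → fromℕ (suc n) ≡ 1ℚ + fromℕ n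
  fromℕ-suc n rewrite fromℕ≡mkℚ n =
    cong (_/ 1) (cong (λ z → + 1 ℤ.+ z) (sym (ℤ.*-identityʳ (+ n))))

  fromℕ-nonNeg : ∀ n → NonNegative (fromℕ n)
  fromℕ-nonNeg n = normalize-nonNeg n 1

-- Meant for x ≥ 1.  The binary logarithm of x and of the integer ⌈x⌉ have the same ceiling,
-- powers of two being integers; see ⌈log₂⌉-correct.
⌈log₂_⌉ : ℚ → ℕ
⌈log₂ x ⌉ = ℕ.⌈log₂ ℤ.∣ ceiling x ∣ ⌉

private

  ceiling≤⇒≤ : ∀ x k → ceiling x ℤ.≤ + k → x ≤ fromℕ k
  ceiling≤⇒≤ x@record{} k h rewrite fromℕ≡mkℚ k = *≤* (begin
    ↥ x ℤ.* + 1                     ≡⟨ ℤ.*-identityʳ (↥ x) ⟩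
    ↥ x                             ≡⟨ ℤ.neg-involutive (↥ x) ⟨
    ℤ.- (ℤ.- ↥ x)                   ≡⟨ cong ℤ.-_ (↥-neg x) ⟨
    ℤ.- ↥ (- x)                     ≤⟨ ℤ.neg-mono-≤ (ℤ.[n/d]*d≤n (↥ (- x)) (↧ (- x))) ⟩
    ℤ.- (⌊-x⌋ ℤ.* ↧ (- x))          ≡⟨ ℤ.neg-distribˡ-* ⌊-x⌋ (↧ (- x)) ⟩
    (ℤ.- ⌊-x⌋) ℤ.* ↧ (- x)          ≤⟨ ℤ.*-monoʳ-≤-nonNeg (↧ (- x)) (subst (ℤ._≤ + k) ceil≡ h) ⟩
    + k ℤ.* ↧ (- x)                 ≡⟨ cong (+ k ℤ.*_) (↧-neg x) ⟩
    + k ℤ.* ↧ x                     ∎)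
    where
    open ℤ.≤-Reasoning
    ⌊-x⌋ : ℤ
    ⌊-x⌋ = ↥ (- x) ℤ./ ↧ (- x)
    ceil≡ : ceiling x ≡ ℤ.- ⌊-x⌋
    ceil≡ with - x
    ... | record{} = refl

  ≤⇒ceiling≤ : ∀ x k → x ≤ fromℕ k → ceiling x ℤ.≤ + k
  ≤⇒ceiling≤ x@record{} k h rewrite fromℕ≡mkℚ k = begin
    ceiling x           ≡⟨ ceil≡ ⟩
    ℤ.- ⌊-x⌋            ≤⟨ ℤ.neg-mono-≤ -k≤⌊-x⌋ ⟩
    ℤ.- (ℤ.- + k)       ≡⟨ ℤ.neg-involutive (+ k) ⟩
    + k                 ∎
    where
    open ℤ.≤-Reasoning
    ⌊-x⌋ : ℤ
    ⌊-x⌋ = ↥ (- x) ℤ./ℕ ↧ₙ (- x)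
    ceil≡ : ceiling x ≡ ℤ.- ⌊-x⌋
    ceil≡ with - x
    ... | y@record{} = cong ℤ.-_ (ℤ.div-pos-is-/ℕ (↥ y) (↧ₙ y))
    -k*d<[1+⌊-x⌋]*d : (ℤ.- + k) ℤ.* ↧ (- x) ℤ.< ℤ.suc ⌊-x⌋ ℤ.* ↧ (- x)
    -k*d<[1+⌊-x⌋]*d = begin-strict
      (ℤ.- + k) ℤ.* ↧ (- x)     ≡⟨ cong ((ℤ.- + k) ℤ.*_) (↧-neg x) ⟩
      (ℤ.- + k) ℤ.* ↧ x         ≡⟨ ℤ.neg-distribˡ-* (+ k) (↧ x) ⟨
      ℤ.- (+ k ℤ.* ↧ x)         ≤⟨ ℤ.neg-mono-≤ (drop-*≤* h) ⟩
      ℤ.- (↥ x ℤ.* + 1)         ≡⟨ cong ℤ.-_ (ℤ.*-identityʳ (↥ x)) ⟩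
      ℤ.- ↥ x                   ≡⟨ ↥-neg x ⟨
      ↥ (- x)                   <⟨ ℤ.n<s[n/ℕd]*d (↥ (- x)) (↧ₙ (- x)) ⟩
      ℤ.suc ⌊-x⌋ ℤ.* ↧ (- x)    ∎
    -k≤⌊-x⌋ : ℤ.- + k ℤ.≤ ⌊-x⌋
    -k≤⌊-x⌋ = subst (ℤ.- + k ℤ.≤_) (ℤ.pred-suc ⌊-x⌋)
      (ℤ.i<j⇒i≤pred[j] {j = ℤ.suc ⌊-x⌋}
        (ℤ.*-cancelʳ-<-nonNeg {j = ℤ.suc ⌊-x⌋} (↧ (- x)) -k*d<[1+⌊-x⌋]*d))

  0≤ceiling : ∀ x → 0ℚ ≤ x → + 0 ℤ.≤ ceiling x
  0≤ceiling x 0≤x with ceiling x in eq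
  ... | + _      = ℤ.+≤+ ℕ.z≤n
  ... | -[1+ n ] = ⊥-elim (absurd (≤-antisym x≤0 0≤x))
    where
    x≤0 : x ≤ 0ℚ
    x≤0 = ceiling≤⇒≤ x 0 (subst (ℤ._≤ + 0) (sym eq) ℤ.-≤+)
    absurd : x ≢ 0ℚ
    absurd x≡0 with () ← trans (sym eq) (cong ceiling x≡0)

  n≤2^⌈log₂n⌉ : ∀ n → n ℕ.≤ 2 ℕ.^ ℕ.⌈log₂ n ⌉
  n≤2^⌈log₂n⌉ = <-rec _ step
    where
    open ℕ.≤-Reasoning
    step : ∀ n → (∀ {m} → m ℕ.< n → m ℕ.≤ 2 ℕ.^ ℕ.⌈log₂ m ⌉) → n ℕ.≤ 2 ℕ.^ ℕ.⌈log₂ n ⌉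
    step 0 _ = ℕ.z≤n
    step 1 _ = ℕ.≤-refl
    step n@(suc (suc l)) rec = begin
      n                                     ≡⟨ ℕ.⌊n/2⌋+⌈n/2⌉≡n n ⟨
      ℕ.⌊ n /2⌋ ℕ.+ ℕ.⌈ n /2⌉               ≤⟨ ℕ.+-monoˡ-≤ ℕ.⌈ n /2⌉ (ℕ.⌊n/2⌋≤⌈n/2⌉ n) ⟩
      ℕ.⌈ n /2⌉ ℕ.+ ℕ.⌈ n /2⌉               ≡⟨ cong (ℕ.⌈ n /2⌉ ℕ.+_) (ℕ.+-identityʳ ℕ.⌈ n /2⌉) ⟨
      2 ℕ.* ℕ.⌈ n /2⌉                       ≤⟨ ℕ.*-monoʳ-≤ 2 (rec (ℕ.⌈n/2⌉<n l)) ⟩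
      2 ℕ.^ suc ℕ.⌈log₂ ℕ.⌈ n /2⌉ ⌉         ≡⟨ cong (λ e → 2 ℕ.^ suc e) (ℕ.⌈log₂⌈n/2⌉⌉≡⌈log₂n⌉∸1 n) ⟩
      2 ℕ.^ suc (ℕ.⌈log₂ n ⌉ ℕ.∸ 1)         ≡⟨ cong (2 ℕ.^_) (ℕ.m+[n∸m]≡n 1≤log) ⟩
      2 ℕ.^ ℕ.⌈log₂ n ⌉                     ∎
      where
      1≤log : 1 ℕ.≤ ℕ.⌈log₂ n ⌉
      1≤log = ℕ.⌈log₂⌉-mono-≤ {2} {n} (ℕ.s≤s (ℕ.s≤s ℕ.z≤n))

⌈log₂⌉-correct : ∀ x → 1ℚ ≤ x → ∀ k → x ≤ fromℕ (2 ℕ.^ k) ⇔ ⌈log₂ x ⌉ ℕ.≤ k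
⌈log₂⌉-correct x 1≤x k = mk⇔ to from
  where
  ∣⌈x⌉∣ : + ℤ.∣ ceiling x ∣ ≡ ceiling x
  ∣⌈x⌉∣ = ℤ.0≤i⇒+∣i∣≡i (0≤ceiling x (≤-trans 0≤1 1≤x))
  to : x ≤ fromℕ (2 ℕ.^ k) → ⌈log₂ x ⌉ ℕ.≤ k
  to h = subst (⌈log₂ x ⌉ ℕ.≤_) (ℕ.⌈log₂2^n⌉≡n k) (ℕ.⌈log₂⌉-mono-≤
    (ℤ.drop‿+≤+ (subst (ℤ._≤ + (2 ℕ.^ k)) (sym ∣⌈x⌉∣) (≤⇒ceiling≤ x (2 ℕ.^ k) h))))
  from : ⌈log₂ x ⌉ ℕ.≤ k → x ≤ fromℕ (2 ℕ.^ k)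
  from h = ceiling≤⇒≤ x (2 ℕ.^ k) (subst (ℤ._≤ + (2 ℕ.^ k)) ∣⌈x⌉∣
    (ℤ.+≤+ (ℕ.≤-trans (n≤2^⌈log₂n⌉ ℤ.∣ ceiling x ∣) (ℕ.^-monoʳ-≤ 2 h))))

-- Reals are Cauchy sequences of rationals; two of them are equal when each is
-- _≤ℝ_ the other.
record ℝ : Set where
  field
    approx : ℕ → ℚ
    cauchy : ∀ ε → 0ℚ < ε →
             ∃[ K ] ∀ m n → K ℕ.≤ m → K ℕ.≤ n → ∣ approx m - approx n ∣ ≤ ε

open ℝ using (approx; cauchy)

infix 4 _≤ℝ_
_≤ℝ_ : ℝ → ℝ → Set
x ≤ℝ y = ∀ ε → 0ℚ < ε → ∃[ K ] ∀ m → K ℕ.≤ m → approx x m ≤ approx y m + ε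

fromℚ : ℚ → ℝ
fromℚ q = record
  { approx = λ _ → q
  ; cauchy = λ ε 0<ε → 0 , λ _ _ _ _ → subst (_≤ ε) (sym (cong ∣_∣ (+-inverseʳ q))) (<⇒≤ 0<ε)
  }

infixl 6 _+ℝ_
_+ℝ_ : ℝ → ℝ → ℝ
x +ℝ y = record
  { approx = λ k → approx x k + approx y k
  ; cauchy = isCauchy
  }
  where
  open +-*-Solver
  isCauchy : ∀ ε → 0ℚ < ε → ∃[ K ] ∀ m n → K ℕ.≤ m → K ℕ.≤ n →
             ∣ (approx x m + approx y m) - (approx x n + approx y n) ∣ ≤ ε
  isCauchy ε 0<ε = let (K , p) = cauchy x (½ * ε) 0<½ε
                       (L , q) = cauchy y (½ * ε) 0<½ε
    in K ℕ.⊔ L , λ m n h h′ → begin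
      ∣ (approx x m + approx y m) - (approx x n + approx y n) ∣
        ≡⟨ cong ∣_∣ (solve 4 (λ a b c d → (a :+ b) :- (c :+ d) := (a :- c) :+ (b :- d))
                     refl (approx x m) (approx y m) (approx x n) (approx y n)) ⟩
      ∣ (approx x m - approx x n) + (approx y m - approx y n) ∣
        ≤⟨ ∣p+q∣≤∣p∣+∣q∣ (approx x m - approx x n) (approx y m - approx y n) ⟩
      ∣ approx x m - approx x n ∣ + ∣ approx y m - approx y n ∣
        ≤⟨ +-mono-≤ (p m n (ℕ.m⊔n≤o⇒m≤o K L h) (ℕ.m⊔n≤o⇒m≤o K L h′))
                    (q m n (ℕ.m⊔n≤o⇒n≤o K L h) (ℕ.m⊔n≤o⇒n≤o K L h′)) ⟩
      ½ * ε + ½ * ε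
        ≡⟨ solve 1 (λ e → con ½ :* e :+ con ½ :* e := e) refl ε ⟩
      ε ∎
    where
    open ≤-Reasoning
    0<½ε : 0ℚ < ½ * ε
    0<½ε = subst (_< ½ * ε) (*-zeroʳ ½) (*-monoʳ-<-pos ½ 0<ε)

infixl 7 _*ℚ_
_*ℚ_ : ℝ → ℚ → ℝ
x *ℚ q = record
  { approx = λ k → approx x k * q
  ; cauchy = isCauchy
  }
  where
  open +-*-Solver
  open ≤-Reasoning
  r : ℚ
  r = 1ℚ + ∣ q ∣
  instance
    r-pos : Positive r
    r-pos = pos+nonNeg⇒pos 1ℚ ∣ q ∣ {{∣-∣-nonNeg q}}
    r-nonZero : NonZero r
    r-nonZero = pos⇒nonZero r
    1/r-pos : Positive (1/ r)
    1/r-pos = 1/pos⇒pos r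
  isCauchy : ∀ ε → 0ℚ < ε → ∃[ K ] ∀ m n → K ℕ.≤ m → K ℕ.≤ n →
             ∣ approx x m * q - approx x n * q ∣ ≤ ε
  isCauchy ε 0<ε = let (K , p) = cauchy x (ε * 1/ r) 0<ε/r
    in K , λ m n h h′ → begin
      ∣ approx x m * q - approx x n * q ∣
        ≡⟨ cong ∣_∣ (solve 3 (λ a b c → a :* c :- b :* c := (a :- b) :* c)
                     refl (approx x m) (approx x n) q) ⟩
      ∣ (approx x m - approx x n) * q ∣
        ≡⟨ ∣p*q∣≡∣p∣*∣q∣ (approx x m - approx x n) q ⟩
      ∣ approx x m - approx x n ∣ * ∣ q ∣
        ≤⟨ *-monoʳ-≤-nonNeg ∣ q ∣ {{∣-∣-nonNeg q}} (p m n h h′) ⟩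
      (ε * 1/ r) * ∣ q ∣
        ≤⟨ *-monoˡ-≤-nonNeg (ε * 1/ r) {{nonNegative (<⇒≤ 0<ε/r)}} ∣q∣≤r ⟩
      (ε * 1/ r) * r
        ≡⟨ *-assoc ε (1/ r) r ⟩
      ε * (1/ r * r)
        ≡⟨ cong (ε *_) (*-inverseˡ r) ⟩
      ε * 1ℚ
        ≡⟨ *-identityʳ ε ⟩
      ε ∎
    where
    0<ε/r : 0ℚ < ε * 1/ r
    0<ε/r = subst (_< ε * 1/ r) (*-zeroˡ (1/ r)) (*-monoˡ-<-pos (1/ r) 0<ε)
    ∣q∣≤r : ∣ q ∣ ≤ r
    ∣q∣≤r = subst (_≤ r) (+-identityˡ ∣ q ∣) (+-monoˡ-≤ ∣ q ∣ 0≤1)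

∑ : ℕ → (ℕ → ℚ) → ℚ
∑ zero    f = 0ℚ
∑ (suc n) f = ∑ n f + f n

module Riemann (h : ℚ) .{{h≥0 : NonNegative h}} where

  node : ℕ → ℚ
  node j = 1ℚ + fromℕ j * h

  node-pos : ∀ j → Positive (node j)
  node-pos j = pos+nonNeg⇒pos 1ℚ (fromℕ j * h)
    {{nonNeg*nonNeg⇒nonNeg (fromℕ j) {{fromℕ-nonNeg j}} h}}

  1/node : ℕ → ℚ
  1/node j = (1/ node j) {{pos⇒nonZero (node j) {{node-pos j}}}}

  -- The right Riemann sum of ∫ dt/t over [1 , 1 + n h] with n steps of length h.
  rightSum : ℕ → ℚ
  rightSum n = ∑ n λ j → h * 1/node (suc j)

mesh : ℚ → ℕ → ℚ
mesh x k = (x - 1ℚ) * ½ ^ k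

private

  ½^-nonNeg : ∀ k → NonNegative (½ ^ k)
  ½^-nonNeg zero    = _
  ½^-nonNeg (suc k) = nonNeg*nonNeg⇒nonNeg ½ (½ ^ k) {{½^-nonNeg k}}

  x-1-nonNeg : ∀ {x} → 1ℚ ≤ x → NonNegative (x - 1ℚ)
  x-1-nonNeg {x} 1≤x = nonNegative (subst (_≤ x - 1ℚ) (+-inverseʳ 1ℚ) (+-monoˡ-≤ (- 1ℚ) 1≤x))

  mesh-nonNeg : ∀ x → 1ℚ ≤ x → ∀ k → NonNegative (mesh x k)
  mesh-nonNeg x 1≤x k =
    nonNeg*nonNeg⇒nonNeg (x - 1ℚ) {{x-1-nonNeg 1≤x}} (½ ^ k) {{½^-nonNeg k}}

-- ln x = ∫₁ˣ dt/t, approximated with 2ᵏ steps of equal length.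
lnSum : (x : ℚ) → 1ℚ ≤ x → ℕ → ℚ
lnSum x 1≤x k = Riemann.rightSum (mesh x k) {{mesh-nonNeg x 1≤x k}} (2 ℕ.^ k)

private

  ∑-mono : ∀ n {f g} → (∀ j → f j ≤ g j) → ∑ n f ≤ ∑ n g
  ∑-mono zero    f≤g = ≤-refl
  ∑-mono (suc n) f≤g = +-mono-≤ (∑-mono n f≤g) (f≤g n)

  ∑-double : ∀ n f → ∑ (2 ℕ.* n) f ≡ ∑ n (λ j → f (j ℕ.+ j) + f (suc (j ℕ.+ j)))
  ∑-double n f = trans (cong (λ m → ∑ (n ℕ.+ m) f) (ℕ.+-identityʳ n)) (go n)
    where
    go : ∀ n → ∑ (n ℕ.+ n) f ≡ ∑ n (λ j → f (j ℕ.+ j) + f (suc (j ℕ.+ j)))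
    go zero = refl
    go (suc n) rewrite ℕ.+-suc n n | go n =
      +-assoc (∑ n λ j → f (j ℕ.+ j) + f (suc (j ℕ.+ j))) (f (n ℕ.+ n)) (f (suc (n ℕ.+ n)))

  1/-anti : ∀ p q .{{_ : Positive p}} .{{_ : Positive q}} → p ≤ q →
            (1/ q) {{pos⇒nonZero q}} ≤ (1/ p) {{pos⇒nonZero p}}
  1/-anti p q p≤q = begin
    1/ q                  ≡⟨ *-identityʳ (1/ q) ⟨
    1/ q * 1ℚ             ≡⟨ cong (1/ q *_) (*-inverseʳ p) ⟨
    1/ q * (p * 1/ p)     ≤⟨ *-monoˡ-≤-nonNeg (1/ q) {{pos⇒nonNeg (1/ q) {{1/pos⇒pos q}}}}
                              (*-monoʳ-≤-nonNeg (1/ p) {{pos⇒nonNeg (1/ p) {{1/pos⇒pos p}}}} p≤q) ⟩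
    1/ q * (q * 1/ p)     ≡⟨ *-assoc (1/ q) q (1/ p) ⟨
    (1/ q * q) * 1/ p     ≡⟨ cong (_* 1/ p) (*-inverseˡ q) ⟩
    1ℚ * 1/ p             ≡⟨ *-identityˡ (1/ p) ⟩
    1/ p                  ∎
    where
    open ≤-Reasoning
    instance
      _ : NonZero p
      _ = pos⇒nonZero p
      _ : NonZero q
      _ = pos⇒nonZero q

  module RiemannProperties (h : ℚ) .{{h≥0 : NonNegative h}} where

    open Riemann h
    open +-*-Solver

    leftSum : ℕ → ℚ
    leftSum n = ∑ n λ j → h * 1/node j

    1/node-pos : ∀ j → Positive (1/node j)
    1/node-pos j = 1/pos⇒pos (node j) {{node-pos j}}

    1/node-anti : ∀ j → 1/node (suc j) ≤ 1/node j
    1/node-anti j = 1/-anti (node j) (node (suc j)) {{node-pos j}} {{node-pos (suc j)}} (begin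
      node j           ≡⟨ +-identityʳ (node j) ⟨
      node j + 0ℚ      ≤⟨ +-monoʳ-≤ (node j) (nonNegative⁻¹ h) ⟩
      node j + h       ≡⟨ solve 2 (λ a b → (con 1ℚ :+ a :* b) :+ b := con 1ℚ :+ (con 1ℚ :+ a) :* b)
                           refl (fromℕ j) h ⟩
      1ℚ + (1ℚ + fromℕ j) * h ≡⟨ cong (λ a → 1ℚ + a * h) (fromℕ-suc j) ⟨
      node (suc j)     ∎)
      where open ≤-Reasoning

    right≤left : ∀ n → rightSum n ≤ leftSum n
    right≤left n = ∑-mono n λ j → *-monoˡ-≤-nonNeg h (1/node-anti j)

    left-right : ∀ n → leftSum n + h * 1/node n ≡ rightSum n + h * 1/node 0
    left-right zero    = refl
    left-right (suc n) = begin
      (leftSum n + a) + b                     ≡⟨ cong (_+ b) (left-right n) ⟩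
      (rightSum n + h * 1/node 0) + b         ≡⟨ solve 3 (λ r s t → (r :+ s) :+ t := (r :+ t) :+ s)
                                                   refl (rightSum n) (h * 1/node 0) b ⟩
      (rightSum n + b) + h * 1/node 0         ∎
      where
      open ≡-Reasoning
      a b : ℚ
      a = h * 1/node n
      b = h * 1/node (suc n)

    1/node0≡1 : 1/node 0 ≡ 1ℚ
    1/node0≡1 = 1/-cong (node-pos 0) (trans (cong (λ z → 1ℚ + z) (*-zeroˡ h)) (+-identityʳ 1ℚ))
      where
      1/-cong : ∀ {p} .(p>0 : Positive p) → p ≡ 1ℚ → (1/ p) {{pos⇒nonZero p {{p>0}}}} ≡ 1ℚ
      1/-cong _ refl = refl

    left≤right+h : ∀ n → leftSum n ≤ rightSum n + h
    left≤right+h n = begin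
      leftSum n                       ≡⟨ +-identityʳ (leftSum n) ⟨
      leftSum n + 0ℚ                  ≤⟨ +-monoʳ-≤ (leftSum n) (nonNegative⁻¹ (h * 1/node n)
                                          {{nonNeg*nonNeg⇒nonNeg h (1/node n)
                                            {{pos⇒nonNeg (1/node n) {{1/node-pos n}}}}}}) ⟩
      leftSum n + h * 1/node n        ≡⟨ left-right n ⟩
      rightSum n + h * 1/node 0       ≡⟨ cong (λ z → rightSum n + h * z) 1/node0≡1 ⟩
      rightSum n + h * 1ℚ             ≡⟨ cong (λ z → rightSum n + z) (*-identityʳ h) ⟩
      rightSum n + h                  ∎
      where open ≤-Reasoning

  module Refinement (h h′ : ℚ) .{{h≥0 : NonNegative h}} .{{h′≥0 : NonNegative h′}}
                    (h≡h′+h′ : h ≡ h′ + h′) where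

    open +-*-Solver
    open ≤-Reasoning
    module F = Riemann h
    module F′ = Riemann h′
    module P = RiemannProperties h
    module P′ = RiemannProperties h′

    fromℕ-+ : ∀ m n → fromℕ (m ℕ.+ n) ≡ fromℕ m + fromℕ n
    fromℕ-+ zero    n = sym (+-identityˡ (fromℕ n))
    fromℕ-+ (suc m) n = trans (fromℕ-suc (m ℕ.+ n)) (trans (cong (λ z → 1ℚ + z) (fromℕ-+ m n))
      (trans (sym (+-assoc 1ℚ (fromℕ m) (fromℕ n))) (cong (_+ fromℕ n) (sym (fromℕ-suc m)))))

    1/node-double : ∀ j → F.1/node j ≡ F′.1/node (j ℕ.+ j)
    1/node-double j = 1/-cong (F.node-pos j) (F′.node-pos (j ℕ.+ j)) (trans
      (cong (λ z → 1ℚ + fromℕ j * z) h≡h′+h′) (trans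
      (solve 2 (λ a b → con 1ℚ :+ a :* (b :+ b) := con 1ℚ :+ (a :+ a) :* b) refl (fromℕ j) h′)
      (cong (λ z → 1ℚ + z * h′) (sym (fromℕ-+ j j)))))
      where
      1/-cong : ∀ {p q} .(p>0 : Positive p) .(q>0 : Positive q) → p ≡ q →
                (1/ p) {{pos⇒nonZero p {{p>0}}}} ≡ (1/ q) {{pos⇒nonZero q {{q>0}}}}
      1/-cong _ _ refl = refl

    term-double : ∀ j → h * F.1/node j ≡ h′ * F′.1/node (j ℕ.+ j) + h′ * F′.1/node (j ℕ.+ j)
    term-double j = trans (cong₂ _*_ h≡h′+h′ (1/node-double j))
      (*-distribʳ-+ (F′.1/node (j ℕ.+ j)) h′ h′)

    right-mono : ∀ n → F.rightSum n ≤ F′.rightSum (2 ℕ.* n)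
    right-mono n = begin
      F.rightSum n
        ≤⟨ ∑-mono n term ⟩
      ∑ n (λ j → h′ * F′.1/node (suc (j ℕ.+ j)) + h′ * F′.1/node (suc (suc (j ℕ.+ j))))
        ≡⟨ ∑-double n (λ j → h′ * F′.1/node (suc j)) ⟨
      F′.rightSum (2 ℕ.* n) ∎
      where
      term : ∀ j → h * F.1/node (suc j) ≤
                   h′ * F′.1/node (suc (j ℕ.+ j)) + h′ * F′.1/node (suc (suc (j ℕ.+ j)))
      term j = begin
        h * F.1/node (suc j)     ≡⟨ term-double (suc j) ⟩
        h′ * F′.1/node (suc j ℕ.+ suc j) + h′ * F′.1/node (suc j ℕ.+ suc j)
                                 ≡⟨ cong (λ i → h′ * F′.1/node (suc i) + h′ * F′.1/node (suc i)) (ℕ.+-suc j j) ⟩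
        h′ * F′.1/node (suc (suc (j ℕ.+ j))) + h′ * F′.1/node (suc (suc (j ℕ.+ j)))
                                 ≤⟨ +-monoˡ-≤ (h′ * F′.1/node (suc (suc (j ℕ.+ j))))
                                     (*-monoˡ-≤-nonNeg h′ (P′.1/node-anti (suc (j ℕ.+ j)))) ⟩
        h′ * F′.1/node (suc (j ℕ.+ j)) + h′ * F′.1/node (suc (suc (j ℕ.+ j))) ∎

    left-anti : ∀ n → P′.leftSum (2 ℕ.* n) ≤ P.leftSum n
    left-anti n = begin
      P′.leftSum (2 ℕ.* n)
        ≡⟨ ∑-double n (λ j → h′ * F′.1/node j) ⟩
      ∑ n (λ j → h′ * F′.1/node (j ℕ.+ j) + h′ * F′.1/node (suc (j ℕ.+ j)))
        ≤⟨ ∑-mono n term ⟩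
      P.leftSum n ∎
      where
      term : ∀ j → h′ * F′.1/node (j ℕ.+ j) + h′ * F′.1/node (suc (j ℕ.+ j)) ≤ h * F.1/node j
      term j = begin
        h′ * F′.1/node (j ℕ.+ j) + h′ * F′.1/node (suc (j ℕ.+ j))
          ≤⟨ +-monoʳ-≤ (h′ * F′.1/node (j ℕ.+ j)) (*-monoˡ-≤-nonNeg h′ (P′.1/node-anti (j ℕ.+ j))) ⟩
        h′ * F′.1/node (j ℕ.+ j) + h′ * F′.1/node (j ℕ.+ j)
          ≡⟨ term-double j ⟨
        h * F.1/node j ∎

  k*½^k≤1 : ∀ k → fromℕ k * ½ ^ k ≤ 1ℚ
  k*½^k≤1 zero    = 0≤1
  k*½^k≤1 (suc k) = begin
    fromℕ (suc k) * (½ * ½ ^ k)             ≡⟨ cong (_* (½ * ½ ^ k)) (fromℕ-suc k) ⟩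
    (1ℚ + fromℕ k) * (½ * ½ ^ k)            ≡⟨ solve 2 (λ a b → (con 1ℚ :+ a) :* (con ½ :* b) :=
                                                con ½ :* b :+ con ½ :* (a :* b)) refl (fromℕ k) (½ ^ k) ⟩
    ½ * ½ ^ k + ½ * (fromℕ k * ½ ^ k)       ≤⟨ +-mono-≤ (*-monoˡ-≤-nonNeg ½ (½^k≤1 k))
                                                        (*-monoˡ-≤-nonNeg ½ (k*½^k≤1 k)) ⟩
    1ℚ                                      ∎
    where
    open ≤-Reasoning
    open +-*-Solver
    ½^k≤1 : ∀ k → ½ ^ k ≤ 1ℚ
    ½^k≤1 zero    = ≤-refl
    ½^k≤1 (suc k) = ≤-trans (*-monoˡ-≤-nonNeg ½ (½^k≤1 k)) (*≤* (ℤ.+≤+ (ℕ.s≤s ℕ.z≤n)))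

  archimedean : ∀ y ε → 0ℚ ≤ y → 0ℚ < ε → ∃[ K ] y ≤ fromℕ K * ε
  archimedean y ε 0≤y 0<ε = K , (begin
    y                   ≡⟨ *-identityʳ y ⟨
    y * 1ℚ              ≡⟨ cong (y *_) (*-inverseˡ ε) ⟨
    y * (1/ ε * ε)      ≡⟨ *-assoc y (1/ ε) ε ⟨
    y * 1/ ε * ε        ≤⟨ *-monoʳ-≤-nonNeg ε {{pos⇒nonNeg ε}} q≤K ⟩
    fromℕ K * ε         ∎)
    where
    open ≤-Reasoning
    instance
      _ : Positive ε
      _ = positive 0<ε
      _ : NonZero ε
      _ = pos⇒nonZero ε
    q : ℚ
    q = y * 1/ ε
    K : ℕ
    K = ℤ.∣ ceiling q ∣
    i≤∣i∣ : ∀ i → i ℤ.≤ + ℤ.∣ i ∣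
    i≤∣i∣ (+ _)    = ℤ.≤-refl
    i≤∣i∣ -[1+ _ ] = ℤ.-≤+
    q≤K : q ≤ fromℕ K
    q≤K = ceiling≤⇒≤ q K (i≤∣i∣ (ceiling q))

  ∣-∣≤ : ∀ {a d p q} → a ≤ p → a ≤ q → p ≤ a + d → q ≤ a + d → ∣ p - q ∣ ≤ d
  ∣-∣≤ {a} {d} {p} {q} a≤p a≤q p≤a+d q≤a+d with ∣p∣≡p∨∣p∣≡-p (p - q)
  ... | inj₁ eq = subst (_≤ d) (sym eq) (diff p≤a+d a≤q)
    where
    diff : ∀ {p q} → p ≤ a + d → a ≤ q → p - q ≤ d
    diff {p} {q} h h′ = subst (p - q ≤_) (solve 2 (λ a d → (a :+ d) :- a := d) refl a d)
      (+-mono-≤ h (neg-antimono-≤ h′))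
      where open +-*-Solver
  ... | inj₂ eq = subst (_≤ d) (sym (trans eq (solve 2 (λ p q → :- (p :- q) := q :- p) refl p q)))
      (subst (q - p ≤_) (solve 2 (λ a d → (a :+ d) :- a := d) refl a d)
      (+-mono-≤ q≤a+d (neg-antimono-≤ a≤p)))
    where open +-*-Solver

  module LnCauchy (x : ℚ) (1≤x : 1ℚ ≤ x) where

    open +-*-Solver
    open ≤-Reasoning

    mesh≥0 : ∀ k → NonNegative (mesh x k)
    mesh≥0 = mesh-nonNeg x 1≤x

    lower upper : ℕ → ℚ
    lower k = lnSum x 1≤x k
    upper k = RiemannProperties.leftSum (mesh x k) {{mesh≥0 k}} (2 ℕ.^ k)

    halve : ∀ k → mesh x k ≡ mesh x (suc k) + mesh x (suc k)
    halve k = solve 2 (λ a b → a :* b := a :* (con ½ :* b) :+ a :* (con ½ :* b)) refl (x - 1ℚ) (½ ^ k)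

    lower-mono : ∀ {m n} → m ℕ.≤′ n → lower m ≤ lower n
    lower-mono {m} (ℕ.≤′-reflexive refl) = ≤-refl
    lower-mono {m} (ℕ.≤′-step {n} m≤n) = ≤-trans (lower-mono m≤n)
      (Refinement.right-mono (mesh x n) (mesh x (suc n)) {{mesh≥0 n}} {{mesh≥0 (suc n)}} (halve n) (2 ℕ.^ n))

    upper-anti : ∀ {m n} → m ℕ.≤′ n → upper n ≤ upper m
    upper-anti {m} (ℕ.≤′-reflexive refl) = ≤-refl
    upper-anti {m} (ℕ.≤′-step {n} m≤n) = ≤-trans
      (Refinement.left-anti (mesh x n) (mesh x (suc n)) {{mesh≥0 n}} {{mesh≥0 (suc n)}} (halve n) (2 ℕ.^ n)) (upper-anti m≤n)

    bound : ∀ {K m} → K ℕ.≤ m → lower K ≤ lower m × lower m ≤ lower K + mesh x K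
    bound {K} {m} K≤m = lower-mono (ℕ.≤⇒≤′ K≤m) , (begin
      lower m             ≤⟨ RiemannProperties.right≤left (mesh x m) {{mesh≥0 m}} (2 ℕ.^ m) ⟩
      upper m             ≤⟨ upper-anti (ℕ.≤⇒≤′ K≤m) ⟩
      upper K             ≤⟨ RiemannProperties.left≤right+h (mesh x K) {{mesh≥0 K}} (2 ℕ.^ K) ⟩
      lower K + mesh x K  ∎)

    isCauchy : ∀ ε → 0ℚ < ε →
               ∃[ K ] ∀ m n → K ℕ.≤ m → K ℕ.≤ n → ∣ lower m - lower n ∣ ≤ ε
    isCauchy ε 0<ε = K , λ m n K≤m K≤n →
      let (l , u) = bound K≤m ; (l′ , u′) = bound K≤n in ≤-trans (∣-∣≤ l l′ u u′) (begin
        (x - 1ℚ) * ½ ^ K            ≤⟨ *-monoʳ-≤-nonNeg (½ ^ K) {{½^-nonNeg K}} x-1≤Kε ⟩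
        fromℕ K * ε * ½ ^ K         ≡⟨ solve 3 (λ a b c → a :* b :* c := (a :* c) :* b) refl (fromℕ K) ε (½ ^ K) ⟩
        fromℕ K * ½ ^ K * ε         ≤⟨ *-monoʳ-≤-nonNeg ε {{nonNegative (<⇒≤ 0<ε)}} (k*½^k≤1 K) ⟩
        1ℚ * ε                      ≡⟨ *-identityˡ ε ⟩
        ε                           ∎)
      where
      arch : ∃[ K ] x - 1ℚ ≤ fromℕ K * ε
      arch = archimedean (x - 1ℚ) ε (nonNegative⁻¹ (x - 1ℚ) {{x-1-nonNeg 1≤x}}) 0<ε
      K : ℕ
      K = proj₁ arch
      x-1≤Kε : x - 1ℚ ≤ fromℕ K * ε
      x-1≤Kε = proj₂ arch

ln : (x : ℚ) → 1ℚ ≤ x → ℝ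
ln x 1≤x = record
  { approx = lnSum x 1≤x
  ; cauchy = LnCauchy.isCauchy x 1≤x
  }

maximum : ∀ {t} → Vec ℕ t → ℕ
maximum = foldr′ ℕ._⊔_ 0

#even #odd : ∀ {t} → Vec ℕ t → ℕ
#even = count (2 ∣?_)
#odd  = count (λ m → ¬? (2 ∣? m))

-- The exponent is -1 when all the lengths are even.
factor : ∀ {t} → Vec ℕ t → ℚ
factor ns = fromℕ 82 * fromℕ 35 ^ℤ (+ (2 ℕ.^ #odd ns) ℤ.- + 2) * fromℕ 81 ^ #even ns

constant : ∀ {t} → Vec ℕ t → ℚ
constant {t} ns = if t ℕ.≡ᵇ 2 then fromℕ 95412 ⊓ factor ns else factor ns

private

  1≤fromℕ-suc : ∀ n → 1ℚ ≤ fromℕ (suc n)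
  1≤fromℕ-suc n = subst (1ℚ ≤_) (sym (fromℕ-suc n))
    (subst (_≤ 1ℚ + fromℕ n) (+-identityʳ 1ℚ)
      (+-monoʳ-≤ 1ℚ (nonNegative⁻¹ (fromℕ n) {{fromℕ-nonNeg n}})))

  *≥1 : ∀ {p q} → 1ℚ ≤ p → 1ℚ ≤ q → 1ℚ ≤ p * q
  *≥1 {p} {q} 1≤p 1≤q = begin
    1ℚ        ≤⟨ 1≤q ⟩
    q         ≡⟨ *-identityˡ q ⟨
    1ℚ * q    ≤⟨ *-monoʳ-≤-nonNeg q {{nonNegative (≤-trans 0≤1 1≤q)}} 1≤p ⟩
    p * q     ∎
    where open ≤-Reasoning

  ^≥1 : ∀ {q} → 1ℚ ≤ q → ∀ n → 1ℚ ≤ q ^ n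
  ^≥1 1≤q zero    = ≤-refl
  ^≥1 1≤q (suc n) = *≥1 1≤q (^≥1 1≤q n)

  1/-nonNeg : ∀ p .{{_ : NonZero p}} → 0ℚ ≤ p → NonNegative (1/ p)
  1/-nonNeg (mkℚ ℤ.+[1+ _ ] _ _) _           = _
  1/-nonNeg (mkℚ -[1+ _ ]   _ _) (*≤* ())

  p*q^≥1 : ∀ p q .{{_ : NonZero q}} → 1ℚ ≤ q → q ≤ p → ∀ o → 1ℚ ≤ p * q ^ℤ (+ (2 ℕ.^ o) ℤ.- + 2)
  p*q^≥1 p q 1≤q q≤p zero = begin
    1ℚ                ≡⟨ *-inverseʳ q ⟨
    q * 1/ q          ≤⟨ *-monoʳ-≤-nonNeg (1/ q) {{1/q≥0}} q≤p ⟩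
    p * 1/ q          ≡⟨ cong (p *_) (*-identityʳ (1/ q)) ⟨
    p * (1/ q * 1ℚ)   ∎
    where
    open ≤-Reasoning
    1/q≥0 : NonNegative (1/ q)
    1/q≥0 = 1/-nonNeg q (≤-trans 0≤1 1≤q)
  p*q^≥1 p q 1≤q q≤p (suc o) = subst (λ e → 1ℚ ≤ p * q ^ℤ e)
    (sym (ℤ.⊖-≥ {2 ℕ.^ suc o} {2} (ℕ.^-monoʳ-≤ 2 {1} {suc o} (ℕ.s≤s ℕ.z≤n))))
    (*≥1 {p} {q ^ (2 ℕ.^ suc o ℕ.∸ 2)} (≤-trans 1≤q q≤p) (^≥1 1≤q (2 ℕ.^ suc o ℕ.∸ 2)))

  if-≥1 : ∀ b {p q} → 1ℚ ≤ p → 1ℚ ≤ q → 1ℚ ≤ (if b then p else q)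
  if-≥1 true  1≤p 1≤q = 1≤p
  if-≥1 false 1≤p 1≤q = 1≤q

  1≤factor : ∀ {t} (ns : Vec ℕ t) → 1ℚ ≤ factor ns
  1≤factor ns = *≥1 {fromℕ 82 * fromℕ 35 ^ℤ (+ (2 ℕ.^ #odd ns) ℤ.- + 2)} {fromℕ 81 ^ #even ns}
    (p*q^≥1 (fromℕ 82) (fromℕ 35) (1≤fromℕ-suc 34) (toWitness {a? = fromℕ 35 ≤? fromℕ 82} _) (#odd ns))
    (^≥1 {fromℕ 81} (1≤fromℕ-suc 80) (#even ns))

1≤constant : ∀ {t} (ns : Vec ℕ t) → 1ℚ ≤ constant ns
1≤constant {t} ns = if-≥1 (t ℕ.≡ᵇ 2) {fromℕ 95412 ⊓ factor ns} {factor ns}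
  (⊓-glb (1≤fromℕ-suc 95411) (1≤factor ns)) (1≤factor ns)

{-# OPTIONS --safe #-}

-- Let s ≥ n, and let two disjoint sets X and Y of at least 15 s vertices be joined by an
-- edge of colour i between any subsets of sizes ≥ s.  Removing at most s vertices from each
-- side makes every set of at most s vertices expand by a factor 6.  Two disjoint binary
-- trees with at least s leaves each then grow out of the ends of any edge u v inside the
-- remaining sets, and a long alternating path found by depth-first search among the vertices
-- outside the trees contains a segment of any prescribed length from the leaves of one tree
-- to those of the other.  This gives a cycle of colour i and length nᵢ through u v, where
-- u and v are on different sides if nᵢ is even, and on the same side if nᵢ is odd.
--
-- Without such a cycle, a large joined pair (X , Y) thus cannot exist if nᵢ is even, and has a
-- large subset of X free of colour i if nᵢ is odd.  By induction on the number of colours, any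
-- K s vertices contain two disjoint s-sets without edges of these colours between them,
-- where each even length multiplies K by 15 and each odd one replaces K by K (K + 13);
-- the odd lengths are treated first.  Hence a graph on K n vertices in which any two disjoint
-- n-sets are joined arrows the cycles.  Choosing edges greedily yields such a graph with
-- K² β n ≤ c² n edges for some β ≥ log₂ 4K, so that of ln c only ln c ≥ 0 is needed.
--
-- That the minimum in the size-Ramsey number is attained is constructive because arrowing
-- is decidable and isolated vertices can be discarded.

module Submission where

-- The edges of one colour between two disjoint sets form a bipartite graph, so they alone give only
-- even cycles; an odd cycle must also use an edge inside a side. This is why only the odd case has
-- a second outcome, and why it is expensive: the colours treated before have to be treated once
-- more inside the set free of colour `i`, which must therefore keep `K s` vertices, and `K` is
-- roughly squared. If even lengths came earlier, their powers of `15` would be squared as well.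
--
-- Joinedness says nothing about a single edge. The trees turn its two ends into leaf sets of size
-- at least `s`, to which joinedness applies, at the price of a depth `d` of about log s. The edge,
-- two branches and a segment with `k + 1` vertices close to a cycle of `2d + 3 + k` vertices,
-- whence the lower bound on the lengths of about twice a logarithm; the upper bound `nᵢ ≤ n ≤ s`
-- keeps the segment short enough to have many possible positions on the long path.

-- Cardinalities of finite subsets.

module FiniteSets where

  open import Data.Bool using (true; false)
  open import Data.Fin using (Fin; zero; suc)
  open import Data.Fin.Properties using (any?; suc-injective; _≟_)
  open import Data.Fin.Subset
  open import Data.Fin.Subset.Properties
  open import Data.Nat using (ℕ; zero; suc; _+_; _≤_; _<_; z≤n; s≤s)
  open import Data.Nat.Properties as ℕ using (≤-trans; ≤-reflexive; +-suc; m≤n⇒m≤1+n)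
  open import Data.Product using (∃-syntax; _×_; _,_)
  open import Data.Sum using (inj₁; inj₂)
  open import Data.Vec using ([]; _∷_; tabulate; here; there)
  open import Data.Vec.Properties using ([]=⇒lookup; lookup⇒[]=; lookup∘tabulate)
  open import Function using (_∘_)
  open import Function.Definitions using (Injective)
  open import Relation.Binary.PropositionalEquality
  open import Relation.Nullary using (Dec; does; yes; no; contradiction)
  open import Relation.Nullary.Decidable using (_×-dec_; dec-true)

  private variable
    n m : ℕ

  Disjoint : Subset n → Subset n → Set
  Disjoint p q = ∀ {x} → x ∈ p → x ∉ q

  Disjoint-sym : {p q : Subset n} → Disjoint p q → Disjoint q p
  Disjoint-sym p#q x∈q x∈p = p#q x∈p x∈q

  module _ {P : Fin n → Set} (P? : ∀ x → Dec (P x)) where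

    ⟪_⟫ : Subset n
    ⟪_⟫ = tabulate (does ∘ P?)

    ∈⟪⟫⁺ : ∀ {x} → P x → x ∈ ⟪_⟫
    ∈⟪⟫⁺ {x} px = lookup⇒[]= x _ (trans (lookup∘tabulate (does ∘ P?) x) (dec-true (P? x) px))

    ∈⟪⟫⁻ : ∀ {x} → x ∈ ⟪_⟫ → P x
    ∈⟪⟫⁻ {x} x∈ with P? x | trans (sym (lookup∘tabulate (does ∘ P?) x)) ([]=⇒lookup x∈)
    ... | yes px | _ = px

  ∣p∪q∣≤∣p∣+∣q∣ : (p q : Subset n) → ∣ p ∪ q ∣ ≤ ∣ p ∣ + ∣ q ∣
  ∣p∪q∣≤∣p∣+∣q∣ [] [] = z≤n
  ∣p∪q∣≤∣p∣+∣q∣ (true ∷ p) (true ∷ q) =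
    s≤s (≤-trans (m≤n⇒m≤1+n (∣p∪q∣≤∣p∣+∣q∣ p q)) (≤-reflexive (sym (+-suc ∣ p ∣ ∣ q ∣))))
  ∣p∪q∣≤∣p∣+∣q∣ (true ∷ p) (false ∷ q) = s≤s (∣p∪q∣≤∣p∣+∣q∣ p q)
  ∣p∪q∣≤∣p∣+∣q∣ (false ∷ p) (true ∷ q) =
    ≤-trans (s≤s (∣p∪q∣≤∣p∣+∣q∣ p q)) (≤-reflexive (sym (+-suc ∣ p ∣ ∣ q ∣)))
  ∣p∪q∣≤∣p∣+∣q∣ (false ∷ p) (false ∷ q) = ∣p∪q∣≤∣p∣+∣q∣ p q

  ∣p∣+∣q∣≤∣p∪q∣ : (p q : Subset n) → Disjoint p q → ∣ p ∣ + ∣ q ∣ ≤ ∣ p ∪ q ∣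
  ∣p∣+∣q∣≤∣p∪q∣ [] [] _ = z≤n
  ∣p∣+∣q∣≤∣p∪q∣ (true ∷ p) (true ∷ q) p#q = contradiction here (p#q here)
  ∣p∣+∣q∣≤∣p∪q∣ (true ∷ p) (false ∷ q) p#q =
    s≤s (∣p∣+∣q∣≤∣p∪q∣ p q λ x∈p x∈q → p#q (there x∈p) (there x∈q))
  ∣p∣+∣q∣≤∣p∪q∣ (false ∷ p) (true ∷ q) p#q = ≤-trans (≤-reflexive (+-suc ∣ p ∣ ∣ q ∣))
    (s≤s (∣p∣+∣q∣≤∣p∪q∣ p q λ x∈p x∈q → p#q (there x∈p) (there x∈q)))
  ∣p∣+∣q∣≤∣p∪q∣ (false ∷ p) (false ∷ q) p#q =
    ∣p∣+∣q∣≤∣p∪q∣ p q λ x∈p x∈q → p#q (there x∈p) (there x∈q)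

  -- The union bound in the form in which most counts below arise: `r` only has to catch what `q`
  -- misses.
  ∣-∣-cover : (p q r : Subset n) → (∀ {x} → x ∈ p → x ∉ q → x ∈ r) → ∣ p ∣ ≤ ∣ q ∣ + ∣ r ∣
  ∣-∣-cover p q r cover = ≤-trans (p⊆q⇒∣p∣≤∣q∣ p⊆q∪r) (∣p∪q∣≤∣p∣+∣q∣ q r)
    where
    p⊆q∪r : p ⊆ q ∪ r
    p⊆q∪r {x} x∈p with x ∈? q
    ... | yes x∈q = x∈p∪q⁺ (inj₁ x∈q)
    ... | no  x∉q = x∈p∪q⁺ (inj₂ (cover x∈p x∉q))

  x∈p─q⁻ : (p q : Subset n) → ∀ {x} → x ∈ p ─ q → x ∈ p × x ∉ q
  x∈p─q⁻ p q x∈ = p─q⊆p p q x∈ , ∉q p q x∈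
    where
    ∉q : ∀ {n} (p q : Subset n) {x} → x ∈ p ─ q → x ∉ q
    ∉q (_ ∷ p) (false ∷ q) here ()
    ∉q (_ ∷ p) (_ ∷ q) (there x∈) (there x∈q) = ∉q p q x∈ x∈q

  ∣p∣≤∣q∣+∣p─q∣ : (p q : Subset n) → ∣ p ∣ ≤ ∣ q ∣ + ∣ p ─ q ∣
  ∣p∣≤∣q∣+∣p─q∣ p q = ∣-∣-cover p q (p ─ q) x∈p∧x∉q⇒x∈p─q

  nonempty : (p : Subset n) → 0 < ∣ p ∣ → Nonempty p
  nonempty {n} p 0<∣p∣ with nonempty? p
  ... | yes ne = ne
  ... | no  ¬ne = contradiction
    (subst (0 <_) (trans (cong ∣_∣ (Empty-unique ¬ne)) (∣⊥∣≡0 n)) 0<∣p∣) λ ()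

  subset-of-size : ∀ k (p : Subset n) → k ≤ ∣ p ∣ → ∃[ q ] q ⊆ p × ∣ q ∣ ≡ k
  subset-of-size {n} zero p _ = ⊥ , ⊥⊆ , ∣⊥∣≡0 n
  subset-of-size (suc k) (true ∷ p) (s≤s k≤) with subset-of-size k p k≤
  ... | q , q⊆p , ∣q∣≡k = true ∷ q , s⊆s q⊆p , cong suc ∣q∣≡k
  subset-of-size (suc k) (false ∷ p) k≤ with subset-of-size (suc k) p k≤
  ... | q , q⊆p , ∣q∣≡k = false ∷ q , s⊆s q⊆p , ∣q∣≡k

  ∣⁅x⁆∪p∣ : ∀ x (p : Subset n) → ∣ ⁅ x ⁆ ∪ p ∣ ≤ suc ∣ p ∣
  ∣⁅x⁆∪p∣ x p = ≤-trans (∣p∪q∣≤∣p∣+∣q∣ ⁅ x ⁆ p) (≤-reflexive (cong (_+ ∣ p ∣) (∣⁅x⁆∣≡1 x)))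

  image : (Fin m → Fin n) → Subset m → Subset n
  image f p = ⟪ (λ y → any? λ x → (x ∈? p) ×-dec (f x ≟ y)) ⟫

  ∈-image⁺ : (f : Fin m → Fin n) (p : Subset m) → ∀ {x} → x ∈ p → f x ∈ image f p
  ∈-image⁺ f p x∈p = ∈⟪⟫⁺ (λ y → any? λ x → (x ∈? p) ×-dec (f x ≟ y)) (_ , x∈p , refl)

  ∈-image⁻ : (f : Fin m → Fin n) (p : Subset m) → ∀ {y} → y ∈ image f p → ∃[ x ] x ∈ p × f x ≡ y
  ∈-image⁻ f p = ∈⟪⟫⁻ (λ y → any? λ x → (x ∈? p) ×-dec (f x ≟ y))

  ∣p∣≤∣image∣ : (f : Fin m → Fin n) → Injective _≡_ _≡_ f → ∀ p → ∣ p ∣ ≤ ∣ image f p ∣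
  ∣p∣≤∣image∣ f inj [] = z≤n
  ∣p∣≤∣image∣ f inj (false ∷ p) = ≤-trans (∣p∣≤∣image∣ (f ∘ suc) (suc-injective ∘ inj) p)
    (p⊆q⇒∣p∣≤∣q∣ λ y∈ → let (x , x∈p , eq) = ∈-image⁻ (f ∘ suc) p y∈ in
      subst (_∈ image f (false ∷ p)) eq (∈-image⁺ f (false ∷ p) (there x∈p)))
  ∣p∣≤∣image∣ f inj (true ∷ p) = begin
    suc ∣ p ∣                              ≤⟨ s≤s (∣p∣≤∣image∣ (f ∘ suc) (suc-injective ∘ inj) p) ⟩
    suc ∣ image (f ∘ suc) p ∣              ≡⟨ cong (_+ ∣ image (f ∘ suc) p ∣) (∣⁅x⁆∣≡1 (f zero)) ⟨
    ∣ ⁅ f zero ⁆ ∣ + ∣ image (f ∘ suc) p ∣ ≤⟨ ∣p∣+∣q∣≤∣p∪q∣ ⁅ f zero ⁆ _ f0∉ ⟩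
    ∣ ⁅ f zero ⁆ ∪ image (f ∘ suc) p ∣     ≤⟨ p⊆q⇒∣p∣≤∣q∣ ⊆image ⟩
    ∣ image f (true ∷ p) ∣                 ∎
    where
    open ℕ.≤-Reasoning
    f0∉ : Disjoint ⁅ f zero ⁆ (image (f ∘ suc) p)
    f0∉ y∈ y∈′ with x∈⁅y⁆⇒x≡y (f zero) y∈ | ∈-image⁻ (f ∘ suc) p y∈′
    ... | refl | x , _ , eq with () ← inj eq
    ⊆image : ⁅ f zero ⁆ ∪ image (f ∘ suc) p ⊆ image f (true ∷ p)
    ⊆image y∈ with x∈p∪q⁻ ⁅ f zero ⁆ _ y∈
    ... | inj₁ y∈₁ = subst (_∈ image f (true ∷ p)) (sym (x∈⁅y⁆⇒x≡y (f zero) y∈₁))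
                       (∈-image⁺ f (true ∷ p) here)
    ... | inj₂ y∈₂ = let (x , x∈p , eq) = ∈-image⁻ (f ∘ suc) p y∈₂ in
      subst (_∈ image f (true ∷ p)) eq (∈-image⁺ f (true ∷ p) (there x∈p))

-- Expansion in a joined pair after deleting few vertices.

module Expansion where

  open import Data.Fin using (Fin; zero; suc)
  open import Data.Fin.Properties using (any?)
  open import Data.Fin.Subset
  open import Data.Fin.Subset.Properties
  open import Data.Nat
  open import Data.Nat.Properties hiding (_≟_)
  open import Data.Nat.Tactic.RingSolver using (solve-∀)
  open import Data.Product using (∃; ∃-syntax; ∃₂; _×_; _,_; proj₁; proj₂)
  open import Data.Sum using (inj₁; inj₂)
  open import Function using (_∘_)
  open import Relation.Binary.PropositionalEquality
  open import Relation.Nullary using (¬_; Dec; yes; no; contradiction)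
  open import Relation.Nullary.Decidable using (_×-dec_)

  open FiniteSets

  module Neighbourhoods {N : ℕ} (E : Fin N → Fin N → Set) (E? : ∀ x y → Dec (E x y))
                        (E-sym : ∀ {x y} → E x y → E y x) where

    nbr : Subset N → Subset N
    nbr A = ⟪ (λ y → any? λ x → (x ∈? A) ×-dec E? x y) ⟫

    ∈-nbr⁺ : ∀ {A x y} → x ∈ A → E x y → y ∈ nbr A
    ∈-nbr⁺ {A} x∈A exy = ∈⟪⟫⁺ (λ y → any? λ x → (x ∈? A) ×-dec E? x y) (_ , x∈A , exy)

    ∈-nbr⁻ : ∀ {A y} → y ∈ nbr A → ∃[ x ] x ∈ A × E x y
    ∈-nbr⁻ {A} = ∈⟪⟫⁻ (λ y → any? λ x → (x ∈? A) ×-dec E? x y)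

    Joined : ℕ → Subset N → Subset N → Set
    Joined s X Y = ∀ {A B} → A ⊆ X → B ⊆ Y → s ≤ ∣ A ∣ → s ≤ ∣ B ∣ →
                   ∃₂ λ a b → a ∈ A × b ∈ B × E a b

    Joined-sym : ∀ {s X Y} → Joined s X Y → Joined s Y X
    Joined-sym j A⊆Y B⊆X s≤A s≤B =
      let (b , a , b∈B , a∈A , eba) = j B⊆X A⊆Y s≤B s≤A in a , b , a∈A , b∈B , E-sym eba

    Joined-⊆ : ∀ {s X Y X′ Y′} → X′ ⊆ X → Y′ ⊆ Y → Joined s X Y → Joined s X′ Y′
    Joined-⊆ X′⊆X Y′⊆Y j A⊆X′ B⊆Y′ = j (X′⊆X ∘ A⊆X′) (Y′⊆Y ∘ B⊆Y′)

    Expands : ℕ → Subset N → Subset N → Set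
    Expands s X Y = ∀ {S} → S ⊆ X → ∣ S ∣ ≤ s → 6 * ∣ S ∣ ≤ ∣ nbr S ∩ Y ∣

    private

      -- Neighbours are counted in `Y ─ D′` only, so deleting more of `Y` never spoils the bound.
      -- This lets the two sides be pruned in any order, although the expansion of each refers to
      -- what is left of the other.
      record Removable (s : ℕ) (X Y D D′ : Subset N) : Set where
        constructor removable
        field
          D⊆X   : D ⊆ X
          ∣D∣<s : ∣ D ∣ < s
          few   : ∣ nbr D ∩ (Y ─ D′) ∣ ≤ 6 * ∣ D ∣

      Violates : ℕ → (X Y D D′ S : Subset N) → Set
      Violates s X Y D D′ S = S ⊆ X ─ D × ∣ S ∣ ≤ s × ∣ nbr S ∩ (Y ─ D′) ∣ < 6 * ∣ S ∣

      violates? : ∀ s X Y D D′ → Dec (∃ (Violates s X Y D D′))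
      violates? s X Y D D′ = anySubset? λ S →
        (S ⊆? X ─ D) ×-dec (∣ S ∣ ≤? s) ×-dec (suc ∣ nbr S ∩ (Y ─ D′) ∣ ≤? 6 * ∣ S ∣)

      ¬violates⇒Expands : ∀ {s X Y D D′} → ¬ ∃ (Violates s X Y D D′) → Expands s (X ─ D) (Y ─ D′)
      ¬violates⇒Expands ¬v S⊆ S≤ = ≮⇒≥ λ viol → ¬v (_ , S⊆ , S≤ , viol)

      shrink : ∀ {s X Y D D′ S} → Removable s Y X D′ D → Removable s Y X D′ (D ∪ S)
      shrink {X = X} {D = D} {D′} {S} (removable D⊆ D< few) = removable D⊆ D< (≤-trans
        (p⊆q⇒∣p∣≤∣q∣ λ x∈ →
          let (x∈nbr , x∈X─) = x∈p∩q⁻ (nbr D′) _ x∈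
              (x∈X , x∉D∪S) = x∈p─q⁻ X (D ∪ S) x∈X─
          in x∈p∩q⁺ (x∈nbr , x∈p∧x∉q⇒x∈p─q x∈X (x∉D∪S ∘ p⊆p∪q S)))
        few)

      -- The origin of `14`: at most `s` vertices of `Y` were removed before, a set of at most
      -- `2 * s` vertices has at most `12 * s` neighbours, and by joinedness fewer than `s` vertices
      -- of `Y` are not adjacent to it once it has reached size `s`.
      too-small : ∀ {s d₁ d₂ S a r y} → d₁ < s → d₂ < s → S ≤ s → a ≤ 6 * (d₁ + S) → r < s →
                  y ≤ d₂ + (a + r) → y < 14 * s
      too-small {s} {d₁} {d₂} {S} {a} {r} {y} d₁< d₂< S≤ a≤ r< y≤ = begin-strict
        y                              ≤⟨ y≤ ⟩
        d₂ + (a + r)                   ≤⟨ +-monoʳ-≤ d₂ (+-mono-≤ a≤ (<⇒≤ r<)) ⟩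
        d₂ + (6 * (d₁ + S) + s)        <⟨ +-mono-<-≤ d₂< (+-monoˡ-≤ s
                                           (*-monoʳ-≤ 6 (+-mono-≤ (<⇒≤ d₁<) S≤))) ⟩
        s + (6 * (s + s) + s)          ≡⟨ eq s ⟩
        14 * s                         ∎
        where
        open ≤-Reasoning
        eq : ∀ s → s + (6 * (s + s) + s) ≡ 14 * s
        eq = solve-∀

      enlarge : ∀ {s X Y D D′ S} → Joined s X Y → 14 * s ≤ ∣ Y ∣ →
                Removable s X Y D D′ → Removable s Y X D′ D → Violates s X Y D D′ S →
                Removable s X Y (D ∪ S) D′ × ∣ D ∣ < ∣ D ∪ S ∣
      enlarge {s} {X} {Y} {D} {D′} {S} joined large (removable D⊆ D< few) (removable _ D′< _)
              (S⊆ , S≤ , viol) = removable D∪S⊆X D∪S<s few′ , grows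
        where
        open ≤-Reasoning
        D#S : Disjoint D S
        D#S x∈D x∈S = proj₂ (x∈p─q⁻ X D (S⊆ x∈S)) x∈D
        D∪S⊆X : D ∪ S ⊆ X
        D∪S⊆X x∈ with x∈p∪q⁻ D S x∈
        ... | inj₁ x∈D = D⊆ x∈D
        ... | inj₂ x∈S = proj₁ (x∈p─q⁻ X D (S⊆ x∈S))
        few″ : ∣ nbr (D ∪ S) ∩ (Y ─ D′) ∣ ≤ 6 * (∣ D ∣ + ∣ S ∣)
        few″ = begin
          ∣ nbr (D ∪ S) ∩ (Y ─ D′) ∣                          ≤⟨ p⊆q⇒∣p∣≤∣q∣ split ⟩
          ∣ (nbr D ∩ (Y ─ D′)) ∪ (nbr S ∩ (Y ─ D′)) ∣         ≤⟨ ∣p∪q∣≤∣p∣+∣q∣ (nbr D ∩ (Y ─ D′)) _ ⟩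
          ∣ nbr D ∩ (Y ─ D′) ∣ + ∣ nbr S ∩ (Y ─ D′) ∣         ≤⟨ +-mono-≤ few (<⇒≤ viol) ⟩
          6 * ∣ D ∣ + 6 * ∣ S ∣                               ≡⟨ *-distribˡ-+ 6 ∣ D ∣ ∣ S ∣ ⟨
          6 * (∣ D ∣ + ∣ S ∣)                                 ∎
          where
          split : nbr (D ∪ S) ∩ (Y ─ D′) ⊆ (nbr D ∩ (Y ─ D′)) ∪ (nbr S ∩ (Y ─ D′))
          split y∈ with x∈p∩q⁻ (nbr (D ∪ S)) _ y∈
          ... | y∈nbr , y∈Y with ∈-nbr⁻ {D ∪ S} y∈nbr
          ... | x , x∈ , exy with x∈p∪q⁻ D S x∈
          ... | inj₁ x∈D = x∈p∪q⁺ (inj₁ (x∈p∩q⁺ (∈-nbr⁺ x∈D exy , y∈Y)))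
          ... | inj₂ x∈S = x∈p∪q⁺ (inj₂ (x∈p∩q⁺ (∈-nbr⁺ x∈S exy , y∈Y)))
        few′ : ∣ nbr (D ∪ S) ∩ (Y ─ D′) ∣ ≤ 6 * ∣ D ∪ S ∣
        few′ = ≤-trans few″ (*-monoʳ-≤ 6 (∣p∣+∣q∣≤∣p∪q∣ D S D#S))
        D∪S<s : ∣ D ∪ S ∣ < s
        D∪S<s = ≰⇒> λ s≤ → <⇒≱ (too-small D< D′< S≤ few″ (rest< s≤) Y≤) large
          where
          R : Subset N
          R = (Y ─ D′) ─ nbr (D ∪ S)
          rest< : s ≤ ∣ D ∪ S ∣ → ∣ R ∣ < s
          rest< s≤ = ≰⇒> λ s≤R →
            let (a , b , a∈ , b∈ , eab) = joined D∪S⊆X (p─q⊆p Y D′ ∘ p─q⊆p (Y ─ D′) _) s≤ s≤R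
            in proj₂ (x∈p─q⁻ (Y ─ D′) _ b∈) (∈-nbr⁺ a∈ eab)
          Y≤ : ∣ Y ∣ ≤ ∣ D′ ∣ + (∣ nbr (D ∪ S) ∩ (Y ─ D′) ∣ + ∣ R ∣)
          Y≤ = ≤-trans (∣p∣≤∣q∣+∣p─q∣ Y D′) (+-monoʳ-≤ ∣ D′ ∣
            (∣-∣-cover (Y ─ D′) _ R λ x∈ x∉ →
              x∈p∧x∉q⇒x∈p─q x∈ λ x∈nbr → x∉ (x∈p∩q⁺ (x∈nbr , x∈))))
        grows : ∣ D ∣ < ∣ D ∪ S ∣
        grows = begin-strict
          ∣ D ∣            <⟨ m<m+n ∣ D ∣ (0<S ∣ S ∣ viol) ⟩
          ∣ D ∣ + ∣ S ∣    ≤⟨ ∣p∣+∣q∣≤∣p∪q∣ D S D#S ⟩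
          ∣ D ∪ S ∣        ∎
          where
          0<S : ∀ {a} k → a < 6 * k → 0 < k
          0<S (suc k) _ = z<s

    -- Violating sets are removed one after the other: as long as fewer than s vertices
    -- are gone on a side, a removed set of size ≥ s with few neighbours would contradict
    -- that the sides are joined.
    prune : ∀ {s X Y} → 0 < s → Joined s X Y → 14 * s ≤ ∣ X ∣ → 14 * s ≤ ∣ Y ∣ →
            ∃₂ λ X′ Y′ → X′ ⊆ X × Y′ ⊆ Y × ∣ X ∣ ≤ s + ∣ X′ ∣ × ∣ Y ∣ ≤ s + ∣ Y′ ∣ ×
                         Expands s X′ Y′ × Expands s Y′ X′
    prune {s} {X} {Y} 0<s joined X≥ Y≥ = go (s + s) ⊥ ⊥
      (removable ⊥⊆ (subst (_< s) (sym (∣⊥∣≡0 N)) 0<s) (none Y ⊥))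
      (removable ⊥⊆ (subst (_< s) (sym (∣⊥∣≡0 N)) 0<s) (none X ⊥)) (m≤n+m (s + s) (∣ ⊥ {N} ∣ + ∣ ⊥ {N} ∣))
      where
      none : ∀ Z D′ → ∣ nbr ⊥ ∩ (Z ─ D′) ∣ ≤ 6 * ∣ ⊥ {N} ∣
      none Z D′ = ≤-trans (p⊆q⇒∣p∣≤∣q∣ {p = nbr ⊥ ∩ (Z ─ D′)} {q = ⊥} λ y∈ →
          let (x , x∈⊥ , _) = ∈-nbr⁻ {⊥} (proj₁ (x∈p∩q⁻ (nbr ⊥) _ y∈)) in contradiction x∈⊥ ∉⊥)
        (m≤n*m ∣ ⊥ {N} ∣ 6)
      go : ∀ fuel D D′ → Removable s X Y D D′ → Removable s Y X D′ D →
           s + s ≤ ∣ D ∣ + ∣ D′ ∣ + fuel →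
           ∃₂ λ X′ Y′ → X′ ⊆ X × Y′ ⊆ Y × ∣ X ∣ ≤ s + ∣ X′ ∣ × ∣ Y ∣ ≤ s + ∣ Y′ ∣ ×
                        Expands s X′ Y′ × Expands s Y′ X′
      -- The fuel `s + s` outlasts the removals: each takes away at least one vertex, and fewer than
      -- `s` are ever gone on either side.
      go zero D D′ r r′ enough = contradiction enough (<⇒≱ (subst (_< s + s)
        (sym (+-identityʳ (∣ D ∣ + ∣ D′ ∣))) (+-mono-< (Removable.∣D∣<s r) (Removable.∣D∣<s r′))))
      go (suc fuel) D D′ r r′ enough with violates? s X Y D D′ | violates? s Y X D′ D
      ... | yes (S , v) | _ =
        let (r₊ , grows) = enlarge joined Y≥ r r′ v
        in go fuel (D ∪ S) D′ r₊ (shrink r′) (≤-trans enough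
             (≤-trans (≤-reflexive (+-suc (∣ D ∣ + ∣ D′ ∣) fuel))
               (+-monoˡ-≤ fuel (+-monoˡ-≤ ∣ D′ ∣ grows))))
      ... | no _ | yes (S , v) =
        let (r₊ , grows) = enlarge (Joined-sym joined) X≥ r′ r v
        in go fuel D (D′ ∪ S) (shrink r) r₊ (≤-trans enough
             (≤-trans (≤-reflexive (trans (+-suc (∣ D ∣ + ∣ D′ ∣) fuel)
                                          (cong (_+ fuel) (sym (+-suc ∣ D ∣ ∣ D′ ∣)))))
               (+-monoˡ-≤ fuel (+-monoʳ-≤ ∣ D ∣ grows))))
      ... | no ¬v | no ¬v′ = X ─ D , Y ─ D′ , p─q⊆p X D , p─q⊆p Y D′ ,
        left X D (Removable.∣D∣<s r) , left Y D′ (Removable.∣D∣<s r′) ,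
        ¬violates⇒Expands ¬v , ¬violates⇒Expands ¬v′
        where
        left : ∀ X D → ∣ D ∣ < s → ∣ X ∣ ≤ s + ∣ X ─ D ∣
        left X D D< = ≤-trans (∣p∣≤∣q∣+∣p─q∣ X D) (+-monoˡ-≤ ∣ X ─ D ∣ (<⇒≤ D<))

-- Simple paths and their closure to cycles.

module Paths where

  open import Data.Fin using (Fin; zero; suc; toℕ)
  open import Data.Fin.Subset using (Subset; _∈_; _∪_; _⊆_; ⁅_⁆)
  open import Data.Fin.Subset.Properties using (x∈p∪q⁺; x∈⁅x⁆)
  open import Data.List using (List; []; _∷_; _++_; length; lookup; applyUpTo)
  open import Data.List.Membership.Propositional using () renaming (_∈_ to _∈ˡ_)
  open import Data.List.Membership.Propositional.Properties
    using (∈-++⁻; ∈-lookup; ∈-applyUpTo⁻)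
  open import Data.List.Properties using (length-++; length-applyUpTo)
  open import Data.List.Relation.Unary.All as All using (All; []; _∷_)
  open import Data.List.Relation.Unary.Any using (here; there)
  open import Data.List.Relation.Unary.Unique.Propositional using (Unique; []; _∷_)
  open import Data.List.Relation.Unary.Unique.Propositional.Properties
    using (++⁺; applyUpTo⁺₁; Unique[x∷xs]⇒x∉xs)
  open import Data.Nat using (ℕ; zero; suc; _+_; _<_; _≤_; s≤s; z<s; s<s)
  open import Data.Nat.Properties using (suc-injective; +-comm)
  open import Data.Product using (∃-syntax; _×_; _,_)
  open import Data.Sum using (inj₁; inj₂)
  open import Function using (_∘_)
  open import Function.Definitions using (Injective)
  open import Relation.Binary.PropositionalEquality
  open import Relation.Nullary using (contradiction)

  open import Defs using (IsNext)
  open FiniteSets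

  lookup-injective : {A : Set} {xs : List A} → Unique xs → ∀ i j → lookup xs i ≡ lookup xs j → i ≡ j
  lookup-injective (_ ∷ _) zero zero _ = refl
  lookup-injective (x∉ ∷ _) zero (suc j) eq = contradiction eq (All.lookup x∉ (∈-lookup j))
  lookup-injective (x∉ ∷ _) (suc i) zero eq = contradiction (sym eq) (All.lookup x∉ (∈-lookup i))
  lookup-injective (_ ∷ u) (suc i) (suc j) eq = cong suc (lookup-injective u i j eq)

  module Walks {N : ℕ} (E : Fin N → Fin N → Set) (E-sym : ∀ {x y} → E x y → E y x) where

    data Path : Fin N → Fin N → List (Fin N) → Set where
      stop : ∀ u → Path u u (u ∷ [])
      step : ∀ {u v w xs} → E u w → Path w v xs → Path u v (u ∷ xs)

    infixr 5 _++⟨_⟩_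
    _++⟨_⟩_ : ∀ {u v w z xs ys} → Path u v xs → E v w → Path w z ys → Path u z (xs ++ ys)
    stop u   ++⟨ e ⟩ q = step e q
    step f p ++⟨ e ⟩ q = step f (p ++⟨ e ⟩ q)

    reversePath : ∀ {u v xs} → Path u v xs → Unique xs →
      ∃[ ys ] Path v u ys × Unique ys × length ys ≡ length xs × (∀ {x} → x ∈ˡ ys → x ∈ˡ xs)
    reversePath (stop u) uniq = u ∷ [] , stop u , uniq , refl , λ x∈ → x∈
    reversePath (step {u} {xs = xs} e p) uniq@(_ ∷ uniq′) with reversePath p uniq′
    ... | ys , q , uniq-ys , len , ys⊆ =
      ys ++ u ∷ [] , q ++⟨ E-sym e ⟩ stop u ,
      ++⁺ uniq-ys ([] ∷ []) (λ { (x∈ys , here refl) → Unique[x∷xs]⇒x∉xs uniq (ys⊆ x∈ys) }) ,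
      trans (length-++ ys) (trans (+-comm (length ys) 1) (cong suc len)) , ⊆xs
      where
      ⊆xs : ∀ {x} → x ∈ˡ ys ++ u ∷ [] → x ∈ˡ u ∷ xs
      ⊆xs x∈ with ∈-++⁻ ys x∈
      ... | inj₁ x∈ys = there (ys⊆ x∈ys)
      ... | inj₂ (here refl) = here refl

    path-lookup-next : ∀ {u v xs} → Path u v xs → ∀ i j → toℕ j ≡ suc (toℕ i) →
                       E (lookup xs i) (lookup xs j)
    path-lookup-next (stop u) zero zero ()
    path-lookup-next (step e (stop _)) zero (suc zero) _ = e
    path-lookup-next (step e (step _ _)) zero (suc zero) _ = e
    path-lookup-next (step e (step _ _)) zero (suc (suc _)) ()
    path-lookup-next (step e p) (suc i) (suc j) eq = path-lookup-next p i j (suc-injective eq)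

    path-lookup-first : ∀ {u v xs} → Path u v xs → ∀ j → toℕ j ≡ 0 → lookup xs j ≡ u
    path-lookup-first (stop u)   zero _ = refl
    path-lookup-first (step _ _) zero _ = refl

    path-lookup-last : ∀ {u v xs} → Path u v xs → ∀ i → suc (toℕ i) ≡ length xs → lookup xs i ≡ v
    path-lookup-last (stop u)            zero    _  = refl
    path-lookup-last (step e (stop _))   zero    ()
    path-lookup-last (step e (step _ _)) zero    ()
    path-lookup-last (step e p)          (suc i) eq = path-lookup-last p i (suc-injective eq)

    applyUpTo-path : ∀ k (p : ℕ → Fin N) → (∀ i → i < k → E (p i) (p (suc i))) →
                     Path (p 0) (p k) (applyUpTo p (suc k))
    applyUpTo-path zero    p e = stop (p 0)
    applyUpTo-path (suc k) p e = step (e 0 z<s) (applyUpTo-path k (p ∘ suc) λ i i<k → e (suc i) (s<s i<k))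

    -- The index n counts vertices, not edges.
    record SimplePath (F : Subset N) (u v : Fin N) (n : ℕ) : Set where
      field
        {vertices} : List (Fin N)
        path       : Path u v vertices
        unique     : Unique vertices
        size       : length vertices ≡ n
        within     : ∀ {x} → x ∈ˡ vertices → x ∈ F

    open SimplePath

    single : ∀ u → SimplePath ⁅ u ⁆ u u 1
    single u = record { path = stop u ; unique = [] ∷ [] ; size = refl
                      ; within = λ { (here refl) → x∈⁅x⁆ u } }

    widen : ∀ {F G u v n} → F ⊆ G → SimplePath F u v n → SimplePath G u v n
    widen F⊆G p = record { path = path p ; unique = unique p ; size = size p ; within = F⊆G ∘ within p }

    join : ∀ {F G u v w z m n} → Disjoint F G →
           SimplePath F u v m → E v w → SimplePath G w z n → SimplePath (F ∪ G) u z (m + n)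
    join F#G p e q = record
      { path   = path p ++⟨ e ⟩ path q
      ; unique = ++⁺ (unique p) (unique q) λ (x∈p , x∈q) → F#G (within p x∈p) (within q x∈q)
      ; size   = trans (length-++ (vertices p)) (cong₂ _+_ (size p) (size q))
      ; within = λ x∈ → x∈p∪q⁺ (inside x∈)
      }
      where
      inside : ∀ {x} → x ∈ˡ vertices p ++ vertices q → _
      inside x∈ with ∈-++⁻ (vertices p) x∈
      ... | inj₁ x∈p = inj₁ (within p x∈p)
      ... | inj₂ x∈q = inj₂ (within q x∈q)

    backwards : ∀ {F u v n} → SimplePath F u v n → SimplePath F v u n
    backwards p with reversePath (path p) (unique p)
    ... | ys , q , uniq , len , ys⊆ = record
      { path = q ; unique = uniq ; size = trans len (size p) ; within = within p ∘ ys⊆ }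

    segment : ∀ {F} k (p : ℕ → Fin N) → (∀ i → i < k → E (p i) (p (suc i))) →
              (∀ {i j} → i < j → j ≤ k → p i ≢ p j) → (∀ i → i ≤ k → p i ∈ F) →
              SimplePath F (p 0) (p k) (suc k)
    segment {F} k p e distinct p∈F = record
      { path   = applyUpTo-path k p e
      ; unique = applyUpTo⁺₁ p (suc k) λ { i<j (s≤s j≤k) → distinct i<j j≤k }
      ; size   = length-applyUpTo p (suc k)
      ; within = λ x∈ → in-F (∈-applyUpTo⁻ p x∈)
      }
      where
      in-F : ∀ {x} → ∃[ i ] i < suc k × x ≡ p i → x ∈ F
      in-F (i , s≤s i≤k , refl) = p∈F i i≤k

    -- Only the pairs in cyclic order are recorded; the reversed pairs in `CycleAdj` are recovered
    -- from the symmetry of `E`.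
    record Cycle (ℓ : ℕ) : Set where
      field
        embed     : Fin ℓ → Fin N
        injective : Injective _≡_ _≡_ embed
        next      : ∀ i j → IsNext ℓ i j → E (embed i) (embed j)

    close : ∀ {F u v n} → SimplePath F u v n → E v u → Cycle n
    close p e = subst Cycle (size p) record
      { embed     = lookup (vertices p)
      ; injective = lookup-injective (unique p) _ _
      ; next      = λ { i j (inj₁ eq) → path-lookup-next (path p) i j eq
                      ; i j (inj₂ (end , start)) →
                          subst₂ E (sym (path-lookup-last (path p) i end))
                                   (sym (path-lookup-first (path p) j start)) e }
      }

-- Two disjoint binary trees in an expanding bipartite graph.

module Trees where

  open import Data.Bool using (Bool; true; false; not; _≟_)
  open import Data.Bool.Properties using (¬-not)
  open import Data.Fin using (Fin)
  open import Data.Fin.Subset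
  open import Data.Fin.Subset.Properties
  open import Data.Nat hiding (_≟_)
  open import Data.Nat.Properties hiding (_≟_)
  open import Data.Nat.Tactic.RingSolver using (solve-∀)
  open import Data.Product using (∃-syntax; ∃₂; _×_; _,_; proj₁; proj₂)
  open import Data.Sum using (_⊎_; inj₁; inj₂)
  open import Function using (_∘_)
  open import Relation.Binary.PropositionalEquality
  open import Relation.Nullary using (Dec; yes; no; contradiction)

  open FiniteSets
  open Expansion
  open Paths

  -- The side on which an alternating walk with `n` edges ends when it starts on side `b`; all
  -- parity arguments are carried by it.
  flip : ℕ → Bool → Bool
  flip zero    b = b
  flip (suc n) b = not (flip n b)

  flip-not : ∀ n b → flip n (not b) ≡ not (flip n b)
  flip-not zero    b = refl
  flip-not (suc n) b = cong not (flip-not n b)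

  flip-+ : ∀ m n b → flip (m + n) b ≡ flip m (flip n b)
  flip-+ zero    n b = refl
  flip-+ (suc m) n b = cong not (flip-+ m n b)

  flip-comm : ∀ m n b → flip m (flip n b) ≡ flip n (flip m b)
  flip-comm m n b = trans (sym (flip-+ m n b)) (trans (cong (λ k → flip k b) (+-comm m n)) (flip-+ n m b))

  ≡⊎≡not : ∀ b c → c ≡ b ⊎ c ≡ not b
  ≡⊎≡not b c with c ≟ b
  ... | yes c≡b = inj₁ c≡b
  ... | no  c≢b = inj₂ (¬-not c≢b)

  Disjoint-not : ∀ {N} (Q : Bool → Subset N) → Disjoint (Q true) (Q false) → ∀ b → Disjoint (Q b) (Q (not b))
  Disjoint-not Q Q# true  = Q#
  Disjoint-not Q Q# false = Disjoint-sym Q#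

  module Growth {N : ℕ} (E : Fin N → Fin N → Set) (E? : ∀ x y → Dec (E x y))
                (E-sym : ∀ {x y} → E x y → E y x) (s : ℕ) (Q : Bool → Subset N)
                (Q# : Disjoint (Q true) (Q false))
                (expands : ∀ b → Neighbourhoods.Expands E E? E-sym s (Q b) (Q (not b))) where

    open Neighbourhoods E E? E-sym
    open Walks E E-sym

    -- Of the tree, only the vertex set F, the leaves A and the branches are kept.
    record Tree (u : Fin N) (b : Bool) (j : ℕ) : Set where
      field
        F A    : Subset N
        A⊆Q    : A ⊆ Q (flip j b)
        A⊆F    : A ⊆ F
        ∣A∣    : ∣ A ∣ ≡ 2 ^ j
        ∣F∣    : ∣ F ∣ < 2 ^ suc j
        ∣F∩Q∣  : ∀ c → 2 * ∣ F ∩ Q c ∣ ≤ 3 * 2 ^ j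
        ∣F∩Q′∣ : ∣ F ∩ Q (not (flip j b)) ∣ ≤ 2 ^ j
        branch : ∀ {a} → a ∈ A → SimplePath F u a (suc j)

    open Tree

    root : ∀ {u b} → u ∈ Q b → Tree u b 0
    root {u} {b} u∈Q = record
      { F = ⁅ u ⁆ ; A = ⁅ u ⁆
      ; A⊆Q = λ x∈ → subst (_∈ Q b) (sym (x∈⁅y⁆⇒x≡y u x∈)) u∈Q
      ; A⊆F = λ x∈ → x∈
      ; ∣A∣ = ∣⁅x⁆∣≡1 u
      ; ∣F∣ = s≤s (≤-reflexive (∣⁅x⁆∣≡1 u))
      ; ∣F∩Q∣ = λ c → ≤-trans (*-monoʳ-≤ 2 (≤1 c)) (n≤1+n 2)
      ; ∣F∩Q′∣ = ≤1 (not b)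
      ; branch = λ x∈ → subst (λ a → SimplePath ⁅ u ⁆ u a 1) (sym (x∈⁅y⁆⇒x≡y u x∈)) (single u)
      }
      where
      ≤1 : ∀ c → ∣ ⁅ u ⁆ ∩ Q c ∣ ≤ 1
      ≤1 c = ≤-trans (∣p∩q∣≤∣p∣ ⁅ u ⁆ (Q c)) (≤-reflexive (∣⁅x⁆∣≡1 u))

    -- The factor `6` is `1 + 3 + 2`: of the `6 * 2 ^ j` neighbours of the leaves, at most `2 ^ j`
    -- lie in the tree, at most `3 * 2 ^ j` in `R`, and `2 * 2 ^ j` remain as new leaves. Only
    -- vertices on the side of the new leaves are in the way, hence the bounds per side. These
    -- reproduce themselves: the new leaf side has at most `2 ^ j + 2 ^ suc j` vertices, which is
    -- `3/2` of `2 ^ suc j`, and the old leaf side has at most `3/2` of `2 ^ j`, less than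
    -- `2 ^ suc j`.
    extend : ∀ {u b j} (t : Tree u b j) R → Disjoint (F t) R →
             ∣ R ∩ Q (flip (suc j) b) ∣ ≤ 3 * 2 ^ j → 2 ^ j ≤ s →
             ∃[ t′ ] Disjoint (F {u} {b} {suc j} t′) R
    extend {u} {b} {j} t R F#R R≤ 2^j≤s = record
      { F = F t ∪ A′ ; A = A′
      ; A⊆Q = proj₁ ∘ A′⊆
      ; A⊆F = q⊆p∪q (F t) A′
      ; ∣A∣ = ∣A′∣
      ; ∣F∣ = begin-strict
          ∣ F t ∪ A′ ∣             ≤⟨ ∣p∪q∣≤∣p∣+∣q∣ (F t) A′ ⟩
          ∣ F t ∣ + ∣ A′ ∣         <⟨ +-mono-<-≤ (∣F∣ t) (≤-reflexive ∣A′∣) ⟩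
          2 ^ suc j + 2 ^ suc j    ≡⟨ cong (2 ^ suc j +_) (+-identityʳ (2 ^ suc j)) ⟨
          2 ^ suc (suc j)          ∎
      ; ∣F∩Q∣ = each
      ; ∣F∩Q′∣ = *-cancelˡ-≤ 2 (begin
          2 * ∣ (F t ∪ A′) ∩ Q (not Q′) ∣   ≤⟨ *-monoʳ-≤ 2 old ⟩
          2 * ∣ F t ∩ Q (not Q′) ∣          ≤⟨ ∣F∩Q∣ t (not Q′) ⟩
          3 * 2 ^ j                         ≤⟨ *-monoˡ-≤ (2 ^ j) (n≤1+n 3) ⟩
          4 * 2 ^ j                         ≡⟨ *-assoc 2 2 (2 ^ j) ⟩
          2 * 2 ^ suc j                     ∎)
      ; branch = λ {a′} a′∈ →
          let (a , a∈A , eaa′) = ∈-nbr⁻ {A t} (proj₁ (proj₂ (A′⊆ a′∈)))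
          in subst (SimplePath _ u a′) (+-comm (suc j) 1)
               (widen (λ x∈ → x∈p∪q⁺ (Data.Sum.map₂
                   (λ x∈′ → subst (_∈ A′) (sym (x∈⁅y⁆⇒x≡y a′ x∈′)) a′∈) (x∈p∪q⁻ (F t) ⁅ a′ ⁆ x∈)))
                 (join (λ x∈F x∈′ → proj₁ (proj₂ (proj₂ (A′⊆ a′∈)))
                          (subst (_∈ F t) (x∈⁅y⁆⇒x≡y a′ x∈′) x∈F))
                       (branch t a∈A) eaa′ (single a′)))
      } , λ x∈ x∈R → disj (x∈p∪q⁻ (F t) A′ x∈) x∈R
      where
      open ≤-Reasoning
      Q′ : Bool
      Q′ = flip (suc j) b
      X = nbr (A t) ∩ Q Q′
      Y = (X ─ F t) ─ R
      count : 6 * 2 ^ j ≤ 4 * 2 ^ j + ∣ Y ∣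
      count = begin
        6 * 2 ^ j                                  ≡⟨ cong (6 *_) (∣A∣ t) ⟨
        6 * ∣ A t ∣                                ≤⟨ expands (flip j b) (A⊆Q t) (subst (_≤ s) (sym (∣A∣ t)) 2^j≤s) ⟩
        ∣ X ∣                                      ≤⟨ ∣-∣-cover X (F t ∩ Q Q′) (X ─ F t) (λ x∈ x∉ →
                                                       x∈p∧x∉q⇒x∈p─q x∈ λ x∈F →
                                                         x∉ (x∈p∩q⁺ (x∈F , p∩q⊆q (nbr (A t)) (Q Q′) x∈))) ⟩
        ∣ F t ∩ Q Q′ ∣ + ∣ X ─ F t ∣               ≤⟨ +-mono-≤ (∣F∩Q′∣ t) (∣-∣-cover (X ─ F t) (R ∩ Q Q′) Y λ x∈ x∉ →
                                                       x∈p∧x∉q⇒x∈p─q x∈ λ x∈R →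
                                                         x∉ (x∈p∩q⁺ (x∈R , p∩q⊆q (nbr (A t)) (Q Q′) (p─q⊆p X (F t) x∈)))) ⟩
        2 ^ j + (∣ R ∩ Q Q′ ∣ + ∣ Y ∣)             ≤⟨ +-monoʳ-≤ (2 ^ j) (+-monoˡ-≤ ∣ Y ∣ R≤) ⟩
        2 ^ j + (3 * 2 ^ j + ∣ Y ∣)                ≡⟨ +-assoc (2 ^ j) (3 * 2 ^ j) ∣ Y ∣ ⟨
        4 * 2 ^ j + ∣ Y ∣                          ∎
      chosen : ∃[ A′ ] A′ ⊆ Y × ∣ A′ ∣ ≡ 2 ^ suc j
      chosen = subset-of-size (2 ^ suc j) Y (+-cancelˡ-≤ (4 * 2 ^ j) _ _
        (subst (_≤ 4 * 2 ^ j + ∣ Y ∣) (*-distribʳ-+ (2 ^ j) 4 2) count))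
      A′ = proj₁ chosen
      ∣A′∣ = proj₂ (proj₂ chosen)
      A′⊆ : ∀ {x} → x ∈ A′ → x ∈ Q Q′ × x ∈ nbr (A t) × x ∉ F t × x ∉ R
      A′⊆ x∈ =
        let (x∈X─F , x∉R) = x∈p─q⁻ (X ─ F t) R (proj₁ (proj₂ chosen) x∈)
            (x∈X , x∉F)   = x∈p─q⁻ X (F t) x∈X─F
            (x∈nbr , x∈Q) = x∈p∩q⁻ (nbr (A t)) (Q Q′) x∈X
        in x∈Q , x∈nbr , x∉F , x∉R
      disj : ∀ {x} → x ∈ F t ⊎ x ∈ A′ → x ∉ R
      disj (inj₁ x∈F) = F#R x∈F
      disj (inj₂ x∈A) = proj₂ (proj₂ (proj₂ (A′⊆ x∈A)))
      old : ∣ (F t ∪ A′) ∩ Q (not Q′) ∣ ≤ ∣ F t ∩ Q (not Q′) ∣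
      old = p⊆q⇒∣p∣≤∣q∣ sub
        where
        sub : (F t ∪ A′) ∩ Q (not Q′) ⊆ F t ∩ Q (not Q′)
        sub x∈ with x∈p∩q⁻ (F t ∪ A′) _ x∈
        ... | x∈FA , x∈Q with x∈p∪q⁻ (F t) A′ x∈FA
        ... | inj₁ x∈F = x∈p∩q⁺ (x∈F , x∈Q)
        ... | inj₂ x∈A = contradiction x∈Q (Disjoint-not Q Q# Q′ (proj₁ (A′⊆ x∈A)))
      each : ∀ c → 2 * ∣ (F t ∪ A′) ∩ Q c ∣ ≤ 3 * 2 ^ suc j
      each c with ≡⊎≡not Q′ c
      ... | inj₁ refl = begin
        2 * ∣ (F t ∪ A′) ∩ Q Q′ ∣                 ≤⟨ *-monoʳ-≤ 2 (∣-∣-cover ((F t ∪ A′) ∩ Q Q′) (F t ∩ Q Q′) A′ new) ⟩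
        2 * (∣ F t ∩ Q Q′ ∣ + ∣ A′ ∣)             ≤⟨ *-monoʳ-≤ 2 (+-mono-≤ (∣F∩Q′∣ t) (≤-reflexive ∣A′∣)) ⟩
        2 * (3 * 2 ^ j)                           ≡⟨ swap (2 ^ j) ⟩
        3 * 2 ^ suc j                             ∎
        where
        swap : ∀ k → 2 * (3 * k) ≡ 3 * (2 * k)
        swap = solve-∀
        new : ∀ {x} → x ∈ (F t ∪ A′) ∩ Q Q′ → x ∉ F t ∩ Q Q′ → x ∈ A′
        new x∈ x∉ with x∈p∩q⁻ (F t ∪ A′) _ x∈
        ... | x∈FA , x∈Q with x∈p∪q⁻ (F t) A′ x∈FA
        ... | inj₁ x∈F = contradiction (x∈p∩q⁺ (x∈F , x∈Q)) x∉
        ... | inj₂ x∈A = x∈A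
      ... | inj₂ refl = begin
        2 * ∣ (F t ∪ A′) ∩ Q (not Q′) ∣           ≤⟨ *-monoʳ-≤ 2 old ⟩
        2 * ∣ F t ∩ Q (not Q′) ∣                  ≤⟨ ∣F∩Q∣ t (not Q′) ⟩
        3 * 2 ^ j                                 ≤⟨ *-monoʳ-≤ 3 (m≤n*m (2 ^ j) 2) ⟩
        3 * 2 ^ suc j                             ∎

    -- The trees grow in turn. When `t` gains a level, `t′` blocks at most `3/2` of `2 ^ d` vertices
    -- on the relevant side; when `t′` follows, the taller `t₊` blocks up to `3 * 2 ^ d`, which is
    -- exactly what `extend` tolerates.
    twoTrees : ∀ {u v b c} → u ≢ v → u ∈ Q b → v ∈ Q c → ∀ d → (∀ j → j < d → 2 ^ j ≤ s) →
               ∃₂ λ (t : Tree u b d) (t′ : Tree v c d) → Disjoint (F t) (F t′)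
    twoTrees u≢v u∈Q v∈Q zero _ = root u∈Q , root v∈Q ,
      λ x∈u x∈v → u≢v (trans (sym (x∈⁅y⁆⇒x≡y _ x∈u)) (x∈⁅y⁆⇒x≡y _ x∈v))
    twoTrees {u} {v} {b} {c} u≢v u∈Q v∈Q (suc d) small =
      let (t , t′ , t#t′) = twoTrees u≢v u∈Q v∈Q d λ j j<d → small j (m<n⇒m<1+n j<d)
          2^d≤s = small d ≤-refl
          (t₊ , t₊#t′) = extend t (F t′) t#t′ (≤-trans (m≤n*m _ 2) (∣F∩Q∣ t′ (flip (suc d) b))) 2^d≤s
          (t′₊ , t′₊#t₊) = extend t′ (F t₊) (Disjoint-sym t₊#t′) (*-cancelˡ-≤ 2 (begin
              2 * ∣ F t₊ ∩ Q (flip (suc d) c) ∣    ≤⟨ ∣F∩Q∣ t₊ (flip (suc d) c) ⟩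
              3 * 2 ^ suc d                        ≡⟨ swap (2 ^ d) ⟩
              2 * (3 * 2 ^ d)                      ∎)) 2^d≤s
      in t₊ , t′₊ , Disjoint-sym t′₊#t₊
      where
      open ≤-Reasoning
      swap : ∀ k → 3 * (2 * k) ≡ 2 * (3 * k)
      swap = solve-∀

-- Long alternating paths by depth-first search.

module DepthFirst where

  open import Data.Bool using (Bool; true; false; not)
  open import Data.Fin using (Fin)
  open import Data.Fin.Properties using (any?)
  open import Data.Fin.Subset
  open import Data.Fin.Subset.Properties
  open import Data.Nat hiding (∣_-_∣)
  open import Data.Nat.Properties
  open import Data.Product using (∃-syntax; ∃₂; _×_; _,_; proj₁; proj₂)
  open import Data.Sum using (_⊎_; inj₁; inj₂)
  open import Function using (_∘_)
  open import Relation.Binary.PropositionalEquality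
  open import Relation.Nullary using (¬_; Dec; yes; no; contradiction)
  open import Relation.Nullary.Decidable using (_×-dec_)

  open FiniteSets
  open Expansion
  open Trees using (flip)

  ∣q∣<∣p∣⇒p⊈q : ∀ {N} (p q : Subset N) → ∣ q ∣ < ∣ p ∣ → ∃[ x ] x ∈ p × x ∉ q
  ∣q∣<∣p∣⇒p⊈q p q q<p =
    let (x , x∈) = nonempty (p ─ q) (+-cancelˡ-< ∣ q ∣ _ _
          (<-≤-trans (subst (_< ∣ p ∣) (sym (+-identityʳ ∣ q ∣)) q<p) (∣p∣≤∣q∣+∣p─q∣ p q)))
    in x , x∈p─q⁻ p q x∈

  record AlternatingPath {N : ℕ} (E : Fin N → Fin N → Set) (Z : Bool → Subset N)
                         (p : ℕ → Fin N) (ℓ : ℕ) : Set where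
    field
      side     : ∀ {i} → i < ℓ → p i ∈ Z (flip i true)
      distinct : ∀ {i j} → i < j → j < ℓ → p i ≢ p j
      edge     : ∀ {i} → suc i < ℓ → E (p i) (p (suc i))

  module LongPath {N : ℕ} (E : Fin N → Fin N → Set) (E? : ∀ x y → Dec (E x y))
                  (E-sym : ∀ {x y} → E x y → E y x) (s : ℕ) (Z : Bool → Subset N)
                  (Z# : Disjoint (Z true) (Z false))
                  (joined : ∀ b → Neighbourhoods.Joined E E? E-sym s (Z b) (Z (not b))) where

    open AlternatingPath

    private

      -- Depth-first search: U is unvisited, D is finished, p 0 , … , p (ℓ-1) is the stack.
      record Search (ℓ : ℕ) (U D : Subset N) : Set where
        field
          p       : ℕ → Fin N
          isPath  : AlternatingPath E Z p ℓ
          visited : ∀ {i} → i < ℓ → p i ∉ U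
          cover   : ∀ {b x} → x ∈ Z b → x ∉ U → x ∉ D → ∃[ i ] i < ℓ × p i ≡ x
          apart   : ∀ {b x y} → x ∈ D ∩ Z b → y ∈ U ∩ Z (not b) → ¬ E x y

      open Search

      update : (ℕ → Fin N) → ℕ → Fin N → ℕ → Fin N
      update p ℓ x i with i ≟ ℓ
      ... | yes _ = x
      ... | no  _ = p i

      update-= : ∀ p ℓ x → update p ℓ x ℓ ≡ x
      update-= p ℓ x with ℓ ≟ ℓ
      ... | yes _ = refl
      ... | no ≢  = contradiction refl ≢

      update-< : ∀ p ℓ x {i} → i < ℓ → update p ℓ x i ≡ p i
      update-< p ℓ x {i} i<ℓ with i ≟ ℓ
      ... | yes refl = contradiction i<ℓ (n≮n i)
      ... | no _ = refl

      <suc : ∀ {i ℓ} → i < suc ℓ → i < ℓ ⊎ i ≡ ℓ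
      <suc (s≤s i≤ℓ) = m≤n⇒m<n∨m≡n i≤ℓ

      push : ∀ {ℓ U D} (σ : Search ℓ U D) x → x ∈ U → x ∈ Z (flip ℓ true) →
             (∀ {l} → ℓ ≡ suc l → E (p σ l) x) → Search (suc ℓ) (U - x) D
      push {ℓ} {U} {D} σ x x∈U x∈Z exy = record
        { p = q ; isPath = record { side = side′ ; distinct = distinct′ ; edge = edge′ }
        ; visited = visited′ ; cover = cover′
        ; apart = λ x∈ y∈ → let (y∈U , y∈Z) = x∈p∩q⁻ (U - x) _ y∈ in
            apart σ x∈ (x∈p∩q⁺ (p─q⊆p U ⁅ x ⁆ y∈U , y∈Z)) }
        where
        q = update (p σ) ℓ x
        q= = update-= (p σ) ℓ x
        q< : ∀ {i} → i < ℓ → q i ≡ p σ i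
        q< = update-< (p σ) ℓ x
        side′ : ∀ {i} → i < suc ℓ → q i ∈ Z (flip i true)
        side′ {i} i<sℓ with <suc i<sℓ
        ... | inj₁ i<ℓ = subst (_∈ Z (flip i true)) (sym (q< i<ℓ)) (side (isPath σ) i<ℓ)
        ... | inj₂ refl = subst (_∈ Z (flip ℓ true)) (sym q=) x∈Z
        distinct′ : ∀ {i j} → i < j → j < suc ℓ → q i ≢ q j
        distinct′ {i} {j} i<j j<sℓ eq with <suc j<sℓ
        ... | inj₁ j<ℓ = distinct (isPath σ) i<j j<ℓ (trans (sym (q< (<-trans i<j j<ℓ))) (trans eq (q< j<ℓ)))
        ... | inj₂ refl = visited σ i<j (subst (_∈ U) (sym (trans (sym (q< i<j)) (trans eq q=))) x∈U)
        edge′ : ∀ {i} → suc i < suc ℓ → E (q i) (q (suc i))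
        edge′ {i} si<sℓ with <suc si<sℓ
        ... | inj₁ si<ℓ = subst₂ E (sym (q< (<⇒≤ si<ℓ))) (sym (q< si<ℓ)) (edge (isPath σ) si<ℓ)
        ... | inj₂ refl = subst₂ E (sym (q< ≤-refl)) (sym q=) (exy refl)
        visited′ : ∀ {i} → i < suc ℓ → q i ∉ U - x
        visited′ {i} i<sℓ qi∈ with <suc i<sℓ
        ... | inj₁ i<ℓ = visited σ i<ℓ (subst (_∈ U) (q< i<ℓ) (p─q⊆p U ⁅ x ⁆ qi∈))
        ... | inj₂ refl = proj₂ (x∈p─q⁻ U ⁅ x ⁆ qi∈) (subst (_∈ ⁅ x ⁆) (sym q=) (x∈⁅x⁆ x))
        cover′ : ∀ {b y} → y ∈ Z b → y ∉ U - x → y ∉ D → ∃[ i ] i < suc ℓ × q i ≡ y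
        cover′ {b} {y} y∈Z y∉U y∉D with y Data.Fin.≟ x
        ... | yes refl = ℓ , ≤-refl , q=
        ... | no  y≢x =
          let (i , i<ℓ , pi≡y) = cover σ y∈Z (λ y∈U → y∉U (x∈p∧x≢y⇒x∈p-y y∈U y≢x)) y∉D
          in i , m<n⇒m<1+n i<ℓ , trans (q< i<ℓ) pi≡y

      pop : ∀ {ℓ U D} (σ : Search (suc ℓ) U D) →
            ¬ (∃[ y ] y ∈ U ∩ Z (flip (suc ℓ) true) × E (p σ ℓ) y) →
            Search ℓ U (⁅ p σ ℓ ⁆ ∪ D)
      pop {ℓ} {U} {D} σ stuck = record
        { p = p σ
        ; isPath = record { side = side (isPath σ) ∘ m<n⇒m<1+n
                          ; distinct = λ i<j → distinct (isPath σ) i<j ∘ m<n⇒m<1+n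
                          ; edge = edge (isPath σ) ∘ m<n⇒m<1+n }
        ; visited = visited σ ∘ m<n⇒m<1+n
        ; cover = cover′
        ; apart = apart′ }
        where
        top∈ : p σ ℓ ∈ Z (flip ℓ true)
        top∈ = side (isPath σ) ≤-refl
        cover′ : ∀ {b x} → x ∈ Z b → x ∉ U → x ∉ ⁅ p σ ℓ ⁆ ∪ D → ∃[ i ] i < ℓ × p σ i ≡ x
        cover′ x∈Z x∉U x∉ with cover σ x∈Z x∉U (x∉ ∘ q⊆p∪q ⁅ p σ ℓ ⁆ D)
        ... | i , i<sℓ , eq with <suc i<sℓ
        ... | inj₁ i<ℓ = i , i<ℓ , eq
        ... | inj₂ refl = contradiction
          (p⊆p∪q D (subst (_∈ ⁅ p σ ℓ ⁆) eq (x∈⁅x⁆ (p σ ℓ)))) x∉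
        -- `apart` must hold for every side on which the popped vertex is found, while `stuck`
        -- concerns the side given by its position on the stack. Disjointness of the sides
        -- identifies the two.
        same-side : ∀ b c {x} → x ∈ Z b → x ∈ Z c → b ≡ c
        same-side true  true  _ _ = refl
        same-side false false _ _ = refl
        same-side true  false x∈ x∈′ = contradiction x∈′ (Z# x∈)
        same-side false true  x∈ x∈′ = contradiction x∈ (Z# x∈′)
        apart′ : ∀ {b x y} → x ∈ (⁅ p σ ℓ ⁆ ∪ D) ∩ Z b → y ∈ U ∩ Z (not b) → ¬ E x y
        apart′ {b} {x} {y} x∈ y∈ exy with x∈p∩q⁻ (⁅ p σ ℓ ⁆ ∪ D) (Z b) x∈
        ... | x∈∪ , x∈Z with x∈p∪q⁻ ⁅ p σ ℓ ⁆ D x∈∪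
        ... | inj₂ x∈D = apart σ (x∈p∩q⁺ (x∈D , x∈Z)) y∈ exy
        ... | inj₁ x∈₁ with x∈⁅y⁆⇒x≡y (p σ ℓ) x∈₁
        ... | refl with same-side b (flip ℓ true) x∈Z top∈
        ... | refl = stuck (y , y∈ , exy)

    module _ (m : ℕ) (0<s : 0 < s) (large : ∀ b → s + s + m ≤ ∣ Z b ∣) where

      private

        size≤ : ∀ {ℓ U D} → Search ℓ U D → ∀ b → ∣ Z b ∣ ≤ ∣ U ∩ Z b ∣ + (∣ D ∩ Z b ∣ + ℓ)
        size≤ {ℓ} {U} {D} σ b = ≤-trans
          (∣-∣-cover (Z b) (U ∩ Z b) (Z b ─ U) λ x∈Z x∉ → x∈p∧x∉q⇒x∈p─q x∈Z λ x∈U → x∉ (x∈p∩q⁺ (x∈U , x∈Z)))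
          (+-monoʳ-≤ ∣ U ∩ Z b ∣ (≤-trans
            (∣-∣-cover (Z b ─ U) (D ∩ Z b) stack λ x∈ x∉ →
              let (x∈Z , x∉U) = x∈p─q⁻ (Z b) U x∈
                  (i , i<ℓ , eq) = cover σ x∈Z x∉U λ x∈D → x∉ (x∈p∩q⁺ (x∈D , x∈Z))
              in subst (_∈ stack) eq (∈-stack i<ℓ))
            (+-monoʳ-≤ ∣ D ∩ Z b ∣ (∣stack∣ ℓ (p σ)))))
          where
          upTo : ℕ → (ℕ → Fin N) → Subset N
          upTo zero    q = ⊥
          upTo (suc l) q = ⁅ q l ⁆ ∪ upTo l q
          stack = upTo ℓ (p σ)
          ∈-upTo : ∀ {i} l q → i < l → q i ∈ upTo l q
          ∈-upTo (suc l) q i<sl with <suc i<sl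
          ... | inj₁ i<l = q⊆p∪q ⁅ q l ⁆ _ (∈-upTo l q i<l)
          ... | inj₂ refl = p⊆p∪q _ (x∈⁅x⁆ (q l))
          ∈-stack : ∀ {i} → i < ℓ → p σ i ∈ stack
          ∈-stack = ∈-upTo ℓ (p σ)
          ∣stack∣ : ∀ l q → ∣ upTo l q ∣ ≤ l
          ∣stack∣ zero    q = ≤-reflexive (∣⊥∣≡0 N)
          ∣stack∣ (suc l) q = ≤-trans (∣⁅x⁆∪p∣ (q l) (upTo l q)) (s≤s (∣stack∣ l q))

        -- With `s` finished vertices on side `b`, joinedness leaves fewer than `s` unvisited ones
        -- opposite, because `apart` forbids edges between them. The opposite side then consists of
        -- fewer than `s` unvisited, at most `s` finished and at most `m` stacked vertices, which is
        -- too few.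
        overfull : ∀ {ℓ U D} → Search ℓ U D → ℓ ≤ m → ∀ b → s ≤ ∣ D ∩ Z b ∣ → ¬ (∣ D ∩ Z (not b) ∣ ≤ s)
        overfull {ℓ} {U} {D} σ ℓ≤m b s≤D D≤s = <⇒≱ (begin-strict
            ∣ Z (not b) ∣                                          ≤⟨ size≤ σ (not b) ⟩
            ∣ U ∩ Z (not b) ∣ + (∣ D ∩ Z (not b) ∣ + ℓ)            <⟨ +-mono-<-≤ U<s (+-mono-≤ D≤s ℓ≤m) ⟩
            s + (s + m)                                            ≡⟨ +-assoc s s m ⟨
            s + s + m                                              ∎) (large (not b))
          where
          open ≤-Reasoning
          U<s : ∣ U ∩ Z (not b) ∣ < s
          U<s = ≰⇒> λ s≤U →
            let (x , y , x∈ , y∈ , exy) = joined b (p∩q⊆q D (Z b)) (p∩q⊆q U (Z (not b))) s≤D s≤U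
            in apart σ x∈ y∈ exy

        first : ∀ {U D} → Search 0 U D → ∣ D ∩ Z true ∣ < s → ∃[ x ] x ∈ U × x ∈ Z true
        first {U} {D} σ D<s =
          let (x , x∈ , x∉) = ∣q∣<∣p∣⇒p⊈q (Z true) (D ∩ Z true) (<-≤-trans D<s
                (≤-trans (m≤m+n s s) (≤-trans (m≤m+n (s + s) m) (large true))))
          in x , unvisited x x∈ x∉ , x∈
          where
          unvisited : ∀ x → x ∈ Z true → x ∉ D ∩ Z true → x ∈ U
          unvisited x x∈ x∉ with x ∈? U
          ... | yes x∈U = x∈U
          ... | no  x∉U with cover σ x∈ x∉U (λ x∈D → x∉ (x∈p∩q⁺ (x∈D , x∈)))
          ... | _ , () , _

        pushed : ∀ {U : Subset N} {x ℓ} → x ∈ U → ∣ U - x ∣ + ∣ U - x ∣ + suc ℓ < ∣ U ∣ + ∣ U ∣ + ℓ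
        pushed {U} {x} {ℓ} x∈U = begin
          suc (∣ U - x ∣ + ∣ U - x ∣ + suc ℓ)    ≡⟨ cong suc (+-suc (∣ U - x ∣ + ∣ U - x ∣) ℓ) ⟩
          suc (suc (∣ U - x ∣ + ∣ U - x ∣)) + ℓ  ≡⟨ cong (λ k → suc k + ℓ) (+-suc ∣ U - x ∣ ∣ U - x ∣) ⟨
          suc ∣ U - x ∣ + suc ∣ U - x ∣ + ℓ      ≤⟨ +-monoˡ-≤ ℓ (+-mono-≤ smaller smaller) ⟩
          ∣ U ∣ + ∣ U ∣ + ℓ                      ∎
          where
          open ≤-Reasoning
          smaller = x∈p⇒∣p-x∣<∣p∣ x∈U

        -- Termination rests on the measure `2 ∣U∣ + ℓ`: a push trades an unvisited vertex, worth
        -- two, for a stack entry, worth one, and a pop gives up a stack entry. A pop finishes just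
        -- one vertex, so `< s` becomes `≤ s`, and `overfull` restores the strict bound.
        progress : ∀ ℓ {U D} → Search ℓ U D → (∀ b → ∣ D ∩ Z b ∣ < s) →
                   ∃[ ℓ′ ] ∃₂ λ U′ D′ → Search ℓ′ U′ D′ × ℓ′ ≤ suc ℓ × (∀ b → ∣ D′ ∩ Z b ∣ ≤ s) ×
                     ∣ U′ ∣ + ∣ U′ ∣ + ℓ′ < ∣ U ∣ + ∣ U ∣ + ℓ
        progress zero {U} σ D<s with first σ (D<s true)
        ... | x , x∈U , x∈Z = _ , _ , _ , push σ x x∈U x∈Z (λ ()) , ≤-refl , <⇒≤ ∘ D<s , pushed x∈U
        progress (suc l) {U} {D} σ D<s
          with any? (λ y → (y ∈? U ∩ Z (flip (suc l) true)) ×-dec E? (p σ l) y)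
        ... | yes (y , y∈ , exy) =
          let (y∈U , y∈Z) = x∈p∩q⁻ U _ y∈
          in _ , _ , _ , push σ y y∈U y∈Z (λ { refl → exy }) , ≤-refl , <⇒≤ ∘ D<s , pushed y∈U
        ... | no stuck = _ , _ , _ , pop σ stuck , m≤n⇒m≤1+n (n≤1+n l) ,
          (λ b → ≤-trans (p⊆q⇒∣p∣≤∣q∣ (sub b)) (≤-trans (∣⁅x⁆∪p∣ (p σ l) (D ∩ Z b)) (D<s b))) ,
          +-monoʳ-< (∣ U ∣ + ∣ U ∣) ≤-refl
          where
          sub : ∀ b → (⁅ p σ l ⁆ ∪ D) ∩ Z b ⊆ ⁅ p σ l ⁆ ∪ (D ∩ Z b)
          sub b x∈ with x∈p∩q⁻ (⁅ p σ l ⁆ ∪ D) (Z b) x∈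
          ... | x∈∪ , x∈Z with x∈p∪q⁻ ⁅ p σ l ⁆ D x∈∪
          ... | inj₁ x∈p = x∈p∪q⁺ (inj₁ x∈p)
          ... | inj₂ x∈D = x∈p∪q⁺ (inj₂ (x∈p∩q⁺ (x∈D , x∈Z)))

        search : ∀ fuel {ℓ U D} → Search ℓ U D → ℓ ≤ m → (∀ b → ∣ D ∩ Z b ∣ ≤ s) →
                 ∣ U ∣ + ∣ U ∣ + ℓ < fuel → ∃[ q ] AlternatingPath E Z q m
        search (suc fuel) {ℓ} {U} {D} σ ℓ≤m D≤s enough with ℓ ≟ m
        ... | yes refl = p σ , isPath σ
        ... | no  ℓ≢m  =
          let (_ , _ , _ , σ′ , ℓ′≤ , D′≤s , smaller) = progress ℓ σ D<s
          in search fuel σ′ (≤-trans ℓ′≤ (≤∧≢⇒< ℓ≤m ℓ≢m)) D′≤s (<-≤-trans smaller (s≤s⁻¹ enough))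
          where
          D<s : ∀ b → ∣ D ∩ Z b ∣ < s
          D<s b = ≰⇒> λ s≤D → overfull σ ℓ≤m b s≤D (D≤s (not b))

      longPath : ∃[ q ] AlternatingPath E Z q m
      longPath = search _ σ₀ z≤n none ≤-refl
        where
        -- The stack is a total function on `ℕ`, so even the empty stack needs some vertex as a
        -- value.
        v₀ : Fin N
        v₀ = proj₁ (nonempty (Z true) (<-≤-trans 0<s
          (≤-trans (m≤m+n s s) (≤-trans (m≤m+n (s + s) m) (large true)))))
        σ₀ : Search 0 ⊤ ⊥
        σ₀ = record
          { p = λ _ → v₀
          ; isPath = record { side = λ () ; distinct = λ _ () ; edge = λ () }
          ; visited = λ ()
          ; cover = λ _ x∉⊤ → contradiction ∈⊤ x∉⊤
          ; apart = λ x∈ → contradiction (proj₁ (x∈p∩q⁻ ⊥ _ x∈)) ∉⊥ }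
        none : ∀ b → ∣ ⊥ ∩ Z b ∣ ≤ s
        none b = ≤-trans (∣p∩q∣≤∣p∣ ⊥ (Z b)) (≤-trans (≤-reflexive (∣⊥∣≡0 N)) z≤n)

-- Monochromatic cycles of prescribed length in a joined pair.

module Cycles where

  open import Data.Bool using (Bool; true; false; not)
  open import Data.Bool.Properties using (not-involutive; not-injective)
  open import Data.Fin using (Fin; toℕ)
  open import Data.Fin.Properties using (any?; toℕ<n; toℕ-injective)
  open import Data.Fin.Subset
  open import Data.Fin.Subset.Properties
  open import Data.Nat hiding (∣_-_∣)
  open import Data.Nat.Divisibility using (_∣_; divides; ∣m∣n⇒∣m+n; ∣-refl)
  open import Data.Nat.Properties
  open import Data.Nat.Tactic.RingSolver using (solve-∀)
  open import Data.Product using (∃-syntax; ∃₂; _×_; _,_; proj₁; proj₂)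
  open import Data.Sum using (_⊎_; inj₁; inj₂)
  open import Function using (_∘_)
  open import Relation.Binary.Definitions using (tri<; tri≈; tri>)
  open import Relation.Binary.PropositionalEquality
  open import Relation.Nullary using (¬_; Dec; yes; no; contradiction)
  open import Relation.Nullary.Decidable using (_×-dec_; ¬?)

  open FiniteSets
  open Expansion
  open Paths
  open Trees
  open DepthFirst

  flip-even : ∀ {n} → 2 ∣ n → ∀ b → flip n b ≡ b
  flip-even (divides q refl) b = go q
    where
    go : ∀ q → flip (q * 2) b ≡ b
    go zero    = refl
    go (suc q) = trans (not-involutive _) (go q)

  flip-odd : ∀ n → ¬ 2 ∣ n → ∀ b → flip n b ≡ not b
  flip-odd zero          odd b = contradiction (divides 0 refl) odd
  flip-odd (suc zero)    odd b = refl
  flip-odd (suc (suc n)) odd b =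
    trans (not-involutive _) (flip-odd n (odd ∘ ∣m∣n⇒∣m+n ∣-refl) b)

  -- This `d` becomes the depth of the trees: at least `s` leaves let joinedness act on them, while
  -- `2 ^ d < 2 * s` keeps the inner levels within the range of expansion and both trees together
  -- within `8 * s` vertices.
  power-between : ∀ s → 0 < s → ∃[ d ] s ≤ 2 ^ d × 2 ^ d < 2 * s
  power-between (suc zero)    _ = 0 , ≤-refl , s≤s (s≤s z≤n)
  power-between (suc (suc s)) _ with power-between (suc s) z<s
  ... | d , s≤ , <2s with suc (suc s) ≤? 2 ^ d
  ... | yes ss≤ = d , ss≤ , <-trans <2s (*-monoʳ-< 2 (n<1+n (suc s)))
  ... | no  ss≰ = suc d , ≤-trans (+-mono-≤ (s≤s (z≤n {s})) (m≤m+n (suc s) 0)) (*-monoʳ-≤ 2 s≤) ,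
                  *-monoʳ-< 2 (≰⇒> ss≰)

  module CycleInBipartite {N : ℕ} (E : Fin N → Fin N → Set) (E? : ∀ x y → Dec (E x y))
           (E-sym : ∀ {x y} → E x y → E y x) (s : ℕ) (0<s : 0 < s)
           (P : Bool → Subset N) (P# : Disjoint (P true) (P false))
           (joined : Neighbourhoods.Joined E E? E-sym s (P true) (P false))
           (large : ∀ b → 15 * s ≤ ∣ P b ∣) where

    open Neighbourhoods E E? E-sym
    open Walks E E-sym

    joined′ : ∀ b → Joined s (P b) (P (not b))
    joined′ true  = joined
    joined′ false = Joined-sym joined

    module _ {Z : Bool → Subset N} (Z⊆P : ∀ b → Z b ⊆ P b) {p : ℕ → Fin N}
             (isPath : AlternatingPath E Z p (5 * s)) where

      open AlternatingPath isPath

      p-injective : ∀ {i j} → i < 5 * s → j < 5 * s → p i ≡ p j → i ≡ j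
      p-injective {i} {j} i< j< eq with <-cmp i j
      ... | tri< i<j _ _ = contradiction eq (distinct i<j j<)
      ... | tri≈ _ i≡j _ = i≡j
      ... | tri> _ _ j<i = contradiction (sym eq) (distinct j<i i<)

      missed : Subset N → (Fin (2 * s) → Fin N) → Subset (2 * s)
      missed S f = ⟪ (λ j → ¬? (f j ∈? nbr S)) ⟫

      -- Otherwise `S` and the missed vertices would be two large sets on opposite sides without an
      -- edge. Injectivity of `f` turns the number of missed indices into a number of vertices.
      few-missed : ∀ S σ (f : Fin (2 * s) → Fin N) → (∀ {i j} → f i ≡ f j → i ≡ j) →
                   (∀ j → f j ∈ Z (not σ)) → S ⊆ P σ → s ≤ ∣ S ∣ → ∣ missed S f ∣ < s
      few-missed S σ f inj f∈ S⊆P s≤S = ≰⇒> λ s≤missed →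
        let (a , y , a∈S , y∈ , eay) = joined′ σ {S} {image f (missed S f)} S⊆P
              (λ y∈ → let (j , _ , eq) = ∈-image⁻ f (missed S f) y∈ in
                subst (_∈ P (not σ)) eq (Z⊆P (not σ) (f∈ j)))
              s≤S (≤-trans s≤missed (∣p∣≤∣image∣ f inj (missed S f)))
            (j , j∈ , eq) = ∈-image⁻ f (missed S f) y∈
        in ∈⟪⟫⁻ (λ j → ¬? (f j ∈? nbr S)) j∈ (subst (_∈ nbr S) (sym eq) (∈-nbr⁺ a∈S eay))

      -- There are `2 * s` candidate segments; fewer than `s` fail at the end facing `A` and fewer
      -- than `s` at the end facing `B`, so one succeeds at both.
      hit-both : ∀ {A B α β} (f g : Fin (2 * s) → Fin N) →
                 (∀ {i j} → f i ≡ f j → i ≡ j) → (∀ {i j} → g i ≡ g j → i ≡ j) →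
                 (∀ j → f j ∈ Z (not α)) → (∀ j → g j ∈ Z (not β)) →
                 A ⊆ P α → B ⊆ P β → s ≤ ∣ A ∣ → s ≤ ∣ B ∣ →
                 ∃[ j ] f j ∈ nbr A × g j ∈ nbr B
      hit-both {A} {B} {α} {β} f g f-inj g-inj f∈ g∈ A⊆P B⊆P s≤A s≤B
        with any? (λ j → (f j ∈? nbr A) ×-dec (g j ∈? nbr B))
      ... | yes hit = hit
      ... | no ¬hit = contradiction (begin-strict
        2 * s                                ≡⟨ ∣⊤∣≡n (2 * s) ⟨
        ∣ ⊤ {2 * s} ∣                        ≤⟨ ∣-∣-cover ⊤ (missed A f) (missed B g) (λ {j} _ j∉ →
                                                 ∈⟪⟫⁺ (λ j → ¬? (g j ∈? nbr B)) λ g∈ →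
                                                 j∉ (∈⟪⟫⁺ (λ j → ¬? (f j ∈? nbr A)) λ f∈ → ¬hit (j , f∈ , g∈))) ⟩
        ∣ missed A f ∣ + ∣ missed B g ∣      <⟨ +-mono-< (few-missed A α f f-inj f∈ A⊆P s≤A)
                                                         (few-missed B β g g-inj g∈ B⊆P s≤B) ⟩
        s + s                                ≡⟨ cong (s +_) (+-identityʳ s) ⟨
        2 * s                                ∎) (n≮n (2 * s))
        where open ≤-Reasoning

      pick : ∀ {A B} α k → A ⊆ P α → B ⊆ P (flip k α) → s ≤ ∣ A ∣ → s ≤ ∣ B ∣ → k ≤ s →
             ∃[ i ] k + i < 5 * s × p i ∈ nbr A × p (k + i) ∈ nbr B
      pick {A} {B} α k A⊆P B⊆P s≤A s≤B k≤s =
        let (j , hitA , hitB) = hit-both {A} {B} (λ j → p (at j)) (λ j → p (k + at j))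
              (λ {i} {j} eq → at-injective (p-injective (at< i) (at< j) eq))
              (λ {i} {j} eq → at-injective (+-cancelˡ-≡ k _ _ (p-injective (k+at< i) (k+at< j) eq)))
              start∈ end∈ A⊆P B⊆P s≤A s≤B
        in at j , k+at< j , hitA , hitB
        where
        open ≤-Reasoning
        offset : ∀ b → ∃[ o ] o ≤ 1 × flip o true ≡ b
        offset true  = 0 , z≤n , refl
        offset false = 1 , ≤-refl , refl
        o : ℕ
        o = proj₁ (offset (not α))
        -- Starting positions of one parity, chosen so that `p (at j)` lies opposite `A`. The last
        -- one is at most `2 * (2 * s - 1) + 1`, and adding `k ≤ s` stays below `5 * s`, the length
        -- of the path.
        at : Fin (2 * s) → ℕ
        at j = toℕ j * 2 + o
        at-injective : ∀ {i j} → at i ≡ at j → i ≡ j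
        at-injective eq = toℕ-injective (*-cancelʳ-≡ _ _ 2 (+-cancelʳ-≡ o _ _ eq))
        k+at< : ∀ j → k + at j < 5 * s
        k+at< j = begin-strict
          k + (toℕ j * 2 + o)     ≤⟨ +-mono-≤ k≤s (+-monoʳ-≤ (toℕ j * 2) (proj₁ (proj₂ (offset (not α))))) ⟩
          s + (toℕ j * 2 + 1)     <⟨ +-monoʳ-< s (≤-reflexive (cong suc (+-comm (toℕ j * 2) 1))) ⟩
          s + suc (toℕ j) * 2     ≤⟨ +-monoʳ-≤ s (*-monoˡ-≤ 2 (toℕ<n j)) ⟩
          s + 2 * s * 2           ≡⟨ 1+4≡5 s ⟩
          5 * s                   ∎
          where
          1+4≡5 : ∀ s → s + 2 * s * 2 ≡ 5 * s
          1+4≡5 = solve-∀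
        at< : ∀ j → at j < 5 * s
        at< j = ≤-<-trans (m≤n+m (at j) k) (k+at< j)
        flip-at : ∀ j → flip (at j) true ≡ not α
        flip-at j = trans (flip-+ (toℕ j * 2) o true)
          (trans (flip-even (divides (toℕ j) refl) _) (proj₂ (proj₂ (offset (not α)))))
        start∈ : ∀ j → p (at j) ∈ Z (not α)
        start∈ j = subst (λ σ → p (at j) ∈ Z σ) (flip-at j) (side (at< j))
        end∈ : ∀ j → p (k + at j) ∈ Z (not (flip k α))
        end∈ j = subst (λ σ → p (k + at j) ∈ Z σ)
          (trans (flip-+ k (at j) true) (trans (cong (flip k) (flip-at j)) (flip-not k α)))
          (side (k+at< j))

      connectWithin : ∀ {A B} G → (∀ b → Disjoint (Z b) G) → ∀ α k → A ⊆ P α → B ⊆ P (flip k α) →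
                      s ≤ ∣ A ∣ → s ≤ ∣ B ∣ → k ≤ s →
                      ∃₂ λ a b → a ∈ A × b ∈ B × ∃₂ λ x y → E a x × E y b × SimplePath (∁ G) x y (suc k)
      connectWithin {A} {B} G Z#G α k A⊆P B⊆P s≤A s≤B k≤s =
        let (i , i< , hitA , hitB) = pick α k A⊆P B⊆P s≤A s≤B k≤s
            (a , a∈A , eax) = ∈-nbr⁻ {A} hitA
            (b , b∈B , eby) = ∈-nbr⁻ {B} hitB
            below : ∀ {h} → h ≤ k → h + i < 5 * s
            below h≤k = ≤-<-trans (+-monoˡ-≤ i h≤k) i<
        in a , b , a∈A , b∈B , p i , p (k + i) , eax , E-sym eby ,
           segment k (λ h → p (h + i))
             (λ h h<k → edge (below h<k))
             (λ h<j j≤k → distinct (+-monoˡ-< i h<j) (below j≤k))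
             (λ h h≤k → x∉p⇒x∈∁p (Z#G _ (side (below h≤k))))

    -- Here the `15 * s` vertices of a side are spent: `8 * s` for the set `G` to be avoided,
    -- `5 * s` for the path, and `2 * s` for the finished and unvisited vertices of the search.
    connect : ∀ {A B} G → ∣ G ∣ ≤ 8 * s → ∀ α k → A ⊆ P α → B ⊆ P (flip k α) →
              s ≤ ∣ A ∣ → s ≤ ∣ B ∣ → k ≤ s →
              ∃₂ λ a b → a ∈ A × b ∈ B × ∃₂ λ x y → E a x × E y b × SimplePath (∁ G) x y (suc k)
    connect G ∣G∣≤ =
      connectWithin (λ σ → p─q⊆p (P σ) G) (proj₂ (longPath (5 * s) 0<s Z-large)) G
        (λ σ x∈Z → proj₂ (x∈p─q⁻ (P σ) G x∈Z))
      where
      open ≤-Reasoning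
      Z : Bool → Subset N
      Z σ = P σ ─ G
      Z⊆P : ∀ σ → Z σ ⊆ P σ
      Z⊆P σ = p─q⊆p (P σ) G
      open LongPath E E? E-sym s Z (λ x∈ x∈′ → P# (Z⊆P true x∈) (Z⊆P false x∈′))
        (λ σ → Joined-⊆ (Z⊆P σ) (Z⊆P (not σ)) (joined′ σ))
      Z-large : ∀ σ → s + s + 5 * s ≤ ∣ Z σ ∣
      Z-large σ = +-cancelˡ-≤ (8 * s) _ _ (begin
        8 * s + (s + s + 5 * s)           ≡⟨ 8+7≡15 s ⟩
        15 * s                            ≤⟨ large σ ⟩
        ∣ P σ ∣                           ≤⟨ ∣p∣≤∣q∣+∣p─q∣ (P σ) G ⟩
        ∣ G ∣ + ∣ Z σ ∣                   ≤⟨ +-monoˡ-≤ ∣ Z σ ∣ ∣G∣≤ ⟩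
        8 * s + ∣ Z σ ∣                   ∎)
        where
        8+7≡15 : ∀ s → 8 * s + (s + s + 5 * s) ≡ 15 * s
        8+7≡15 = solve-∀

    module _ (Q : Bool → Subset N) (Q⊆P : ∀ b → Q b ⊆ P b)
             (expands : ∀ b → Expands s (Q b) (Q (not b))) where

      open Growth E E? E-sym s Q (λ x∈ x∈′ → P# (Q⊆P true x∈) (Q⊆P false x∈′)) expands
      open Tree

      joinTrees : ∀ {u v b d k} (t : Tree u b d) (t′ : Tree v (flip k b) d) → Disjoint (F t) (F t′) →
                  E u v → s ≤ 2 ^ d → 2 ^ d < 2 * s → k ≤ s → Cycle (suc d + suc k + suc d)
      joinTrees {u} {v} {b} {d} {k} t t′ t#t′ euv s≤2^d 2^d<2s k≤s =
        let (a , a′ , a∈ , a′∈ , x , y , eax , eya′ , mid) =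
              connect {A t} {A t′} (F t ∪ F t′) small (flip d b) k (Q⊆P _ ∘ A⊆Q t)
                (subst (λ σ → A t′ ⊆ P σ) (flip-comm d k b) (Q⊆P _ ∘ A⊆Q t′)) (s≤A t) (s≤A t′) k≤s
        in close (join disj₂ (join disj₁ (branch t a∈) eax mid) eya′ (backwards (branch t′ a′∈)))
                 (E-sym euv)
        where
        open ≤-Reasoning
        s≤A : ∀ {w σ} (τ : Tree w σ d) → s ≤ ∣ A τ ∣
        s≤A τ = subst (s ≤_) (sym (∣A∣ τ)) s≤2^d
        small : ∣ F t ∪ F t′ ∣ ≤ 8 * s
        small = begin
          ∣ F t ∪ F t′ ∣                    ≤⟨ ∣p∪q∣≤∣p∣+∣q∣ (F t) (F t′) ⟩
          ∣ F t ∣ + ∣ F t′ ∣                ≤⟨ +-mono-≤ (<⇒≤ (∣F∣ t)) (<⇒≤ (∣F∣ t′)) ⟩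
          2 * 2 ^ d + 2 * 2 ^ d             ≤⟨ +-mono-≤ (*-monoʳ-≤ 2 (<⇒≤ 2^d<2s)) (*-monoʳ-≤ 2 (<⇒≤ 2^d<2s)) ⟩
          2 * (2 * s) + 2 * (2 * s)         ≡⟨ 4+4≡8 s ⟩
          8 * s                             ∎
          where
          4+4≡8 : ∀ k → 2 * (2 * k) + 2 * (2 * k) ≡ 8 * k
          4+4≡8 = solve-∀
        disj₁ : Disjoint (F t) (∁ (F t ∪ F t′))
        disj₁ x∈F x∈∁ = x∈∁p⇒x∉p x∈∁ (p⊆p∪q (F t′) x∈F)
        disj₂ : Disjoint (F t ∪ ∁ (F t ∪ F t′)) (F t′)
        disj₂ x∈ x∈F′ with x∈p∪q⁻ (F t) (∁ (F t ∪ F t′)) x∈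
        ... | inj₁ x∈F = t#t′ x∈F x∈F′
        ... | inj₂ x∈∁ = x∈∁p⇒x∉p x∈∁ (q⊆p∪q (F t) (F t′) x∈F′)

      cycleThroughEdge : ∀ {u v b c d k} → u ≢ v → u ∈ Q b → v ∈ Q c → E u v →
                         s ≤ 2 ^ d → 2 ^ d < 2 * s → k ≤ s → flip k b ≡ c →
                         Cycle (suc d + suc k + suc d)
      cycleThroughEdge {d = d} u≢v u∈Q v∈Q euv s≤2^d 2^d<2s k≤s refl =
        let (t , t′ , t#t′) = twoTrees u≢v u∈Q v∈Q d λ j j<d →
              *-cancelˡ-≤ 2 (<⇒≤ (≤-<-trans (^-monoʳ-≤ 2 j<d) 2^d<2s))
        in joinTrees t t′ t#t′ euv s≤2^d 2^d<2s k≤s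

      -- From `2 ^ d < 2 * s ≤ 2 ^ L` follows `d < L`, so `2 * d + 3` vertices fit into `ℓ` and the
      -- remainder is `k ≤ ℓ ≤ s`. As `ℓ` has the parity of `k + 1`, the last hypothesis says that a
      -- walk of `k` edges leads from side `b` to side `c`, which is what the segment between two
      -- leaf levels of equal depth has to do.
      cycleOfLength : ∀ {u v b c L ℓ} → u ≢ v → u ∈ Q b → v ∈ Q c → E u v →
                      2 * s ≤ 2 ^ L → 2 * L + 2 ≤ ℓ → ℓ ≤ s → flip ℓ b ≡ not c → Cycle ℓ
      cycleOfLength {b = b} {c} {L} {ℓ} u≢v u∈Q v∈Q euv 2s≤2^L L≤ℓ ℓ≤s parity =
        let (d , s≤2^d , 2^d<2s) = power-between s 0<s
            (k , eq) = m≤n⇒∃[o]m+o≡n (2d+3≤ℓ {d} (≰⇒> λ L≤d →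
                         <⇒≱ 2^d<2s (≤-trans 2s≤2^L (^-monoʳ-≤ 2 L≤d))))
        in subst Cycle (trans (count d k) eq)
             (cycleThroughEdge u≢v u∈Q v∈Q euv s≤2^d 2^d<2s
               (≤-trans (m≤n+m k (2 * d + 3)) (subst (_≤ s) (sym eq) ℓ≤s)) (parity′ d k eq))
        where
        open ≤-Reasoning
        2d+3≤ℓ : ∀ {d} → d < L → 2 * d + 3 ≤ ℓ
        2d+3≤ℓ {d} d<L = begin
          2 * d + 3          ≤⟨ n≤1+n (2 * d + 3) ⟩
          suc (2 * d + 3)    ≡⟨ eq d ⟩
          2 * suc d + 2      ≤⟨ +-monoˡ-≤ 2 (*-monoʳ-≤ 2 d<L) ⟩
          2 * L + 2          ≤⟨ L≤ℓ ⟩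
          ℓ                  ∎
          where
          eq : ∀ d → suc (2 * d + 3) ≡ 2 * suc d + 2
          eq = solve-∀
        count : ∀ d k → suc d + suc k + suc d ≡ 2 * d + 3 + k
        count = solve-∀
        swap : ∀ d k → suc (suc d * 2 + k) ≡ 2 * d + 3 + k
        swap = solve-∀
        parity′ : ∀ d k → 2 * d + 3 + k ≡ ℓ → flip k b ≡ c
        parity′ d k eq = not-injective (trans
          (cong not (sym (trans (flip-+ (suc d * 2) k b) (flip-even (divides (suc d) refl) (flip k b)))))
          (trans (cong (λ n → flip n b) (trans (swap d k) eq)) parity))

    private
      pruned : ∃₂ λ X Y → X ⊆ P true × Y ⊆ P false × ∣ P true ∣ ≤ s + ∣ X ∣ × ∣ P false ∣ ≤ s + ∣ Y ∣ ×
                          Expands s X Y × Expands s Y X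
      pruned = prune 0<s joined (14≤ true) (14≤ false)
        where
        14≤ : ∀ b → 14 * s ≤ ∣ P b ∣
        14≤ b = ≤-trans (*-monoˡ-≤ s (n≤1+n 14)) (large b)

      sides : Subset N → Subset N → Bool → Subset N
      sides X Y true  = X
      sides X Y false = Y

      s≤pruned : ∀ {x} b → ∣ P b ∣ ≤ s + x → s ≤ x
      s≤pruned b le = +-cancelˡ-≤ s _ _ (≤-trans (+-monoʳ-≤ s (m≤n*m s 14)) (≤-trans (large b) le))

    module _ {L ℓ : ℕ} (2s≤2^L : 2 * s ≤ 2 ^ L) (L≤ℓ : 2 * L + 2 ≤ ℓ) (ℓ≤s : ℓ ≤ s) where

      evenCycle : 2 ∣ ℓ → Cycle ℓ
      evenCycle even =
        let (X , Y , X⊆ , Y⊆ , X≥ , Y≥ , X-exp , Y-exp) = pruned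
            (u , v , u∈X , v∈Y , euv) = joined X⊆ Y⊆ (s≤pruned true X≥) (s≤pruned false Y≥)
        in cycleOfLength (sides X Y) (λ { true → X⊆ ; false → Y⊆ }) (λ { true → X-exp ; false → Y-exp })
             {b = true} {c = false} {L = L} (λ u≡v → P# (X⊆ (subst (_∈ X) u≡v u∈X)) (Y⊆ v∈Y)) u∈X v∈Y euv 2s≤2^L L≤ℓ ℓ≤s
             (flip-even even true)

      oddCycle : (∀ {x} → ¬ E x x) → ¬ 2 ∣ ℓ →
                 Cycle ℓ ⊎ ∃[ X ] X ⊆ P true × ∣ P true ∣ ≤ s + ∣ X ∣ ×
                                  (∀ {x y} → x ∈ X → y ∈ X → ¬ E x y)
      oddCycle E-irrefl odd =
        let (X , Y , X⊆ , Y⊆ , X≥ , Y≥ , X-exp , Y-exp) = pruned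
        in dichotomy X Y X⊆ Y⊆ X≥ X-exp Y-exp
             (any? λ u → (u ∈? X) ×-dec any? λ v → (v ∈? X) ×-dec E? u v)
        where
        dichotomy : ∀ X Y → X ⊆ P true → Y ⊆ P false → ∣ P true ∣ ≤ s + ∣ X ∣ → Expands s X Y →
                    Expands s Y X → Dec (∃[ u ] u ∈ X × ∃[ v ] v ∈ X × E u v) →
                    Cycle ℓ ⊎ ∃[ X ] X ⊆ P true × ∣ P true ∣ ≤ s + ∣ X ∣ ×
                                     (∀ {x y} → x ∈ X → y ∈ X → ¬ E x y)
        dichotomy X Y X⊆ Y⊆ X≥ _ _ (no ¬edge) =
          inj₂ (X , X⊆ , X≥ , λ x∈ y∈ exy → ¬edge (_ , x∈ , _ , y∈ , exy))
        dichotomy X Y X⊆ Y⊆ _ X-exp Y-exp (yes (u , u∈X , v , v∈X , euv)) = inj₁ (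
          cycleOfLength (sides X Y) (λ { true → X⊆ ; false → Y⊆ }) (λ { true → X-exp ; false → Y-exp })
            {b = true} {c = true} {L = L} (λ { refl → E-irrefl euv }) u∈X v∈X euv 2s≤2^L L≤ℓ ℓ≤s
            (flip-odd ℓ odd true))

-- Induction on the colours: large pairs of sets without edges of the listed colours.

module Colours where

  open import Data.Bool using (Bool; true; false)
  open import Data.Fin using (Fin)
  open import Data.Fin.Properties using (any?)
  open import Data.Fin.Subset
  open import Data.Fin.Subset.Properties
  open import Data.List using (List; []; _∷_; _++_; length)
  open import Data.List.Membership.Propositional using () renaming (_∈_ to _∈ˡ_)
  open import Data.List.Relation.Unary.All using (All; []; _∷_)
  open import Data.List.Relation.Unary.Any using (here; there)
  open import Data.Nat hiding (∣_-_∣)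
  open import Data.Nat.Divisibility using (_∣_)
  open import Data.Nat.Properties
  open import Data.Nat.Tactic.RingSolver using (solve-∀)
  open import Data.Product using (∃; ∃-syntax; ∃₂; _×_; _,_; proj₂)
  open import Data.Sum using (_⊎_; inj₁; inj₂)
  open import Function using (_∘_)
  open import Relation.Binary.PropositionalEquality
  open import Relation.Nullary using (¬_; Dec; yes; no; contradiction)
  open import Relation.Nullary.Decidable using (_×-dec_; ¬?)

  open FiniteSets
  open Expansion
  open Paths
  open Cycles

  -- Without colours, `2 * s` vertices are just split in two. The summand `13` makes `K + 13` at
  -- least `15` from `K = 2` on, as the search for cycles requires, and leaves at least `K * s`
  -- vertices after pruning has cost `s`.
  oddRatio : ℕ → ℕ
  oddRatio zero    = 2
  oddRatio (suc o) = oddRatio o * (oddRatio o + 13)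

  2≤oddRatio : ∀ o → 2 ≤ oddRatio o
  2≤oddRatio zero    = ≤-refl
  2≤oddRatio (suc o) = *-mono-≤ (2≤oddRatio o) (≤-trans (s≤s z≤n) (m≤n+m 13 (oddRatio o)))

  module Colourings {N k : ℕ} (E : Fin k → Fin N → Fin N → Set) (E? : ∀ i x y → Dec (E i x y))
           (E-sym : ∀ i {x y} → E i x y → E i y x) (E-irrefl : ∀ i {x} → ¬ E i x x)
           (ℓ : Fin k → ℕ) (n L : ℕ) (0<n : 0 < n) (N≤2^L : N ≤ 2 ^ L)
           (ℓ≤n : ∀ i → ℓ i ≤ n) (L≤ℓ : ∀ i → 2 * L + 2 ≤ ℓ i)
           (noCycle : ∀ i → ¬ Walks.Cycle (E i) (E-sym i) (ℓ i)) where

    private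
      module Nb i = Neighbourhoods (E i) (E? i) (E-sym i)

    NoEdges : Fin k → Subset N → Subset N → Set
    NoEdges i A B = ∀ {a b} → a ∈ A → b ∈ B → ¬ E i a b

    EmptyPair : Fin k → ℕ → Subset N → Subset N → Set
    EmptyPair i s X Y = ∃₂ λ A B → A ⊆ X × B ⊆ Y × s ≤ ∣ A ∣ × s ≤ ∣ B ∣ × NoEdges i A B

    edge? : ∀ i A B → Dec (∃[ a ] a ∈ A × ∃[ b ] b ∈ B × E i a b)
    edge? i A B = any? λ a → (a ∈? A) ×-dec any? λ b → (b ∈? B) ×-dec E? i a b

    emptyPair-or-joined : ∀ i s X Y → EmptyPair i s X Y ⊎ Nb.Joined i s X Y
    emptyPair-or-joined i s X Y = decide (anySubset? λ A → anySubset? λ B → (A ⊆? X) ×-dec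
        (B ⊆? Y) ×-dec (s ≤? ∣ A ∣) ×-dec (s ≤? ∣ B ∣) ×-dec ¬? (edge? i A B))
      where
      decide : Dec (∃ λ A → ∃ λ B → A ⊆ X × B ⊆ Y × s ≤ ∣ A ∣ × s ≤ ∣ B ∣ ×
                      ¬ (∃[ a ] a ∈ A × ∃[ b ] b ∈ B × E i a b)) →
               EmptyPair i s X Y ⊎ Nb.Joined i s X Y
      decide (yes (A , B , A⊆ , B⊆ , s≤A , s≤B , ¬e)) =
        inj₁ (A , B , A⊆ , B⊆ , s≤A , s≤B , λ a∈ b∈ eab → ¬e (_ , a∈ , _ , b∈ , eab))
      decide (no ¬empty) = inj₂ λ {A} {B} A⊆ B⊆ s≤A s≤B → edge A B A⊆ B⊆ s≤A s≤B (edge? i A B)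
        where
        edge : ∀ A B → A ⊆ X → B ⊆ Y → s ≤ ∣ A ∣ → s ≤ ∣ B ∣ →
               Dec (∃[ a ] a ∈ A × ∃[ b ] b ∈ B × E i a b) → ∃₂ λ a b → a ∈ A × b ∈ B × E i a b
        edge A B _ _ _ _ (yes (a , a∈ , b , b∈ , eab)) = a , b , a∈ , b∈ , eab
        edge A B A⊆ B⊆ s≤A s≤B (no ¬e) =
          contradiction (A , B , (λ {x} → A⊆ {x}) , (λ {x} → B⊆ {x}) , s≤A , s≤B , ¬e) ¬empty

    Shattered : List (Fin k) → ℕ → Subset N → Set
    Shattered cs s W = ∃₂ λ A B → A ⊆ W × B ⊆ W × Disjoint A B × s ≤ ∣ A ∣ × s ≤ ∣ B ∣ ×
                                  (∀ {i} → i ∈ˡ cs → NoEdges i A B)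

    -- All scales `s ≥ n` and all sets `W` are allowed, since adding a colour calls on the earlier
    -- ones at a scale larger by `15` or `K + 13`, and in the odd case also inside a subset of `W`.
    Shatters : List (Fin k) → ℕ → Set
    Shatters cs K = ∀ s → n ≤ s → ∀ W → K * s ≤ ∣ W ∣ → Shattered cs s W

    shatter-[] : Shatters [] 2
    shatter-[] s _ W 2s≤W =
      let (A , A⊆W , ∣A∣≡s) = subset-of-size s W (≤-trans (m≤n*m s 2) 2s≤W)
      in A , W ─ A , A⊆W , p─q⊆p W A , (λ x∈A x∈W─A → proj₂ (x∈p─q⁻ W A x∈W─A) x∈A) ,
         ≤-reflexive (sym ∣A∣≡s) ,
         +-cancelˡ-≤ s _ _ (≤-trans (≤-reflexive (cong (s +_) (sym (+-identityʳ s)))) (≤-trans 2s≤W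
           (subst (λ a → ∣ W ∣ ≤ a + ∣ W ─ A ∣) ∣A∣≡s (∣p∣≤∣q∣+∣p─q∣ W A)))) , λ ()

    private

      sides : Subset N → Subset N → Bool → Subset N
      sides A B true  = A
      sides A B false = B

      add-colour : ∀ {cs s W A B} i → A ⊆ W → B ⊆ W → Disjoint A B →
                   (∀ {j} → j ∈ˡ cs → NoEdges j A B) → EmptyPair i s A B → Shattered (i ∷ cs) s W
      add-colour i A⊆W B⊆W A#B none (A′ , B′ , A′⊆ , B′⊆ , s≤A′ , s≤B′ , none-i) =
        A′ , B′ , A⊆W ∘ A′⊆ , B⊆W ∘ B′⊆ , (λ x∈ x∈′ → A#B (A′⊆ x∈) (B′⊆ x∈′)) , s≤A′ , s≤B′ ,
        λ { (here refl) → none-i ; (there j∈) a∈ b∈ → none j∈ (A′⊆ a∈) (B′⊆ b∈) }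

      -- Every scale that occurs is bounded by the number `N` of vertices, so one `L` limits the
      -- depth of the trees at all scales.
      2s≤2^L : ∀ s (A : Subset N) → 15 * s ≤ ∣ A ∣ → 2 * s ≤ 2 ^ L
      2s≤2^L s A 15s≤A = ≤-trans (*-monoˡ-≤ s (m≤m+n 2 13)) (≤-trans 15s≤A (≤-trans (∣p∣≤n A) N≤2^L))

      both : ∀ {s} (A B : Subset N) → s ≤ ∣ A ∣ → s ≤ ∣ B ∣ → ∀ b → s ≤ ∣ sides A B b ∣
      both A B s≤A s≤B true  = s≤A
      both A B s≤A s≤B false = s≤B

    shatter-even : ∀ {cs} K i → 2 ∣ ℓ i → Shatters cs K → Shatters (i ∷ cs) (K * 15)
    shatter-even {cs} K i even shatter s n≤s W K15s≤W =
      let (A , B , A⊆W , B⊆W , A#B , A≥ , B≥ , none) =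
            shatter (15 * s) (≤-trans n≤s (m≤n*m s 15)) W (subst (_≤ ∣ W ∣) (*-assoc K 15 s) K15s≤W)
      in resolve A B A⊆W B⊆W A#B A≥ B≥ none (emptyPair-or-joined i s A B)
      where
      resolve : ∀ A B → A ⊆ W → B ⊆ W → Disjoint A B → 15 * s ≤ ∣ A ∣ → 15 * s ≤ ∣ B ∣ →
                (∀ {j} → j ∈ˡ cs → NoEdges j A B) →
                EmptyPair i s A B ⊎ Nb.Joined i s A B → Shattered (i ∷ cs) s W
      resolve A B A⊆W B⊆W A#B _ _ none (inj₁ empty) = add-colour i A⊆W B⊆W A#B none empty
      resolve A B _ _ A#B A≥ B≥ _ (inj₂ joined) = contradiction
        (CycleInBipartite.evenCycle (E i) (E? i) (E-sym i) s (<-≤-trans 0<n n≤s) (sides A B) A#B joined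
          (both A B A≥ B≥) {L = L} (2s≤2^L s A A≥) (L≤ℓ i) (≤-trans (ℓ≤n i) n≤s) even)
        (noCycle i)

    -- If no large pair of subsets of A and B is empty in colour i, then a large part of A
    -- has no edge of colour i at all, and the remaining colours can be treated inside it.
    shatter-odd : ∀ {cs} K i → 2 ≤ K → ¬ 2 ∣ ℓ i → Shatters cs K → Shatters (i ∷ cs) (K * (K + 13))
    shatter-odd {cs} K i 2≤K odd shatter s n≤s W large =
      let (A , B , A⊆W , B⊆W , A#B , A≥ , B≥ , none) =
            shatter ((K + 13) * s) (≤-trans n≤s (≤-trans (m≤n*m s 15) 15s≤)) W
              (subst (_≤ ∣ W ∣) (*-assoc K (K + 13) s) large)
      in resolve A B A⊆W B⊆W A#B A≥ B≥ none (emptyPair-or-joined i s A B)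
      where
      15s≤ : 15 * s ≤ (K + 13) * s
      15s≤ = *-monoˡ-≤ s (+-monoˡ-≤ 13 2≤K)
      inside-independent : ∀ A → A ⊆ W → (K + 13) * s ≤ ∣ A ∣ →
        ∃[ X ] X ⊆ A × ∣ A ∣ ≤ s + ∣ X ∣ × (∀ {x y} → x ∈ X → y ∈ X → ¬ E i x y) →
        Shattered (i ∷ cs) s W
      inside-independent A A⊆W A≥ (X , X⊆A , X≥ , indep) =
        let (A′ , B′ , A′⊆ , B′⊆ , A′#B′ , A′≥ , B′≥ , none) = shatter s n≤s X Ks≤X
        in A′ , B′ , A⊆W ∘ X⊆A ∘ A′⊆ , A⊆W ∘ X⊆A ∘ B′⊆ , A′#B′ , A′≥ , B′≥ ,
           λ { (here refl) a∈ b∈ → indep (A′⊆ a∈) (B′⊆ b∈) ; (there j∈) → none j∈ }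
        where
        eq : ∀ K s → s + (K * s + 12 * s) ≡ (K + 13) * s
        eq = solve-∀
        Ks≤X : K * s ≤ ∣ X ∣
        Ks≤X = ≤-trans (m≤m+n (K * s) (12 * s)) (+-cancelˡ-≤ s _ _
          (≤-trans (≤-reflexive (eq K s)) (≤-trans A≥ X≥)))
      resolve : ∀ A B → A ⊆ W → B ⊆ W → Disjoint A B → (K + 13) * s ≤ ∣ A ∣ → (K + 13) * s ≤ ∣ B ∣ →
                (∀ {j} → j ∈ˡ cs → NoEdges j A B) →
                EmptyPair i s A B ⊎ Nb.Joined i s A B → Shattered (i ∷ cs) s W
      resolve A B A⊆W B⊆W A#B _ _ none (inj₁ empty) = add-colour i A⊆W B⊆W A#B none empty
      resolve A B A⊆W _ A#B A≥ B≥ _ (inj₂ joined) = conclude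
        (CycleInBipartite.oddCycle (E i) (E? i) (E-sym i) s (<-≤-trans 0<n n≤s) (sides A B) A#B joined
          (both A B (≤-trans 15s≤ A≥) (≤-trans 15s≤ B≥)) {L = L} (2s≤2^L s A (≤-trans 15s≤ A≥)) (L≤ℓ i)
          (≤-trans (ℓ≤n i) n≤s) (E-irrefl i) odd)
        where
        conclude : _ ⊎ _ → Shattered (i ∷ cs) s W
        conclude (inj₁ cycle) = contradiction cycle (noCycle i)
        conclude (inj₂ indep) = inside-independent A A⊆W A≥ indep

    shatter-odds : ∀ {cs} → All (λ i → ¬ 2 ∣ ℓ i) cs → Shatters cs (oddRatio (length cs))
    shatter-odds [] = shatter-[]
    shatter-odds (_∷_ {x = i} {xs = cs} odd odds) =
      shatter-odd (oddRatio (length cs)) i (2≤oddRatio (length cs)) odd (shatter-odds odds)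

    shatter-all : ∀ {es os} → All (λ i → 2 ∣ ℓ i) es → All (λ i → ¬ 2 ∣ ℓ i) os →
                  Shatters (es ++ os) (oddRatio (length os) * 15 ^ length es)
    shatter-all {os = os} [] odds = subst (Shatters os) (sym (*-identityʳ (oddRatio (length os)))) (shatter-odds odds)
    shatter-all {es = i ∷ es} {os} (even ∷ evens) odds =
      subst (Shatters (i ∷ es ++ os)) (eq (oddRatio (length os)) (15 ^ length es))
        (shatter-even (oddRatio (length os) * 15 ^ length es) i even (shatter-all evens odds))
      where
      eq : ∀ a b → a * b * 15 ≡ a * (15 * b)
      eq = solve-∀

-- Elementary inequalities of Bernoulli type.

module Greedy where

  open import Data.Bool using (true; false)
  open import Data.Empty using (⊥-elim)
  open import Data.Fin using (Fin; zero; suc)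
  open import Data.Fin.Subset
  open import Data.Fin.Subset.Properties
  open import Data.List using (List; []; _∷_; _++_; length; map; filter; allFin; tabulate; cartesianProduct)
  open import Data.List.Membership.Propositional using (find; lose) renaming (_∈_ to _∈ˡ_)
  open import Data.List.Membership.Propositional.Properties
    using (∈-++⁺ˡ; ∈-++⁺ʳ; ∈-++⁻; ∈-map⁺; ∈-map⁻; ∈-filter⁺; ∈-filter⁻; ∈-cartesianProduct⁺; ∈-cartesianProduct⁻)
  open import Data.List.Properties using (length-map; length-++; map-++; length-filter; map-tabulate; tabulate-cong; length-tabulate)
  open import Data.List.Relation.Unary.Any as Any using (Any; here; any?)
  open import Data.Nat hiding (∣_-_∣)
  open import Data.Nat.ListAction using (sum)
  open import Data.Nat.ListAction.Properties using (sum-++)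
  open import Data.Nat.Properties
  open import Data.Nat.Tactic.RingSolver using (solve-∀)
  open import Data.Product using (∃-syntax; ∃₂; _×_; _,_; proj₁; proj₂)
  open import Data.Sum using (_⊎_; inj₁; inj₂)
  open import Data.Vec using ([]; _∷_; there)
  open import Function using (_∘_)
  open import Relation.Binary.PropositionalEquality
  open import Relation.Nullary using (¬_; Dec; yes; no; contradiction)
  open import Relation.Nullary.Decidable using (_×-dec_; _⊎-dec_; ¬?)

  open FiniteSets

  ^-distribʳ-* : ∀ n a b → (a * b) ^ n ≡ a ^ n * b ^ n
  ^-distribʳ-* zero    a b = refl
  ^-distribʳ-* (suc n) a b = trans (cong (a * b *_) (^-distribʳ-* n a b)) (eq a b (a ^ n) (b ^ n))
    where
    eq : ∀ a b c d → a * b * (c * d) ≡ a * c * (b * d)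
    eq = solve-∀

  -- With denominators cleared, `1 + k/a ≤ (1 + 1/a) ^ k`.
  bernoulli : ∀ a k → (a + k) * a ^ k ≤ a * suc a ^ k
  bernoulli a zero = ≤-reflexive (cong (_* 1) (+-identityʳ a))
  bernoulli a (suc k) = begin
    (a + suc k) * (a * a ^ k)                      ≡⟨ eq a k (a ^ k) ⟩
    (a * a + k * a + a) * a ^ k                    ≤⟨ *-monoˡ-≤ (a ^ k) (m≤m+n (a * a + k * a + a) k) ⟩
    (a * a + k * a + a + k) * a ^ k                ≡⟨ eq′ a k (a ^ k) ⟩
    suc a * ((a + k) * a ^ k)                      ≤⟨ *-monoʳ-≤ (suc a) (bernoulli a k) ⟩
    suc a * (a * suc a ^ k)                        ≡⟨ eq″ (suc a) a (suc a ^ k) ⟩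
    a * (suc a * suc a ^ k)                        ∎
    where
    open ≤-Reasoning
    eq : ∀ a k x → (a + suc k) * (a * x) ≡ (a * a + k * a + a) * x
    eq = solve-∀
    eq′ : ∀ a k x → (a * a + k * a + a + k) * x ≡ suc a * ((a + k) * x)
    eq′ = solve-∀
    eq″ : ∀ b a x → b * (a * x) ≡ a * (b * x)
    eq″ = solve-∀

  -- Used in the form that `1 + y` rounds, each keeping at most the fraction `y/(1 + y)`, keep at
  -- most one half.
  2*y^[1+y]≤[1+y]^[1+y] : ∀ y → 0 < y → 2 * y ^ suc y ≤ suc y ^ suc y
  2*y^[1+y]≤[1+y]^[1+y] y@(suc _) _ = *-cancelˡ-≤ y (begin
    y * (2 * y ^ suc y)           ≡⟨ eq y (y ^ suc y) ⟩
    (y + y) * y ^ suc y           ≤⟨ *-monoˡ-≤ (y ^ suc y) (+-monoʳ-≤ y (n≤1+n y)) ⟩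
    (y + suc y) * y ^ suc y       ≤⟨ bernoulli y (suc y) ⟩
    y * suc y ^ suc y             ∎)
    where
    open ≤-Reasoning
    eq : ∀ y x → y * (2 * x) ≡ (y + y) * x
    eq = solve-∀

  -- Bernoulli's inequality `(1 - 1/(1 + y)) ^ j ≥ 1 - j/(1 + y)`, where `m` stands for `1 + y - j`
  -- so that no subtraction occurs.
  [1+y]^j*m≤y^j*[1+y] : ∀ y j m → j + m ≡ suc y → suc y ^ j * m ≤ y ^ j * suc y
  [1+y]^j*m≤y^j*[1+y] y zero m refl = ≤-refl
  [1+y]^j*m≤y^j*[1+y] y (suc j) m eq = begin
    suc y * suc y ^ j * m             ≡⟨ assoc (suc y) (suc y ^ j) m ⟩
    suc y ^ j * (suc y * m)           ≤⟨ *-monoʳ-≤ (suc y ^ j) (begin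
      m + y * m                          ≤⟨ +-monoˡ-≤ (y * m) m≤y ⟩
      y + y * m                          ≡⟨ *-suc y m ⟨
      y * suc m                          ∎) ⟩
    suc y ^ j * (y * suc m)           ≡⟨ swap (suc y ^ j) y (suc m) ⟩
    y * (suc y ^ j * suc m)           ≤⟨ *-monoʳ-≤ y ([1+y]^j*m≤y^j*[1+y] y j (suc m)
                                           (trans (+-suc j m) eq)) ⟩
    y * (y ^ j * suc y)               ≡⟨ *-assoc y (y ^ j) (suc y) ⟨
    y * y ^ j * suc y                 ∎
    where
    open ≤-Reasoning
    assoc : ∀ a b c → a * b * c ≡ b * (a * c)
    assoc = solve-∀
    swap : ∀ a b c → a * (b * c) ≡ b * (a * c)
    swap = solve-∀
    m≤y : m ≤ y
    m≤y = ≤-trans (m≤n+m m j) (≤-reflexive (suc-injective eq))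

  -- The previous inequality with `y = 2k` and `j = k` gives `(1 + 1/(2k)) ^ k ≤ (2k + 1)/(k + 1)`,
  -- which is less than `2`.
  [1+2k]^k<2*[2k]^k : ∀ k → suc (2 * k) ^ k < 2 * (2 * k) ^ k
  [1+2k]^k<2*[2k]^k zero = s≤s (s≤s z≤n)
  [1+2k]^k<2*[2k]^k k@(suc _) = *-cancelʳ-< (suc k) _ _ (begin-strict
    suc (2 * k) ^ k * suc k                ≤⟨ [1+y]^j*m≤y^j*[1+y] (2 * k) k (suc k) (eq k) ⟩
    (2 * k) ^ k * suc (2 * k)              <⟨ *-monoʳ-< ((2 * k) ^ k) {{m^n≢0 (2 * k) k}} (n<1+n (suc (2 * k))) ⟩
    (2 * k) ^ k * suc (suc (2 * k))        ≡⟨ eq′ ((2 * k) ^ k) k ⟩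
    2 * (2 * k) ^ k * suc k                ∎)
    where
    open ≤-Reasoning
    eq : ∀ k → k + suc k ≡ suc (2 * k)
    eq = solve-∀
    eq′ : ∀ x k → x * suc (suc (2 * k)) ≡ 2 * x * suc k
    eq′ = solve-∀

  -- Counting the subsets of given size.

  subsets : ∀ N → ℕ → List (Subset N)
  subsets zero    zero    = [] ∷ []
  subsets zero    (suc n) = []
  subsets (suc N) zero    = map (false ∷_) (subsets N zero)
  subsets (suc N) (suc n) = map (true ∷_) (subsets N n) ++ map (false ∷_) (subsets N (suc n))

  ∈-subsets : ∀ {N} (A : Subset N) → A ∈ˡ subsets N ∣ A ∣
  ∈-subsets [] = here refl
  ∈-subsets (true ∷ A) = ∈-++⁺ˡ (∈-map⁺ (true ∷_) (∈-subsets A))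
  ∈-subsets (false ∷ A) with ∣ A ∣ | ∈-subsets A
  ... | zero  | A∈ = ∈-map⁺ (false ∷_) A∈
  ... | suc n | A∈ = ∈-++⁺ʳ (map (true ∷_) (subsets _ n)) (∈-map⁺ (false ∷_) A∈)

  size∈subsets : ∀ {N n} {A : Subset N} → A ∈ˡ subsets N n → ∣ A ∣ ≡ n
  size∈subsets {zero} {zero} (here refl) = refl
  size∈subsets {suc N} {zero} A∈ with ∈-map⁻ (false ∷_) A∈
  ... | A , A∈′ , refl = size∈subsets A∈′
  size∈subsets {suc N} {suc n} A∈ with ∈-++⁻ (map (true ∷_) (subsets N n)) A∈
  ... | inj₁ A∈₁ with ∈-map⁻ (true ∷_) A∈₁
  ...   | A , A∈′ , refl = cong suc (size∈subsets A∈′)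
  size∈subsets {suc N} {suc n} A∈ | inj₂ A∈₂ with ∈-map⁻ (false ∷_) A∈₂
  ...   | A , A∈′ , refl = size∈subsets A∈′

  -- This is C(N,n) xⁿ ≤ (1 + x)ᴺ for x = 1/q.
  length-subsets : ∀ q N n → length (subsets N n) * q ^ N ≤ suc q ^ N * q ^ n
  length-subsets q zero    zero    = ≤-refl
  length-subsets q zero    (suc n) = z≤n
  length-subsets q (suc N) zero    = begin
    length (map (false ∷_) (subsets N 0)) * (q * q ^ N)   ≡⟨ cong (_* (q * q ^ N)) (length-map (false ∷_) (subsets N 0)) ⟩
    length (subsets N 0) * (q * q ^ N)                    ≡⟨ swap (length (subsets N 0)) q (q ^ N) ⟩
    q * (length (subsets N 0) * q ^ N)                    ≤⟨ *-mono-≤ (n≤1+n q) (length-subsets q N 0) ⟩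
    suc q * (suc q ^ N * 1)                               ≡⟨ *-assoc (suc q) (suc q ^ N) 1 ⟨
    suc q * suc q ^ N * 1                                 ∎
    where
    open ≤-Reasoning
    swap : ∀ a b c → a * (b * c) ≡ b * (a * c)
    swap = solve-∀
  length-subsets q (suc N) (suc n) = begin
    length (map (true ∷_) S ++ map (false ∷_) S′) * (q * q ^ N)
      ≡⟨ cong (_* (q * q ^ N)) (trans (length-++ (map (true ∷_) S))
           (cong₂ _+_ (length-map (true ∷_) S) (length-map (false ∷_) S′))) ⟩
    (length S + length S′) * (q * q ^ N)
      ≡⟨ split (length S) (length S′) q (q ^ N) ⟩
    q * (length S * q ^ N) + q * (length S′ * q ^ N)
      ≤⟨ +-mono-≤ (*-monoʳ-≤ q (length-subsets q N n)) (*-monoʳ-≤ q (length-subsets q N (suc n))) ⟩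
    q * (suc q ^ N * q ^ n) + q * (suc q ^ N * (q * q ^ n))
      ≡⟨ collect q (suc q ^ N) (q ^ n) ⟩
    suc q * suc q ^ N * (q * q ^ n) ∎
    where
    open ≤-Reasoning
    S = subsets N n
    S′ = subsets N (suc n)
    split : ∀ a b q x → (a + b) * (q * x) ≡ q * (a * x) + q * (b * x)
    split = solve-∀
    collect : ∀ q x y → q * (x * y) + q * (x * (q * y)) ≡ (1 + q) * x * (q * y)
    collect = solve-∀

  -- The weight `q = 2 * K` makes `(1 + 1/q) ^ (K * n)` less than `2 ^ n`; together with the factor
  -- `q ^ n` this leaves `(2 * q) ^ n`.
  length-subsets-< : ∀ K n → 0 < K → 0 < n → length (subsets (K * n) n) < (4 * K) ^ n
  length-subsets-< K@(suc _) n@(suc _) 0<K 0<n = *-cancelʳ-< (q ^ (K * n)) _ _ (begin-strict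
    length (subsets (K * n) n) * q ^ (K * n)      ≤⟨ length-subsets q (K * n) n ⟩
    suc q ^ (K * n) * q ^ n                       ≡⟨ cong (_* q ^ n) (^-*-assoc (suc q) K n) ⟨
    (suc q ^ K) ^ n * q ^ n                       <⟨ *-monoˡ-< (q ^ n) {{m^n≢0 q n}} (^-monoˡ-< n ([1+2k]^k<2*[2k]^k K)) ⟩
    (2 * q ^ K) ^ n * q ^ n                       ≡⟨ cong (_* q ^ n) (^-distribʳ-* n 2 (q ^ K)) ⟩
    2 ^ n * (q ^ K) ^ n * q ^ n                   ≡⟨ cong (λ x → 2 ^ n * x * q ^ n) (^-*-assoc q K n) ⟩
    2 ^ n * q ^ (K * n) * q ^ n                   ≡⟨ swap (2 ^ n) (q ^ (K * n)) (q ^ n) ⟩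
    2 ^ n * q ^ n * q ^ (K * n)                   ≡⟨ cong (_* q ^ (K * n)) (^-distribʳ-* n 2 q) ⟨
    (2 * q) ^ n * q ^ (K * n)                     ≡⟨ cong (λ x → x ^ n * q ^ (K * n)) (*-assoc 2 2 K) ⟨
    (4 * K) ^ n * q ^ (K * n)                     ∎)
    where
    open ≤-Reasoning
    q : ℕ
    q = 2 * K
    swap : ∀ a b c → a * b * c ≡ a * c * b
    swap = solve-∀

  -- Sums over lists and double counting.

  private variable
    A B : Set

  ∑ : (A → ℕ) → List A → ℕ
  ∑ f xs = sum (map f xs)

  ∑-mono : ∀ {f g : A → ℕ} xs → (∀ {x} → x ∈ˡ xs → f x ≤ g x) → ∑ f xs ≤ ∑ g xs
  ∑-mono []       f≤g = z≤n
  ∑-mono (x ∷ xs) f≤g = +-mono-≤ (f≤g (here refl)) (∑-mono xs (f≤g ∘ Any.there))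

  ∑-+ : ∀ (f g : A → ℕ) xs → ∑ (λ x → f x + g x) xs ≡ ∑ f xs + ∑ g xs
  ∑-+ f g [] = refl
  ∑-+ f g (x ∷ xs) = trans (cong (f x + g x +_) (∑-+ f g xs)) (eq (f x) (g x) (∑ f xs) (∑ g xs))
    where
    eq : ∀ a b c d → a + b + (c + d) ≡ a + c + (b + d)
    eq = solve-∀

  ∑-*ˡ : ∀ c (f : A → ℕ) xs → ∑ (λ x → c * f x) xs ≡ c * ∑ f xs
  ∑-*ˡ c f [] = sym (*-zeroʳ c)
  ∑-*ˡ c f (x ∷ xs) = trans (cong (c * f x +_) (∑-*ˡ c f xs)) (sym (*-distribˡ-+ c (f x) (∑ f xs)))

  ∑-const : ∀ c (xs : List A) → ∑ (λ _ → c) xs ≡ length xs * c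
  ∑-const c []       = refl
  ∑-const c (_ ∷ xs) = cong (c +_) (∑-const c xs)

  ∑-swap : ∀ (f : A → B → ℕ) xs ys →
           ∑ (λ x → ∑ (f x) ys) xs ≡ ∑ (λ y → ∑ (λ x → f x y) xs) ys
  ∑-swap f []       ys = sym (trans (∑-const 0 ys) (*-zeroʳ (length ys)))
  ∑-swap f (x ∷ xs) ys = trans (cong (∑ (f x) ys +_) (∑-swap f xs ys))
    (sym (∑-+ (f x) (λ y → ∑ (λ x → f x y) xs) ys))

  average : ∀ (f : A → ℕ) c xs → 0 < length xs → length xs * c ≤ ∑ f xs → ∃[ x ] c ≤ f x
  average f c (x ∷ xs) _ le with c ≤? f x
  ... | yes c≤ = x , c≤
  ... | no  c≰ = rest xs (+-cancelˡ-< c _ _ (<-≤-trans (s≤s le) (+-monoˡ-≤ (∑ f xs) (≰⇒> c≰))))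
    where
    rest : ∀ xs → length xs * c < ∑ f xs → ∃[ x ] c ≤ f x
    rest xs@(_ ∷ _) lt = average f c xs z<s (<⇒≤ lt)

  indicator : {P : Set} → Dec P → ℕ
  indicator (yes _) = 1
  indicator (no  _) = 0

  length-filter-¬ : {P : A → Set} (P? : ∀ x → Dec (P x)) (xs : List A) →
                    length (filter (¬? ∘ P?) xs) + ∑ (indicator ∘ P?) xs ≡ length xs
  length-filter-¬ P? [] = refl
  length-filter-¬ P? (x ∷ xs) with P? x
  ... | yes _ = trans (+-suc _ _) (cong suc (length-filter-¬ P? xs))
  ... | no  _ = cong suc (length-filter-¬ P? xs)

  ∑-cartesianProduct : ∀ (f : A → ℕ) (g : B → ℕ) xs ys →
                       ∑ (λ (x , y) → f x * g y) (cartesianProduct xs ys) ≡ ∑ f xs * ∑ g ys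
  ∑-cartesianProduct f g [] ys = refl
  ∑-cartesianProduct {B = B} f g (x ∷ xs) ys = begin
    ∑ h (map (x ,_) ys ++ cartesianProduct xs ys)
      ≡⟨ trans (cong sum (map-++ h (map (x ,_) ys) _)) (sum-++ (map h (map (x ,_) ys)) _) ⟩
    ∑ h (map (x ,_) ys) + ∑ h (cartesianProduct xs ys)
      ≡⟨ cong₂ _+_ (row ys) (∑-cartesianProduct f g xs ys) ⟩
    f x * ∑ g ys + ∑ f xs * ∑ g ys
      ≡⟨ *-distribʳ-+ (∑ g ys) (f x) (∑ f xs) ⟨
    (f x + ∑ f xs) * ∑ g ys ∎
    where
    open ≡-Reasoning
    h : _ × B → ℕ
    h (x , y) = f x * g y
    row : ∀ ys → ∑ h (map (x ,_) ys) ≡ f x * ∑ g ys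
    row []       = sym (*-zeroʳ (f x))
    row (y ∷ ys) = trans (cong (f x * g y +_) (row ys)) (sym (*-distribˡ-+ (f x) (g y) (∑ g ys)))

  length-cartesianProduct : ∀ (xs : List A) (ys : List B) → length (cartesianProduct xs ys) ≡ length xs * length ys
  length-cartesianProduct xs ys = begin
    length (cartesianProduct xs ys)            ≡⟨ ∑1 (cartesianProduct xs ys) ⟨
    ∑ (λ _ → 1) (cartesianProduct xs ys)       ≡⟨ ∑-cartesianProduct (λ _ → 1) (λ _ → 1) xs ys ⟩
    ∑ (λ _ → 1) xs * ∑ (λ _ → 1) ys            ≡⟨ cong₂ _*_ (∑1 xs) (∑1 ys) ⟩
    length xs * length ys                      ∎
    where
    open ≡-Reasoning
    ∑1 : (xs : List A) → ∑ (λ _ → 1) xs ≡ length xs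
    ∑1 xs = trans (∑-const 1 xs) (*-identityʳ (length xs))

  ∑-allFin : ∀ {N} (A : Subset N) → ∑ (indicator ∘ (_∈? A)) (allFin N) ≡ ∣ A ∣
  ∑-allFin {N} A = trans (cong sum (map-tabulate {n = N} (λ i → i) (indicator ∘ (_∈? A)))) (go A)
    where
    indicator-cong : ∀ {P Q : Set} (p? : Dec P) (q? : Dec Q) → (P → Q) → (Q → P) → indicator p? ≡ indicator q?
    indicator-cong (yes _) (yes _) _ _ = refl
    indicator-cong (no _)  (no _)  _ _ = refl
    indicator-cong (yes p) (no ¬q) f _ = contradiction (f p) ¬q
    indicator-cong (no ¬p) (yes q) _ g = contradiction (g q) ¬p
    tail : ∀ {n} b (A : Subset n) → sum (tabulate λ i → indicator (suc i ∈? b ∷ A)) ≡ ∣ A ∣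
    go : ∀ {n} (A : Subset n) → sum (tabulate λ i → indicator (i ∈? A)) ≡ ∣ A ∣
    go [] = refl
    go (true ∷ A)  = cong suc (tail true A)
    go (false ∷ A) = tail false A
    tail b A = trans (cong sum (tabulate-cong λ i →
      indicator-cong (suc i ∈? b ∷ A) (i ∈? A) drop-there there)) (go A)

  -- Greedy choice of edges that join all pairs of large sets.

  module _ {N : ℕ} where

    private
      Edge = Fin N × Fin N
      Pair = Subset N × Subset N

    Hits : Edge → Pair → Set
    Hits (u , v) (A , B) = (u ∈ A × v ∈ B) ⊎ (u ∈ B × v ∈ A)

    hits? : ∀ e ω → Dec (Hits e ω)
    hits? (u , v) (A , B) = ((u ∈? A) ×-dec (v ∈? B)) ⊎-dec ((u ∈? B) ×-dec (v ∈? A))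

    -- Loops and both orientations are kept, so that counts over a product factorise; `fromEdges`
    -- ignores loops and orientations anyway.
    allEdges : List Edge
    allEdges = cartesianProduct (allFin N) (allFin N)

    length-allEdges : length allEdges ≡ N * N
    length-allEdges = trans (length-cartesianProduct (allFin N) (allFin N))
      (cong₂ _*_ (length-tabulate {n = N} (λ i → i)) (length-tabulate {n = N} (λ i → i)))

    hitting : ∀ A B → Disjoint A B → ∣ A ∣ * ∣ B ∣ + ∣ B ∣ * ∣ A ∣ ≤ ∑ (λ e → indicator (hits? e (A , B))) allEdges
    hitting A B A#B = begin
      ∣ A ∣ * ∣ B ∣ + ∣ B ∣ * ∣ A ∣                                  ≡⟨ cong₂ _+_ (count A B) (count B A) ⟨
      ∑ (both A B) allEdges + ∑ (both B A) allEdges                  ≡⟨ ∑-+ (both A B) (both B A) allEdges ⟨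
      ∑ (λ e → both A B e + both B A e) allEdges                     ≤⟨ ∑-mono allEdges (λ {e} _ → pointwise e) ⟩
      ∑ (λ e → indicator (hits? e (A , B))) allEdges                 ∎
      where
      open ≤-Reasoning
      both : Subset N → Subset N → Edge → ℕ
      both A B (u , v) = indicator (u ∈? A) * indicator (v ∈? B)
      count : ∀ A B → ∑ (both A B) allEdges ≡ ∣ A ∣ * ∣ B ∣
      count A B = trans (∑-cartesianProduct (indicator ∘ (_∈? A)) (indicator ∘ (_∈? B)) (allFin N) (allFin N))
        (cong₂ _*_ (∑-allFin A) (∑-allFin B))
      pointwise : ∀ e → both A B e + both B A e ≤ indicator (hits? e (A , B))
      pointwise (u , v) with u ∈? A | v ∈? B | u ∈? B | v ∈? A
      ... | yes u∈A | _       | yes u∈B | _       = contradiction u∈B (A#B u∈A)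
      ... | _       | yes v∈B | _       | yes v∈A = contradiction v∈B (A#B v∈A)
      ... | yes _   | yes _   | no _    | no _    = ≤-refl
      ... | yes _   | no _    | no _    | _       = z≤n
      ... | no _    | yes _   | yes _   | no _    = z≤n
      ... | no _    | no _    | yes _   | yes _   = ≤-refl
      ... | no _    | no _    | yes _   | no _    = z≤n
      ... | no _    | _       | no _    | _       = z≤n

    Missed : List Edge → Pair → Set
    Missed es ω = ∀ {e} → e ∈ˡ es → ¬ Hits e ω

    module _ (n y : ℕ) (0<N : 0 < N) (dense : N * N ≤ suc y * (n * n + n * n)) where

      Good : Pair → Set
      Good (A , B) = ∣ A ∣ ≡ n × ∣ B ∣ ≡ n × Disjoint A B

      private

        -- Each pair in `Ω` is hit by at least `2n²` of the `N²` candidates, so an average candidate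
        -- hits at least the fraction `2n²/N² ≥ 1/(1 + y)` of `Ω`.
        bestEdge : ∀ Ω → (∀ {ω} → ω ∈ˡ Ω → Good ω) →
                   ∃[ e ] length Ω ≤ suc y * ∑ (indicator ∘ hits? e) Ω
        bestEdge Ω good = average (λ e → suc y * ∑ (indicator ∘ hits? e) Ω) (length Ω) allEdges
          (subst (0 <_) (sym length-allEdges) (*-mono-< 0<N 0<N)) (begin
            length allEdges * length Ω                                      ≡⟨ cong (_* length Ω) length-allEdges ⟩
            N * N * length Ω                                                ≤⟨ *-monoˡ-≤ (length Ω) dense ⟩
            suc y * (n * n + n * n) * length Ω                              ≡⟨ swap (suc y) (n * n + n * n) (length Ω) ⟩
            suc y * (length Ω * (n * n + n * n))                            ≡⟨ cong (suc y *_) (∑-const (n * n + n * n) Ω) ⟨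
            suc y * ∑ (λ _ → n * n + n * n) Ω                               ≤⟨ *-monoʳ-≤ (suc y) (∑-mono Ω λ {ω} ω∈ → many ω (good ω∈)) ⟩
            suc y * ∑ (λ ω → ∑ (λ e → indicator (hits? e ω)) allEdges) Ω    ≡⟨ cong (suc y *_) (∑-swap (λ e ω → indicator (hits? e ω)) allEdges Ω) ⟨
            suc y * ∑ (λ e → ∑ (indicator ∘ hits? e) Ω) allEdges            ≡⟨ ∑-*ˡ (suc y) (λ e → ∑ (indicator ∘ hits? e) Ω) allEdges ⟨
            ∑ (λ e → suc y * ∑ (indicator ∘ hits? e) Ω) allEdges            ∎)
          where
          open ≤-Reasoning
          swap : ∀ a b c → a * b * c ≡ a * (c * b)
          swap = solve-∀
          many : ∀ ω → Good ω → n * n + n * n ≤ ∑ (λ e → indicator (hits? e ω)) allEdges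
          many (A , B) (refl , ∣B∣≡ , A#B) =
            subst (λ b → ∣ A ∣ * b + b * ∣ A ∣ ≤ ∑ (λ e → indicator (hits? e (A , B))) allEdges) ∣B∣≡ (hitting A B A#B)

      -- After `j` choices at most the fraction `(y/(1 + y)) ^ j` of the pairs survives. `Good` is
      -- carried along because the survivors are averaged over again.
      greedy : ∀ Ω → (∀ {ω} → ω ∈ˡ Ω → Good ω) → ∀ j →
               ∃₂ λ es Ω′ → length es ≡ j × (∀ {ω} → ω ∈ˡ Ω → Missed es ω → ω ∈ˡ Ω′) ×
                            (∀ {ω} → ω ∈ˡ Ω′ → Good ω) × suc y ^ j * length Ω′ ≤ y ^ j * length Ω
      greedy Ω good zero = [] , Ω , refl , (λ ω∈ _ → ω∈) , good , ≤-refl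
      greedy Ω good (suc j) =
        let (es , Ω′ , len , left , good′ , bound) = greedy Ω good j
            (e , best) = bestEdge Ω′ good′
        in e ∷ es , filter (¬? ∘ hits? e) Ω′ , cong suc len ,
           (λ ω∈ missed → ∈-filter⁺ (¬? ∘ hits? e) (left ω∈ (missed ∘ Any.there)) (missed (here refl))) ,
           good′ ∘ proj₁ ∘ ∈-filter⁻ (¬? ∘ hits? e) ,
           decrease (length (filter (¬? ∘ hits? e) Ω′)) (∑ (indicator ∘ hits? e) Ω′) (length Ω′)
             (length-filter-¬ (hits? e) Ω′) best bound
        where
        open ≤-Reasoning
        decrease : ∀ r h l → r + h ≡ l → l ≤ suc y * h → suc y ^ j * l ≤ y ^ j * length Ω →
                   suc y ^ suc j * r ≤ y ^ suc j * length Ω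
        decrease r h .(r + h) refl l≤ bound = begin
          suc y * suc y ^ j * r            ≡⟨ assoc (suc y) (suc y ^ j) r ⟩
          suc y ^ j * (suc y * r)          ≤⟨ *-monoʳ-≤ (suc y ^ j) less-r ⟩
          suc y ^ j * (y * (r + h))        ≡⟨ swap (suc y ^ j) y (r + h) ⟩
          y * (suc y ^ j * (r + h))        ≤⟨ *-monoʳ-≤ y bound ⟩
          y * (y ^ j * length Ω)           ≡⟨ *-assoc y (y ^ j) (length Ω) ⟨
          y * y ^ j * length Ω             ∎
          where
          assoc : ∀ a b c → a * b * c ≡ b * (a * c)
          assoc = solve-∀
          swap : ∀ a b c → a * (b * c) ≡ b * (a * c)
          swap = solve-∀
          less-r : suc y * r ≤ y * (r + h)
          less-r = begin
            r + y * r          ≤⟨ +-monoˡ-≤ (y * r) (+-cancelʳ-≤ h r (y * h) (≤-trans l≤ (≤-reflexive (+-comm h (y * h))))) ⟩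
            y * h + y * r      ≡⟨ +-comm (y * h) (y * r) ⟩
            y * r + y * h      ≡⟨ *-distribˡ-+ y r h ⟨
            y * (r + h)        ∎

      -- Since `1 + y` choices halve the survivors, `suc y * b` choices leave at most
      -- `length Ω / 2 ^ b` of them, which is less than one.
      greedy-all : ∀ Ω b → (∀ {ω} → ω ∈ˡ Ω → Good ω) → 0 < y → length Ω < 2 ^ b →
                   ∃[ es ] length es ≡ suc y * b × (∀ {ω} → ω ∈ˡ Ω → ¬ Missed es ω)
      greedy-all Ω b good 0<y small =
        let (es , Ω′ , len , left , _ , bound) = greedy Ω good (suc y * b)
        in es , len , λ ω∈ missed → nothing-left Ω′ bound (left ω∈ missed)
        where
        open ≤-Reasoning
        swap : ∀ a b c → a * b * c ≡ b * (a * c)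
        swap = solve-∀
        nothing-left : ∀ Ω′ → suc y ^ (suc y * b) * length Ω′ ≤ y ^ (suc y * b) * length Ω →
                       ∀ {ω} → ¬ ω ∈ˡ Ω′
        nothing-left Ω′@(_ ∷ _) bound _ = <⇒≱ small (*-cancelˡ-≤ (y ^ (suc y * b))
            {{m^n≢0 y (suc y * b) {{>-nonZero 0<y}}}} (begin
          y ^ (suc y * b) * 2 ^ b                 ≡⟨ *-comm (y ^ (suc y * b)) (2 ^ b) ⟩
          2 ^ b * y ^ (suc y * b)                 ≡⟨ cong (2 ^ b *_) (^-*-assoc y (suc y) b) ⟨
          2 ^ b * (y ^ suc y) ^ b                 ≡⟨ ^-distribʳ-* b 2 (y ^ suc y) ⟨
          (2 * y ^ suc y) ^ b                     ≤⟨ ^-monoˡ-≤ b (2*y^[1+y]≤[1+y]^[1+y] y 0<y) ⟩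
          (suc y ^ suc y) ^ b                     ≡⟨ ^-*-assoc (suc y) (suc y) b ⟩
          suc y ^ (suc y * b)                     ≤⟨ m≤m*n _ (length Ω′) ⟩
          suc y ^ (suc y * b) * length Ω′         ≤⟨ bound ⟩
          y ^ (suc y * b) * length Ω              ∎))

  -- Every 2h² greedily chosen edges halve the number of pairs of n-sets not yet joined.
  joiningEdges : ∀ h n β → 0 < h → 0 < n → 4 * (2 * h) ≤ 2 ^ β →
    ∃[ es ] length es ≡ 2 * h * h * (2 * (β * n)) ×
            (∀ {A B : Subset (2 * h * n)} → Disjoint A B → n ≤ ∣ A ∣ → n ≤ ∣ B ∣ →
               ∃₂ λ a b → a ∈ A × b ∈ B × ((a , b) ∈ˡ es ⊎ (b , a) ∈ˡ es))
  joiningEdges h@(suc _) n@(suc _) β 0<h 0<n 8h≤2^β = fromGreedy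
    (greedy-all n y z<s dense Ω (2 * (β * n)) good 0<y small)
    where
    open ≤-Reasoning
    N : ℕ
    N = 2 * h * n
    y : ℕ
    y = pred (2 * h * h)
    dense : N * N ≤ suc y * (n * n + n * n)
    dense = ≤-reflexive (eq h n)
      where
      eq : ∀ h n → 2 * h * n * (2 * h * n) ≡ 2 * h * h * (n * n + n * n)
      eq = solve-∀
    0<y : 0 < y
    0<y = s≤s⁻¹ (*-mono-≤ (*-monoʳ-≤ 2 0<h) 0<h)
    disjoint? : (ω : Subset N × Subset N) → Dec (¬ Nonempty (proj₁ ω ∩ proj₂ ω))
    disjoint? (A , B) = ¬? (nonempty? (A ∩ B))
    S : List (Subset N)
    S = subsets N n
    Ω : List (Subset N × Subset N)
    Ω = filter disjoint? (cartesianProduct S S)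
    good : ∀ {ω} → ω ∈ˡ Ω → Good n y z<s dense ω
    good {A , B} ω∈ =
      let (ω∈S² , A∩B≡∅) = ∈-filter⁻ disjoint? ω∈
          (A∈S , B∈S) = ∈-cartesianProduct⁻ S S ω∈S²
      in size∈subsets A∈S , size∈subsets B∈S , λ x∈A x∈B → A∩B≡∅ (_ , x∈p∩q⁺ (x∈A , x∈B))
    small : length Ω < 2 ^ (2 * (β * n))
    small = begin-strict
      length Ω                              ≤⟨ length-filter disjoint? (cartesianProduct S S) ⟩
      length (cartesianProduct S S)         ≡⟨ length-cartesianProduct S S ⟩
      length S * length S                   <⟨ *-mono-< few few ⟩
      2 ^ (β * n) * 2 ^ (β * n)             ≡⟨ ^-distribˡ-+-* 2 (β * n) (β * n) ⟨
      2 ^ (β * n + β * n)                   ≡⟨ cong (λ k → 2 ^ (β * n + k)) (+-identityʳ (β * n)) ⟨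
      2 ^ (2 * (β * n))                     ∎
      where
      few : length S < 2 ^ (β * n)
      few = begin-strict
        length S            <⟨ length-subsets-< (2 * h) n z<s 0<n ⟩
        (4 * (2 * h)) ^ n   ≤⟨ ^-monoˡ-≤ n 8h≤2^β ⟩
        (2 ^ β) ^ n         ≡⟨ ^-*-assoc 2 β n ⟩
        2 ^ (β * n)         ∎
    fromGreedy : ∃[ es ] length es ≡ suc y * (2 * (β * n)) × (∀ {ω} → ω ∈ˡ Ω → ¬ Missed es ω) →
      ∃[ es ] length es ≡ 2 * h * h * (2 * (β * n)) ×
            (∀ {A B : Subset N} → Disjoint A B → n ≤ ∣ A ∣ → n ≤ ∣ B ∣ →
               ∃₂ λ a b → a ∈ A × b ∈ B × ((a , b) ∈ˡ es ⊎ (b , a) ∈ˡ es))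
    fromGreedy (es , len , hit) = es , len , λ {A} {B} A#B n≤A n≤B →
      let (A′ , A′⊆A , ∣A′∣≡n) = subset-of-size n A n≤A
          (B′ , B′⊆B , ∣B′∣≡n) = subset-of-size n B n≤B
      in found A′ B′ A′⊆A B′⊆B (any? (λ e → hits? e (A′ , B′)) es)
           (hit (∈-filter⁺ disjoint? (∈-cartesianProduct⁺ (∈S A′ ∣A′∣≡n) (∈S B′ ∣B′∣≡n))
             λ (x , x∈) → let (x∈A′ , x∈B′) = x∈p∩q⁻ A′ B′ x∈ in A#B (A′⊆A x∈A′) (B′⊆B x∈B′)))
      where
      ∈S : ∀ A → ∣ A ∣ ≡ n → A ∈ˡ S
      ∈S A ∣A∣≡n = subst (λ k → A ∈ˡ subsets N k) ∣A∣≡n (∈-subsets A)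
      found : ∀ {A B} A′ B′ → A′ ⊆ A → B′ ⊆ B → Dec (Any (λ e → Hits e (A′ , B′)) es) →
              ¬ Missed es (A′ , B′) →
              ∃₂ λ a b → a ∈ A × b ∈ B × ((a , b) ∈ˡ es ⊎ (b , a) ∈ˡ es)
      found A′ B′ A′⊆ B′⊆ (no none) ¬missed = ⊥-elim (¬missed λ e∈ h → none (lose e∈ h))
      found A′ B′ A′⊆ B′⊆ (yes some) _ with find some
      ... | (u , v) , e∈ , inj₁ (u∈A , v∈B) = u , v , A′⊆ u∈A , B′⊆ v∈B , inj₁ e∈
      ... | (u , v) , e∈ , inj₂ (u∈B , v∈A) = v , u , A′⊆ v∈A , B′⊆ u∈B , inj₂ e∈

-- Graphs given by lists of edges.

module Hosts where

  open import Data.Bool using (Bool)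
  open import Data.Bool.Properties using (T-irrelevant)
  open import Data.Fin as Fin using (Fin; zero; suc; inject≤)
  open import Data.Fin.Properties as Fin using (any?; all?; _≟_; _<?_; <-cmp; inject≤-injective)
  open import Data.List as List using (List; []; _∷_; _++_; length; map; allFin; cartesianProduct; concatMap)
  open import Data.List.Membership.Propositional using (_∈_)
  open import Data.List.Membership.Propositional.Properties
    using (∈-∃++; ∈-++⁻; ∈-++⁺ˡ; ∈-++⁺ʳ; ∈-map⁺; ∈-filter⁻; ∈-filter⁺; ∈-cartesianProduct⁺; ∈-allFin)
  open import Data.List.Properties using (length-++; length-map)
  open import Data.List.Relation.Unary.All as All using ([]; _∷_)
  open import Data.List.Relation.Unary.Any using (here; there; index)
  open import Data.List.Relation.Unary.Any.Properties using (lookup-index)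
  open import Data.List.Relation.Unary.Unique.Propositional using (Unique; []; _∷_)
  open import Data.List.Relation.Unary.Unique.Propositional.Properties using (filter⁺; cartesianProduct⁺; allFin⁺)
  open import Data.Nat as ℕ using (ℕ; zero; suc; _+_; _*_; _≤_; _<_; z≤n; s≤s)
  open import Data.Nat.Induction using (<-rec)
  open import Data.Nat.Properties as ℕ using (+-suc)
  open import Data.Product using (Σ; ∃; ∃-syntax; _×_; _,_; proj₁; proj₂)
  open import Data.Sum using (_⊎_; inj₁; inj₂; swap)
  open import Data.Vec as Vec using (Vec; []; _∷_; lookup; tabulate)
  open import Data.Vec.Properties using (lookup∘tabulate; length-toList; toList∘fromList)
  open import Function using (_∘_)
  open import Relation.Binary.Definitions using (tri<; tri≈; tri>)
  open import Relation.Binary.PropositionalEquality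
  open import Relation.Nullary using (¬_; Dec; yes; no; isYes; toWitness; fromWitness; contradiction)
  open import Relation.Nullary.Decidable using (_×-dec_; _⊎-dec_; _→-dec_; ¬?; T?; map′)

  open import Defs using (Graph; Colouring; MonochromaticCopy; Arrows; IsSizeRamseyNumber)
  open Graph using (order; adj; Vertex; Adj; size; edges; symm; irrefl)
  open Colouring using (colour; symmetric)

  length-⊆ : {A : Set} {xs ys : List A} → Unique xs → (∀ {x} → x ∈ xs → x ∈ ys) → length xs ≤ length ys
  length-⊆ [] _ = z≤n
  length-⊆ {xs = x ∷ xs} (x∉ ∷ uniq) xs⊆ys with ∈-∃++ (xs⊆ys (here refl))
  ... | as , bs , refl = subst (suc (length xs) ≤_)
      (sym (trans (length-++ as) (trans (+-suc (length as) (length bs)) (cong suc (sym (length-++ as))))))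
      (s≤s (length-⊆ uniq λ y∈ → strip (All.lookup x∉ y∈) (∈-++⁻ as (xs⊆ys (there y∈)))))
    where
    strip : ∀ {y} → x ≢ y → y ∈ as ⊎ y ∈ x ∷ bs → y ∈ as ++ bs
    strip x≢y (inj₁ y∈)           = ∈-++⁺ˡ y∈
    strip x≢y (inj₂ (here refl))  = contradiction refl x≢y
    strip x≢y (inj₂ (there y∈))   = ∈-++⁺ʳ as y∈

  module _ {N : ℕ} (es : List (Fin N × Fin N)) where

    Listed : Fin N → Fin N → Set
    Listed u v = u ≢ v × ((u , v) ∈ es ⊎ (v , u) ∈ es)

    listed? : ∀ u v → Dec (Listed u v)
    listed? u v = ¬? (u ≟ v) ×-dec (((u , v) ∈? es) ⊎-dec ((v , u) ∈? es))
      where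
      open import Data.Product.Properties using (≡-dec)
      open import Data.List.Membership.DecPropositional (≡-dec _≟_ _≟_) using (_∈?_)

    fromEdges : Graph
    fromEdges = record
      { order  = N
      ; adj    = λ u v → isYes (listed? u v)
      ; symm   = λ u v e → let (u≢v , uv) = toWitness {a? = listed? u v} e
                           in fromWitness {a? = listed? v u} (u≢v ∘ sym , swap uv)
      ; irrefl = λ v e → proj₁ (toWitness {a? = listed? v v} e) refl
      }

    adj⁺ : ∀ {u v} → Listed u v → Adj fromEdges u v
    adj⁺ {u} {v} = fromWitness {a? = listed? u v}

    adj⁻ : ∀ {u v} → Adj fromEdges u v → Listed u v
    adj⁻ {u} {v} = toWitness {a? = listed? u v}

    private
      ordered : Fin N × Fin N → Fin N × Fin N
      ordered (u , v) with u <? v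
      ... | yes _ = u , v
      ... | no  _ = v , u

      ordered-< : ∀ {u v} → u Fin.< v → ordered (u , v) ≡ (u , v)
      ordered-< {u} {v} u<v with u <? v
      ... | yes _  = refl
      ... | no u≮v = contradiction u<v u≮v

      ordered-> : ∀ {u v} → u Fin.< v → ordered (v , u) ≡ (u , v)
      ordered-> {u} {v} u<v with v <? u
      ... | yes v<u = contradiction u<v (ℕ.<⇒≯ v<u)
      ... | no _    = refl

    -- Equality may fail: the list may contain loops, repetitions, or an edge in both orientations.
    size-fromEdges : size fromEdges ≤ length es
    size-fromEdges = subst (size fromEdges ≤_) (length-map ordered es) (length-⊆
      (filter⁺ _ (cartesianProduct⁺ (allFin⁺ N) (allFin⁺ N))) λ {(u , v)} e∈ →
        let (_ , u<v , uv) = ∈-filter⁻ (λ (u , v) → (u <? v) ×-dec T? (adj fromEdges u v))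
              {xs = cartesianProduct (allFin N) (allFin N)} e∈
        in edge∈ u<v (proj₂ (adj⁻ uv)))
      where
      edge∈ : ∀ {u v} → u Fin.< v → (u , v) ∈ es ⊎ (v , u) ∈ es → (u , v) ∈ map ordered es
      edge∈ u<v (inj₁ uv∈) = subst (_∈ map ordered es) (ordered-< u<v) (∈-map⁺ ordered uv∈)
      edge∈ u<v (inj₂ vu∈) = subst (_∈ map ordered es) (ordered-> u<v) (∈-map⁺ ordered vu∈)

  -- Deciding the arrow relation by exhaustive search.

  Searchable : Set → Set₁
  Searchable A = {P : A → Set} → (∀ x → Dec (P x)) → Dec (∃ P)

  search-Fin : ∀ n → Searchable (Fin n)
  search-Fin n = any?

  search-× : {A B : Set} → Searchable A → Searchable B → Searchable (A × B)
  search-× search-A search-B P? = map′ (λ (x , y , p) → (x , y) , p) (λ ((x , y) , p) → x , y , p)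
    (search-A λ x → search-B λ y → P? (x , y))

  search-Vec : {A : Set} → Searchable A → ∀ n → Searchable (Vec A n)
  search-Vec search zero    P? = map′ ([] ,_) (λ { ([] , p) → p }) (P? [])
  search-Vec search (suc n) P? = map′ (λ (x , xs , p) → x ∷ xs , p) (λ { (x ∷ xs , p) → x , xs , p })
    (search λ x → search-Vec search n λ xs → P? (x ∷ xs))

  module _ (G H : Graph) {k : ℕ} where

    IsCopy : (χ : Colouring H k) → Fin k → (Vertex G → Vertex H) → Set
    IsCopy χ i f = (∀ u v → f u ≡ f v → u ≡ v) ×
                   (∀ u v → Adj G u v → Σ (Adj H (f u) (f v)) λ e → colour χ (f u) (f v) e ≡ i)

    copy⁺ : ∀ {χ i f} → IsCopy χ i f → MonochromaticCopy G H χ i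
    copy⁺ {f = f} (inj , edge) = record
      { embed = f ; injective = inj _ _
      ; edge = λ u v e → proj₁ (edge u v e) ; coloured = λ u v e → proj₂ (edge u v e) }

    copy⁻ : ∀ {χ i} → MonochromaticCopy G H χ i → ∃ (IsCopy χ i)
    copy⁻ c = embed , (λ u v → injective) , λ u v e → edge u v e , coloured u v e
      where open MonochromaticCopy c

    -- Maps and colourings are searched as vectors, and tabulating one of them recovers it only
    -- pointwise; being a copy must survive this.
    IsCopy-resp : ∀ χ χ′ {i f g} → (∀ u v e → colour χ u v e ≡ colour χ′ u v e) → (∀ u → f u ≡ g u) →
                  IsCopy χ i f → IsCopy χ′ i g
    IsCopy-resp χ χ′ {i} χ≗χ′ f≗g (inj , edge) =
      (λ u v eq → inj u v (trans (f≗g u) (trans eq (sym (f≗g v))))) ,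
      λ u v e → let (e′ , col) = edge u v e in
        subst₂ (λ x y → Σ (Adj H x y) λ e → colour χ′ x y e ≡ i) (f≗g u) (f≗g v)
          (e′ , trans (sym (χ≗χ′ _ _ e′)) col)

    isCopy? : ∀ χ i f → Dec (IsCopy χ i f)
    isCopy? χ i f =
      all? (λ u → all? λ v → (f u ≟ f v) →-dec (u ≟ v)) ×-dec
      all? (λ u → all? λ v → T? (adj G u v) →-dec coloured? (f u) (f v))
      where
      coloured? : ∀ x y → Dec (Σ (Adj H x y) λ e → colour χ x y e ≡ i)
      coloured? x y with T? (adj H x y)
      ... | no ¬e = no (¬e ∘ proj₁)
      ... | yes e = map′ (e ,_)
        (λ (e′ , col) → trans (cong (colour χ x y) (T-irrelevant e e′)) col) (colour χ x y e ≟ i)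

    copy? : ∀ χ i → Dec (MonochromaticCopy G H χ i)
    copy? χ i = map′ (λ (_ , c) → copy⁺ c)
      (λ c → let (f , isC) = copy⁻ c in tabulate f ,
         IsCopy-resp χ χ (λ _ _ _ → refl) (λ u → sym (lookup∘tabulate f u)) isC)
      (search-Vec (search-Fin (order H)) (order G) λ f → isCopy? χ i (lookup f))

    copy-resp : ∀ χ χ′ {i} → (∀ u v e → colour χ u v e ≡ colour χ′ u v e) →
                MonochromaticCopy G H χ i → MonochromaticCopy G H χ′ i
    copy-resp χ χ′ χ≗χ′ c = let (_ , isC) = copy⁻ c in copy⁺ (IsCopy-resp χ χ′ χ≗χ′ (λ _ → refl) isC)

  module _ (H : Graph) {k : ℕ} where

    private
      n = order H

    Table : Set
    Table = Vec (Vec (Fin (suc k)) n) n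

    -- The entry is read at the pair in increasing order, so an arbitrary table gives a symmetric
    -- colouring.
    fromTable : Table → Colouring H (suc k)
    fromTable τ = record { colour = λ u v _ → entry u v ; symmetric = sym-entry }
      where
      entry : Fin n → Fin n → Fin (suc k)
      entry u v with u <? v
      ... | yes _ = lookup (lookup τ u) v
      ... | no  _ = lookup (lookup τ v) u
      sym-entry : ∀ u v → Adj H u v → Adj H v u → entry u v ≡ entry v u
      sym-entry u v e _ with u <? v | v <? u
      ... | yes _   | no _    = refl
      ... | no _    | yes _   = refl
      ... | yes u<v | yes v<u = contradiction v<u (ℕ.<⇒≯ u<v)
      ... | no u≮v  | no v≮u with <-cmp u v
      ...   | tri< u<v _ _ = contradiction u<v u≮v
      ...   | tri≈ _ refl _ = contradiction e (irrefl H u)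
      ...   | tri> _ _ v<u = contradiction v<u v≮u

    private
      entry : Colouring H (suc k) → Fin n → Fin n → Fin (suc k)
      entry χ u v with T? (adj H u v)
      ... | yes e = colour χ u v e
      -- A dummy colour for non-edges, available because there are `suc k` colours.
      ... | no  _ = zero

      entry≡colour : ∀ χ u v e → entry χ u v ≡ colour χ u v e
      entry≡colour χ u v e with T? (adj H u v)
      ... | yes e′ = cong (colour χ u v) (T-irrelevant e′ e)
      ... | no ¬e  = contradiction e ¬e

    toTable : Colouring H (suc k) → Table
    toTable χ = tabulate λ u → tabulate λ v → entry χ u v

    private
      lookup-toTable : ∀ χ u v → lookup (lookup (toTable χ) u) v ≡ entry χ u v
      lookup-toTable χ u v = trans
        (cong (λ row → lookup row v) (lookup∘tabulate (λ u → tabulate λ v → entry χ u v) u))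
        (lookup∘tabulate (entry χ u) v)

    fromTable-toTable : ∀ χ u v e → colour (fromTable (toTable χ)) u v e ≡ colour χ u v e
    fromTable-toTable χ u v e with u <? v
    ... | yes _ = trans (lookup-toTable χ u v) (entry≡colour χ u v e)
    ... | no  _ = trans (lookup-toTable χ v u) (trans (entry≡colour χ v u (symm H u v e))
                    (symmetric χ v u (symm H u v e) e))

    arrows? : (G : Fin (suc k) → Graph) → Dec (Arrows H G)
    arrows? G with search-Vec (search-Vec (search-Fin (suc k)) n) n
                     (λ τ → ¬? (any? λ i → copy? (G i) H (fromTable τ) i))
    ... | yes (τ , none) = no λ arrows → none (arrows (fromTable τ))
    ... | no ¬none = yes λ χ → decide χ (any? λ i → copy? (G i) H (fromTable (toTable χ)) i)
      where
      decide : ∀ χ → Dec (∃[ i ] MonochromaticCopy (G i) H (fromTable (toTable χ)) i) →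
               ∃[ i ] MonochromaticCopy (G i) H χ i
      decide χ (yes (i , c)) = i , copy-resp (G i) H (fromTable (toTable χ)) χ (fromTable-toTable χ) c
      decide χ (no none) = contradiction (toTable χ , none) ¬none

  -- Only the vertices that lie on an edge matter: they can be renamed by their first
  -- position in the list of all ends of edges.
  module Compression (H : Graph) (b : ℕ) (2*size≤b : 2 * size H ≤ b) where

    open import Data.List.Membership.DecPropositional (_≟_ {order H}) using (_∈?_)

    private
      V = Vertex H

      ends : List V
      ends = concatMap (λ (u , v) → u ∷ v ∷ []) (edges H)

      length-ends : ∀ (es : List (V × V)) → length (concatMap (λ (u , v) → u ∷ v ∷ []) es) ≡ 2 * length es
      length-ends []       = refl
      length-ends (e ∷ es) = trans (cong (λ l → 2 + l) (length-ends es)) (sym (ℕ.*-suc 2 (length es)))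

      shorten : Fin (length ends) → Fin (suc b)
      shorten j = inject≤ j (ℕ.m≤n⇒m≤1+n (subst (_≤ b) (sym (length-ends (edges H))) 2*size≤b))

      position : ∀ {u} → Dec (u ∈ ends) → Fin (suc b)
      position (yes u∈) = shorten (index u∈)
      -- Vertices on no edge may all collide here, even with a genuine end: injectivity is claimed
      -- on `ends` only. The bound `suc b` guarantees that `zero` exists.
      position (no _)   = zero

      position-injective : ∀ {u v} (u∈? : Dec (u ∈ ends)) (v∈? : Dec (v ∈ ends)) → u ∈ ends → v ∈ ends →
                           position u∈? ≡ position v∈? → u ≡ v
      position-injective (no u∉) _ u∈ _ _ = contradiction u∈ u∉
      position-injective (yes _) (no v∉) _ v∈ _ = contradiction v∈ v∉
      position-injective (yes u∈) (yes v∈) _ _ eq =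
        trans (lookup-index u∈) (trans (cong (List.lookup ends) (inject≤-injective _ _ _ _ eq))
          (sym (lookup-index v∈)))

      rename : V → Fin (suc b)
      rename u = position (u ∈? ends)

      rename-injective : ∀ {u v} → u ∈ ends → v ∈ ends → rename u ≡ rename v → u ≡ v
      rename-injective {u} {v} = position-injective (u ∈? ends) (v ∈? ends)

      edge∈ : ∀ {u v} → u Fin.< v → Adj H u v → (u , v) ∈ edges H
      edge∈ {u} {v} u<v e = ∈-filter⁺ (λ (u , v) → (u <? v) ×-dec T? (adj H u v))
        (∈-cartesianProduct⁺ (∈-allFin u) (∈-allFin v)) (u<v , e)

      edge-cases : ∀ {u v} → Adj H u v → (u , v) ∈ edges H ⊎ (v , u) ∈ edges H
      edge-cases {u} {v} e with <-cmp u v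
      ... | tri< u<v _ _  = inj₁ (edge∈ u<v e)
      ... | tri≈ _ refl _ = contradiction e (irrefl H u)
      ... | tri> _ _ v<u  = inj₂ (edge∈ v<u (symm H u v e))

      ends∈ : ∀ {u v} (es : List (V × V)) → (u , v) ∈ es →
              u ∈ concatMap (λ (u , v) → u ∷ v ∷ []) es × v ∈ concatMap (λ (u , v) → u ∷ v ∷ []) es
      ends∈ (_ ∷ _)  (here refl) = here refl , there (here refl)
      ends∈ (_ ∷ es) (there e∈)  = let (u∈ , v∈) = ends∈ es e∈ in there (there u∈) , there (there v∈)

      touched : ∀ {u v} → Adj H u v → u ∈ ends
      touched e with edge-cases e
      ... | inj₁ uv∈ = proj₁ (ends∈ (edges H) uv∈)
      ... | inj₂ vu∈ = proj₂ (ends∈ (edges H) vu∈)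

    compressed : List (Fin (suc b) × Fin (suc b))
    compressed = map (λ (u , v) → rename u , rename v) (edges H)

    length-compressed : length compressed ≡ size H
    length-compressed = length-map _ (edges H)

    private
      keep : ∀ {u v} → Adj H u v → Adj (fromEdges compressed) (rename u) (rename v)
      keep {u} {v} e = adj⁺ compressed (distinct , listed (edge-cases e))
        where
        distinct : rename u ≢ rename v
        distinct eq = irrefl H v (subst (λ x → Adj H x v)
          (rename-injective (touched e) (touched (symm H u v e)) eq) e)
        listed : (u , v) ∈ edges H ⊎ (v , u) ∈ edges H →
                 (rename u , rename v) ∈ compressed ⊎ (rename v , rename u) ∈ compressed
        listed (inj₁ uv∈) = inj₁ (∈-map⁺ _ uv∈)
        listed (inj₂ vu∈) = inj₂ (∈-map⁺ _ vu∈)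

    -- A colouring of the compressed graph is pulled back along `rename`. In the copy found in `H`
    -- every vertex lies on an edge, and on such vertices `rename` is injective, so the copy can be
    -- pushed forward.
    compressed-arrows : ∀ {k} {G : Fin k → Graph} → (∀ i u → ∃[ v ] Adj (G i) u v) →
                        Arrows H G → Arrows (fromEdges compressed) G
    compressed-arrows {k} {G} no-isolated arrows χ = let (i , c) = arrows χ′ in i , transfer i c
      where
      χ′ : Colouring H k
      χ′ = record
        { colour    = λ u v e → colour χ (rename u) (rename v) (keep e)
        ; symmetric = λ u v e e′ → symmetric χ (rename u) (rename v) (keep e) (keep e′) }
      transfer : ∀ i → MonochromaticCopy (G i) H χ′ i → MonochromaticCopy (G i) (fromEdges compressed) χ i
      transfer i c = record
        { embed     = rename ∘ embed
        ; injective = λ {u} {v} eq → injective (rename-injective (covered u) (covered v) eq)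
        ; edge      = λ u v e → keep (edge u v e)
        ; coloured  = coloured }
        where
        open MonochromaticCopy c
        covered : ∀ u → embed u ∈ ends
        covered u = let (v , e) = no-isolated i u in touched (edge u v e)

  -- Attaining the minimum number of edges.

  least : {P : ℕ → Set} → (∀ m → Dec (P m)) → ∀ {m} → P m → ∃[ l ] l ≤ m × P l × (∀ {j} → j < l → ¬ P j)
  least {P} P? {m} pm = <-rec (λ m → P m → ∃[ l ] l ≤ m × P l × (∀ {j} → j < l → ¬ P j)) step m pm
    where
    step : ∀ m → (∀ {j} → j < m → P j → ∃[ l ] l ≤ j × P l × (∀ {i} → i < l → ¬ P i)) →
           P m → ∃[ l ] l ≤ m × P l × (∀ {j} → j < l → ¬ P j)
    step m rec pm with ℕ.anyUpTo? P? m
    ... | yes (j , j<m , pj) = let (l , l≤j , pl , min) = rec j<m pj in l , ℕ.≤-trans l≤j (ℕ.<⇒≤ j<m) , pl , min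
    ... | no none = m , ℕ.≤-refl , pm , λ j<m pj → none (_ , j<m , pj)

  -- Compression puts every arrowing graph with at most `size H` edges on the same `B` vertices, so
  -- a finite search through lists of edges finds the true minimum.
  sizeRamsey-≤ : ∀ {k} {G : Fin (suc k) → Graph} → (∀ i u → ∃[ v ] Adj (G i) u v) →
                 ∀ H → Arrows H G → ∃[ m ] m ≤ size H × IsSizeRamseyNumber G m
  sizeRamsey-≤ {k} {G} no-isolated H arrows =
    let (m , m≤ , (es , len , es-arrows) , minimal) = least arrowing? (compress H ℕ.≤-refl arrows)
        minimum = λ H′ (a : Arrows H′ G) → ℕ.≮⇒≥ λ size<m →
          minimal size<m (compress H′ (ℕ.≤-trans (ℕ.<⇒≤ size<m) m≤) a)
    -- The optimal list has length `m`, but its graph might have fewer edges; minimality excludes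
    -- this.
    in m , m≤ , (fromEdges es , ℕ.≤-antisym (subst (size (fromEdges es) ≤_) len (size-fromEdges es))
                                            (minimum (fromEdges es) es-arrows) , es-arrows) , minimum
    where
    B : ℕ
    B = suc (2 * size H)
    Arrowing : ℕ → Set
    Arrowing m = ∃[ es ] length {A = Fin B × Fin B} es ≡ m × Arrows (fromEdges es) G
    arrowing? : ∀ m → Dec (Arrowing m)
    arrowing? m = map′ (λ (es , a) → Vec.toList es , length-toList es , a)
      (λ { (es , refl , a) → Vec.fromList es , subst (λ es → Arrows (fromEdges es) G) (sym (toList∘fromList es)) a })
      (search-Vec (search-× (search-Fin B) (search-Fin B)) m λ es → arrows? (fromEdges (Vec.toList es)) G)
    compress : ∀ H′ → size H′ ≤ size H → Arrows H′ G → Arrowing (size H′)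
    compress H′ size≤ arrows′ = compressed , length-compressed , compressed-arrows no-isolated arrows′
      where open Compression H′ (2 * size H) (ℕ.*-monoʳ-≤ 2 size≤)

-- A sparse graph that arrows the cycles.

module CycleRamsey where

  open import Data.Bool.Properties using (T-irrelevant)
  open import Data.Fin as Fin using (Fin; zero; suc; toℕ; fromℕ<)
  open import Data.Fin.Properties using (any?; toℕ<n; toℕ-fromℕ<; _≟_)
  open import Data.Fin.Subset using (Subset; ⊤; _∈_; ∣_∣)
  open import Data.Fin.Subset.Properties using (∣⊤∣≡n)
  open import Data.List using (List; []; _∷_; _++_; length; map)
  open import Data.List.Membership.Propositional using () renaming (_∈_ to _∈ˡ_)
  open import Data.List.Membership.Propositional.Properties using (∈-++⁺ˡ; ∈-++⁺ʳ; ∈-map⁺)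
  open import Data.List.Properties using (length-map)
  open import Data.List.Relation.Unary.All as All using (All; []; _∷_)
  open import Data.List.Relation.Unary.All.Properties using (map⁺)
  open import Data.List.Relation.Unary.Any using (here)
  open import Data.Nat hiding (∣_-_∣; _≟_)
  open import Data.Nat.Divisibility using (_∣_; _∣?_)
  open import Data.Nat.Properties hiding (_≟_)
  open import Data.Nat.Tactic.RingSolver using (solve-∀)
  open import Data.Product using (Σ; ∃-syntax; ∃₂; _×_; _,_; proj₁; proj₂)
  open import Data.Sum using (_⊎_; inj₁; inj₂)
  open import Data.Vec using (Vec; []; _∷_; lookup; count)
  open import Function using (_∘_)
  open import Relation.Binary.PropositionalEquality
  open import Relation.Nullary using (Dec; yes; no; toWitness; fromWitness; contradiction)
  open import Relation.Nullary.Decidable using (¬?; T?; map′)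

  open import Defs using (Graph; Colouring; MonochromaticCopy; Arrows; IsSizeRamseyNumber; C; cycleAdj?; #even; #odd; maximum)
  open Graph using (adj; Adj; symm; irrefl)
  open Colouring using (colour; symmetric)

  open FiniteSets
  open Paths
  open Colours
  open Greedy
  open Hosts

  indices : ∀ {P : ℕ → Set} (P? : ∀ m → Dec (P m)) {t} (ns : Vec ℕ t) →
            ∃[ js ] (length js ≡ count P? ns) × All (P ∘ lookup ns) js × (∀ i → P (lookup ns i) → i ∈ˡ js)
  indices P? [] = [] , refl , [] , λ ()
  indices {P} P? (m ∷ ns) with indices P? ns | P? m
  ... | js , len , all , complete | yes pm = zero ∷ map suc js , cong suc (trans (length-map suc js) len) ,
      pm ∷ map⁺ all , λ { zero _ → here refl ; (suc i) p → Data.List.Relation.Unary.Any.there (∈-map⁺ suc (complete i p)) }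
  ... | js , len , all , complete | no ¬pm = map suc js , trans (length-map suc js) len , map⁺ all ,
      λ { zero p → contradiction p ¬pm ; (suc i) p → ∈-map⁺ suc (complete i p) }

  lookup≤maximum : ∀ {t} (ns : Vec ℕ t) i → lookup ns i ≤ maximum ns
  lookup≤maximum (m ∷ ns) zero    = m≤m⊔n m (maximum ns)
  lookup≤maximum (m ∷ ns) (suc i) = ≤-trans (lookup≤maximum ns i) (m≤n⊔m m (maximum ns))

  C-no-isolated : ∀ k → 2 ≤ k → ∀ u → ∃[ v ] Adj (C k) u v
  C-no-isolated k@(suc _) 2≤k u with suc (toℕ u) <? k
  ... | yes su<k = fromℕ< su<k , fromWitness {a? = cycleAdj? k u (fromℕ< su<k)}
        ((λ eq → 1+n≢n (sym (trans (cong toℕ eq) (toℕ-fromℕ< su<k)))) , inj₁ (inj₁ (toℕ-fromℕ< su<k)))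
  ... | no su≮k = zero , fromWitness {a? = cycleAdj? k u zero}
        ((λ { refl → su≮k 2≤k }) , inj₁ (inj₂ (≤-antisym (toℕ<n u) (≮⇒≥ su≮k) , refl)))

  module _ (H : Graph) {k : ℕ} (χ : Colouring H k) where

    Edge : Fin k → Graph.Vertex H → Graph.Vertex H → Set
    Edge i u v = Σ (Adj H u v) λ e → colour χ u v e ≡ i

    edge? : ∀ i u v → Dec (Edge i u v)
    edge? i u v with T? (adj H u v)
    ... | no ¬e = no (¬e ∘ proj₁)
    ... | yes e = map′ (e ,_)
      (λ (e′ , col) → trans (cong (colour χ u v) (T-irrelevant e e′)) col) (colour χ u v e ≟ i)

    edge-sym : ∀ i {u v} → Edge i u v → Edge i v u
    edge-sym i {u} {v} (e , refl) = symm H u v e , symmetric χ v u (symm H u v e) e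

    cycle⇒copy : ∀ {i ℓ} → Walks.Cycle (Edge i) (edge-sym i) ℓ → MonochromaticCopy (C ℓ) H χ i
    cycle⇒copy {i} {ℓ} c = record
      { embed = embed ; injective = injective
      ; edge = λ u v e → proj₁ (edge u v e) ; coloured = λ u v e → proj₂ (edge u v e) }
      where
      open Walks.Cycle c
      edge : ∀ u v → Adj (C ℓ) u v → Edge i (embed u) (embed v)
      edge u v e with toWitness {a? = cycleAdj? ℓ u v} e
      ... | _ , inj₁ nxt = next u v nxt
      ... | _ , inj₂ nxt = edge-sym i (next v u nxt)

  ratio : ∀ {t} → Vec ℕ t → ℕ
  ratio ns = oddRatio (#odd ns) * 15 ^ #even ns

  -- With `N = K * n`, the quotient of `N²` by `2n²` is `K²/2`; for even `K = 2 * h` it is the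
  -- integer `2 * h * h` on which the greedy choice runs.
  halfRatio : ∀ {t} (ns : Vec ℕ t) → ∃[ h ] 0 < h × ratio ns ≡ 2 * h
  halfRatio ns = let (h , 0<h , eq) = half (#odd ns) in
    h * 15 ^ #even ns , *-mono-< 0<h (m^n>0 15 (#even ns)) ,
    trans (cong (_* 15 ^ #even ns) eq) (*-assoc 2 h (15 ^ #even ns))
    where
    half : ∀ o → ∃[ h ] 0 < h × oddRatio o ≡ 2 * h
    half zero    = 1 , z<s , refl
    half (suc o) = let (h , 0<h , eq) = half o in
      h * (oddRatio o + 13) , *-mono-< 0<h (m≤n⇒m≤o+n (oddRatio o) (s≤s z≤n)) ,
      trans (cong (_* (oddRatio o + 13)) eq) (*-assoc 2 h (oddRatio o + 13))

  module _ {t : ℕ} (ns : Vec ℕ (suc t)) (n L β : ℕ) (0<n : 0 < n) (n≡max : n ≡ maximum ns)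
           (Kn≤2^L : ratio ns * n ≤ 2 ^ L) (L≤ns : ∀ i → 2 * L + 2 ≤ lookup ns i)
           (4K≤2^β : 4 * ratio ns ≤ 2 ^ β) where

    private
      cycles : Fin (suc t) → Graph
      cycles i = C (lookup ns i)

    joined⇒arrows : ∀ {N} (es : List (Fin N × Fin N)) → N ≡ ratio ns * n →
      (∀ {A B : Subset N} → Disjoint A B → n ≤ ∣ A ∣ → n ≤ ∣ B ∣ →
         ∃₂ λ a b → a ∈ A × b ∈ B × ((a , b) ∈ˡ es ⊎ (b , a) ∈ˡ es)) →
      Arrows (fromEdges es) cycles
    -- Having a monochromatic copy is decidable, so it is legitimate to assume that there is none,
    -- as `Colourings` does, and to derive a contradiction.
    joined⇒arrows {N} es N≡ joining χ = decide (any? λ i → copy? (cycles i) H χ i)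
      where
      H : Graph
      H = fromEdges es
      evens = indices (2 ∣?_) ns
      odds  = indices (λ m → ¬? (2 ∣? m)) ns
      listed : ∀ i → i ∈ˡ proj₁ evens ++ proj₁ odds
      listed i with 2 ∣? lookup ns i
      ... | yes even = ∈-++⁺ˡ (proj₂ (proj₂ (proj₂ evens)) i even)
      ... | no  odd  = ∈-++⁺ʳ (proj₁ evens) (proj₂ (proj₂ (proj₂ odds)) i odd)
      decide : Dec (∃[ i ] MonochromaticCopy (cycles i) H χ i) → ∃[ i ] MonochromaticCopy (cycles i) H χ i
      decide (yes c) = c
      decide (no none) = absurd (shatter-all (proj₁ (proj₂ (proj₂ evens))) (proj₁ (proj₂ (proj₂ odds)))
          n ≤-refl ⊤ (≤-reflexive (trans (cong₂ (λ o e → oddRatio o * 15 ^ e * n)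
            (proj₁ (proj₂ odds)) (proj₁ (proj₂ evens))) (trans (sym N≡) (sym (∣⊤∣≡n N))))))
        where
        open Colourings (Edge H χ) (edge? H χ) (edge-sym H χ) (λ i {x} (e , _) → irrefl H x e)
          (lookup ns) n L 0<n (subst (_≤ 2 ^ L) (sym N≡) Kn≤2^L)
          (λ i → subst (lookup ns i ≤_) (sym n≡max) (lookup≤maximum ns i)) L≤ns
          (λ i c → none (i , cycle⇒copy H χ c))
        absurd : Shattered (proj₁ evens ++ proj₁ odds) n ⊤ → ∃[ i ] MonochromaticCopy (cycles i) H χ i
        absurd (A , B , _ , _ , A#B , n≤A , n≤B , noEdge) =
          let (a , b , a∈ , b∈ , ab) = joining A#B n≤A n≤B
              e = adj⁺ es ((λ a≡b → A#B a∈ (subst (_∈ B) (sym a≡b) b∈)) , ab)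
          in contradiction (e , refl) (noEdge (listed (colour χ a b e)) a∈ b∈)

    sizeRamsey-cycles : ∃[ m ] m ≤ ratio ns * ratio ns * β * n × IsSizeRamseyNumber cycles m
    sizeRamsey-cycles =
      let (h , 0<h , K≡2h) = halfRatio ns
          (es , len , joining) = joiningEdges h n β 0<h 0<n (subst (λ K → 4 * K ≤ 2 ^ β) K≡2h 4K≤2^β)
          (m , m≤ , ramsey) = sizeRamsey-≤ no-isolated (fromEdges es)
            (joined⇒arrows es (cong (_* n) (sym K≡2h)) joining)
      in m , ≤-trans m≤ (≤-trans (size-fromEdges es) (≤-reflexive (trans len (trans (eq h β n)
           (cong (λ K → K * K * β * n) (sym K≡2h)))))) , ramsey
      where
      eq : ∀ h β n → 2 * h * h * (2 * (β * n)) ≡ 2 * h * (2 * h) * β * n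
      eq = solve-∀
      no-isolated : ∀ i u → ∃[ v ] Adj (cycles i) u v
      no-isolated i = C-no-isolated (lookup ns i) (≤-trans (m≤n+m 2 (2 * L)) (L≤ns i))

-- Comparison of the integer constants.

module Numbers where

  open import Data.Bool using (true; false; T; if_then_else_)
  open import Data.Nat
  open import Data.Nat.Divisibility using (_∣?_)
  open import Data.Nat.Properties
  open import Data.Nat.Tactic.RingSolver using (solve-∀)
  open import Data.Sum using (inj₁; inj₂)
  open import Data.Vec using (Vec; []; _∷_; count)
  open import Relation.Binary.PropositionalEquality
  open import Relation.Nullary using (Dec; yes; no; ¬?)

  open import Defs using (#even; #odd)
  open Colours using (oddRatio; 2≤oddRatio)
  open Greedy using (^-distribʳ-*)
  open CycleRamsey using (ratio)

  square : ℕ → ℕ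
  square a = a * a

  square-mono : ∀ {a b} → a ≤ b → square a ≤ square b
  square-mono a≤b = *-mono-≤ a≤b a≤b

  square-cancel : ∀ {a b} → square a ≤ square b → a ≤ b
  square-cancel a²≤b² = ≮⇒≥ λ b<a → <⇒≱ (*-mono-< b<a b<a) a²≤b²

  ≤-square-⊓ : ∀ x a b → x ≤ square a → x ≤ square b → x ≤ square (a ⊓ b)
  ≤-square-⊓ x a b x≤a² x≤b² with ⊓-sel a b
  ... | inj₁ eq = subst (λ c → x ≤ square c) (sym eq) x≤a²
  ... | inj₂ eq = subst (λ c → x ≤ square c) (sym eq) x≤b²

  square-* : ∀ a b → square (a * b) ≡ square a * square b
  square-* = eq
    where
    eq : ∀ a b → a * b * (a * b) ≡ a * a * (b * b)
    eq = solve-∀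

  -- The integer 2 replaces 82/35 when all the lengths are even.
  oddFactor : ℕ → ℕ
  oddFactor zero      = 2
  oddFactor o@(suc _) = 82 * 35 ^ (2 ^ o ∸ 2)

  -- A bound for the binary logarithm of `4 * oddRatio o`: `8 = 2³` and `120 ≤ 2⁷` at the start.
  -- From then on `K` becomes at most `2K²`, and `8K² ≤ (4K)²` shows that doubling suffices.
  bits : ℕ → ℕ
  bits zero          = 3
  bits (suc zero)    = 7
  bits (suc (suc o)) = 2 * bits (suc o)

  private

    30≤oddRatio : ∀ o → 30 ≤ oddRatio (suc o)
    30≤oddRatio o = *-mono-≤ (2≤oddRatio o) (+-monoˡ-≤ 13 (2≤oddRatio o))

    oddRatio-suc : ∀ o → oddRatio (suc (suc o)) ≤ 2 * square (oddRatio (suc o))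
    oddRatio-suc o = begin
      K * (K + 13)       ≤⟨ *-monoʳ-≤ K (+-monoʳ-≤ K (≤-trans (m≤m+n 13 17) (30≤oddRatio o))) ⟩
      K * (K + K)        ≡⟨ eq K ⟩
      2 * square K       ∎
      where
      open ≤-Reasoning
      K = oddRatio (suc o)
      eq : ∀ K → K * (K + K) ≡ 2 * (K * K)
      eq = solve-∀

    4*oddRatio≤2^bits : ∀ o → 4 * oddRatio o ≤ 2 ^ bits o
    4*oddRatio≤2^bits zero          = ≤-refl
    4*oddRatio≤2^bits (suc zero)    = m≤m+n 120 8
    4*oddRatio≤2^bits (suc (suc o)) = begin
      4 * oddRatio (suc (suc o))      ≤⟨ *-monoʳ-≤ 4 (oddRatio-suc o) ⟩
      4 * (2 * square K)              ≡⟨ *-assoc 4 2 (square K) ⟨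
      8 * square K                    ≤⟨ *-monoˡ-≤ (square K) (m≤m+n 8 8) ⟩
      square 4 * square K             ≡⟨ square-* 4 K ⟨
      square (4 * K)                  ≤⟨ square-mono (4*oddRatio≤2^bits (suc o)) ⟩
      square (2 ^ b)                  ≡⟨ ^-distribˡ-+-* 2 b b ⟨
      2 ^ (b + b)                     ≡⟨ cong (λ k → 2 ^ (b + k)) (+-identityʳ b) ⟨
      2 ^ bits (suc (suc o))          ∎
      where
      open ≤-Reasoning
      K = oddRatio (suc o)
      b = bits (suc o)

    0<bits : ∀ o → 0 < bits o
    0<bits zero          = z<s
    0<bits (suc zero)    = z<s
    0<bits (suc (suc o)) = ≤-trans (0<bits (suc o)) (m≤n*m (bits (suc o)) 2)

    -- If `2 ^ suc o` is `2 + x`, the next exponent is `2 * (2 + x) - 2 = 2 + 2x`; the `2` in front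
    -- yields `35² = 1225`.
    oddFactor-suc : ∀ o → oddFactor (suc (suc o)) ≡ 82 * (1225 * square (35 ^ (2 ^ suc o ∸ 2)))
    oddFactor-suc o = cong (82 *_) (begin
      35 ^ (2 * p ∸ 2)              ≡⟨ cong (35 ^_) double ⟩
      35 ^ (2 + (x + x))            ≡⟨ ^-distribˡ-+-* 35 2 (x + x) ⟩
      1225 * 35 ^ (x + x)           ≡⟨ cong (1225 *_) (^-distribˡ-+-* 35 x x) ⟩
      1225 * square (35 ^ x)        ∎)
      where
      open ≡-Reasoning
      p = 2 ^ suc o
      x = p ∸ 2
      p≡2+x : p ≡ 2 + x
      p≡2+x = sym (m+[n∸m]≡n (*-monoʳ-≤ 2 (m^n>0 2 o)))
      eq : ∀ x → 2 * (2 + x) ≡ 2 + (2 + (x + x))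
      eq = solve-∀
      double : 2 * p ∸ 2 ≡ 2 + (x + x)
      double = trans (cong (λ q → 2 * q ∸ 2) p≡2+x) (cong (_∸ 2) (eq x))

    -- The left side is `8K⁴b`, at most `8 (K²b)²` as `b ≥ 1`, so the previous bound is simply
    -- squared. The excess factor `8a²` is paid for by `d²`; in the application `8 * 82² ≤ 1225²`.
    square-step : ∀ a d K b w → 0 < b → 8 * square a ≤ square d → square K * b ≤ square (a * w) →
                  square (2 * square K) * (2 * b) ≤ square (a * (d * square w))
    square-step a d K b w 0<b 8a²≤d² bound = begin
      square (2 * square K) * (2 * b)               ≡⟨ eq K b ⟩
      8 * (square K * (square K * b))               ≤⟨ *-monoʳ-≤ 8 (*-monoˡ-≤ (square K * b)
                                                        (m≤m*n (square K) b {{>-nonZero 0<b}})) ⟩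
      8 * square (square K * b)                     ≤⟨ *-monoʳ-≤ 8 (square-mono bound) ⟩
      8 * square (square (a * w))                   ≡⟨ eq′ a w ⟩
      8 * square a * square a * square (square w)   ≤⟨ *-monoˡ-≤ (square (square w)) (*-monoˡ-≤ (square a) 8a²≤d²) ⟩
      square d * square a * square (square w)       ≡⟨ eq″ a d w ⟩
      square (a * (d * square w))                   ∎
      where
      open ≤-Reasoning
      eq : ∀ K b → 2 * (K * K) * (2 * (K * K)) * (2 * b) ≡ 8 * (K * K * (K * K * b))
      eq = solve-∀
      eq′ : ∀ a w → 8 * (a * w * (a * w) * (a * w * (a * w))) ≡ 8 * (a * a) * (a * a) * (w * w * (w * w))
      eq′ = solve-∀
      eq″ : ∀ a d w → d * d * (a * a) * (w * w * (w * w)) ≡ a * (d * (w * w)) * (a * (d * (w * w)))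
      eq″ = solve-∀

    oddRatio-bound : ∀ o → square (oddRatio (suc o)) * bits (suc o) ≤ square (oddFactor (suc o))
    -- This is `30² * 7 = 6300 ≤ 6724 = 82²`.
    oddRatio-bound zero    = ≤ᵇ⇒≤ _ _ _
    oddRatio-bound (suc o) = begin
      square (oddRatio (suc (suc o))) * (2 * b)     ≤⟨ *-monoˡ-≤ (2 * b) (square-mono (oddRatio-suc o)) ⟩
      square (2 * square K) * (2 * b)               ≤⟨ square-step 82 1225 K b w (0<bits (suc o)) (≤ᵇ⇒≤ _ _ _) (oddRatio-bound o) ⟩
      square (82 * (1225 * square w))               ≡⟨ cong square (oddFactor-suc o) ⟨
      square (oddFactor (suc (suc o)))              ∎
      where
      open ≤-Reasoning
      K = oddRatio (suc o)
      b = bits (suc o)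
      w = 35 ^ (2 ^ suc o ∸ 2)

    -- Here `225 = 15²` and `6561 = 81²`. The induction starts at exponent one, since at exponent
    -- zero the inequality would read `3 ≤ 1`.
    225^e*[3+4e]≤6561^e : ∀ e → 225 ^ suc e * (3 + 4 * suc e) ≤ 6561 ^ suc e
    225^e*[3+4e]≤6561^e zero    = m≤m+n 1575 4986
    225^e*[3+4e]≤6561^e (suc e) = begin
      225 * x * (3 + 4 * suc (suc e))       ≤⟨ *-monoʳ-≤ (225 * x) (≤-trans (m≤m+n _ (2 + 8 * suc e)) (≤-reflexive (eq (suc e)))) ⟩
      225 * x * (3 * (3 + 4 * suc e))       ≡⟨ eq′ 225 x (3 + 4 * suc e) ⟩
      675 * (x * (3 + 4 * suc e))           ≤⟨ *-mono-≤ (m≤m+n 675 5886) (225^e*[3+4e]≤6561^e e) ⟩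
      6561 * 6561 ^ suc e                   ∎
      where
      open ≤-Reasoning
      x = 225 ^ suc e
      eq : ∀ e → 3 + 4 * suc e + (2 + 8 * e) ≡ 3 * (3 + 4 * e)
      eq = solve-∀
      eq′ : ∀ a x y → a * x * (3 * y) ≡ a * 3 * (x * y)
      eq′ = solve-∀

    225^e*[1+4e]≤6561^e : ∀ e → 225 ^ e * (1 + 4 * e) ≤ 6561 ^ e
    225^e*[1+4e]≤6561^e zero    = ≤-refl
    225^e*[1+4e]≤6561^e (suc e) = ≤-trans (*-monoʳ-≤ (225 ^ suc e) (+-monoˡ-≤ (4 * suc e) (m≤m+n 1 2)))
                                          (225^e*[3+4e]≤6561^e e)

    square-^ : ∀ a e → square (a ^ e) ≡ square a ^ e
    square-^ a e = sym (^-distribʳ-* e a a)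

    -- With an odd length present, `b + 4 * e ≤ b * (1 + 4 * e)` separates the odd part from the
    -- even part. Without one, `bits` contributes `3` and the bound holds from `e = 1` on, which is
    -- what `0 < o + e` provides.
    ratio-bound′ : ∀ o e → 0 < o + e →
      square (oddRatio o * 15 ^ e) * (bits o + 4 * e) ≤ square (oddFactor o * 81 ^ e)
    ratio-bound′ zero (suc e) _ = begin
      square (2 * 15 ^ suc e) * (3 + 4 * suc e)         ≡⟨ cong (_* (3 + 4 * suc e)) (square-* 2 (15 ^ suc e)) ⟩
      4 * square (15 ^ suc e) * (3 + 4 * suc e)         ≡⟨ cong (λ x → 4 * x * (3 + 4 * suc e)) (square-^ 15 (suc e)) ⟩
      4 * 225 ^ suc e * (3 + 4 * suc e)                 ≡⟨ *-assoc 4 (225 ^ suc e) (3 + 4 * suc e) ⟩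
      4 * (225 ^ suc e * (3 + 4 * suc e))               ≤⟨ *-monoʳ-≤ 4 (225^e*[3+4e]≤6561^e e) ⟩
      4 * 6561 ^ suc e                                  ≡⟨ cong (4 *_) (square-^ 81 (suc e)) ⟨
      4 * square (81 ^ suc e)                           ≡⟨ square-* 2 (81 ^ suc e) ⟨
      square (2 * 81 ^ suc e)                           ∎
      where open ≤-Reasoning
    ratio-bound′ (suc o) e _ = begin
      square (K * 15 ^ e) * (b + 4 * e)                 ≡⟨ cong (_* (b + 4 * e)) (trans (square-* K (15 ^ e))
                                                             (cong (square K *_) (square-^ 15 e))) ⟩
      square K * 225 ^ e * (b + 4 * e)                  ≤⟨ *-monoʳ-≤ (square K * 225 ^ e) (begin
        b + 4 * e                                          ≤⟨ +-monoʳ-≤ b (m≤n*m (4 * e) b {{>-nonZero (0<bits (suc o))}}) ⟩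
        b + b * (4 * e)                                    ≡⟨ *-suc b (4 * e) ⟨
        b * (1 + 4 * e)                                    ∎) ⟩
      square K * 225 ^ e * (b * (1 + 4 * e))            ≡⟨ eq (square K) (225 ^ e) b (1 + 4 * e) ⟩
      square K * b * (225 ^ e * (1 + 4 * e))            ≤⟨ *-mono-≤ (oddRatio-bound o) (225^e*[1+4e]≤6561^e e) ⟩
      square (oddFactor (suc o)) * 6561 ^ e             ≡⟨ cong (square (oddFactor (suc o)) *_) (square-^ 81 e) ⟨
      square (oddFactor (suc o)) * square (81 ^ e)      ≡⟨ square-* (oddFactor (suc o)) (81 ^ e) ⟨
      square (oddFactor (suc o) * 81 ^ e)               ∎
      where
      open ≤-Reasoning
      K = oddRatio (suc o)
      b = bits (suc o)
      eq : ∀ a x b y → a * x * (b * y) ≡ a * b * (x * y)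
      eq = solve-∀

    two-colours : ∀ o e → o + e ≡ 2 → square (oddRatio o * 15 ^ e) * (bits o + 4 * e) ≤ square 95412
    two-colours 0 2 refl = ≤ᵇ⇒≤ _ _ _
    two-colours 1 1 refl = ≤ᵇ⇒≤ _ _ _
    two-colours 2 0 refl = ≤ᵇ⇒≤ _ _ _

  count-¬ : ∀ {P : ℕ → Set} (P? : ∀ m → Dec (P m)) {t} (ns : Vec ℕ t) →
            count (λ m → ¬? (P? m)) ns + count P? ns ≡ t
  count-¬ P? [] = refl
  count-¬ P? (m ∷ ns) with P? m
  ... | yes _ = trans (+-suc (count (λ m → ¬? (P? m)) ns) (count P? ns)) (cong suc (count-¬ P? ns))
  ... | no  _ = cong suc (count-¬ P? ns)

  #odd+#even : ∀ {t} (ns : Vec ℕ t) → #odd ns + #even ns ≡ t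
  #odd+#even = count-¬ (2 ∣?_)

  logRatio : ∀ {t} → Vec ℕ t → ℕ
  logRatio ns = bits (#odd ns) + 4 * #even ns

  4*ratio≤2^logRatio : ∀ {t} (ns : Vec ℕ t) → 4 * ratio ns ≤ 2 ^ logRatio ns
  4*ratio≤2^logRatio ns = begin
    4 * (oddRatio o * 15 ^ e)       ≡⟨ *-assoc 4 (oddRatio o) (15 ^ e) ⟨
    4 * oddRatio o * 15 ^ e         ≤⟨ *-mono-≤ (4*oddRatio≤2^bits o) (^-monoˡ-≤ e (n≤1+n 15)) ⟩
    2 ^ bits o * 16 ^ e             ≡⟨ cong (2 ^ bits o *_) (^-*-assoc 2 4 e) ⟩
    2 ^ bits o * 2 ^ (4 * e)        ≡⟨ ^-distribˡ-+-* 2 (bits o) (4 * e) ⟨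
    2 ^ (bits o + 4 * e)            ∎
    where
    open ≤-Reasoning
    o = #odd ns
    e = #even ns

  wholeFactor : ∀ {t} → Vec ℕ t → ℕ
  wholeFactor ns = oddFactor (#odd ns) * 81 ^ #even ns

  -- A natural number below the rational `constant`, so that the comparison with `ratio` can be made
  -- in `ℕ`.
  wholeConstant : ∀ {t} → Vec ℕ t → ℕ
  wholeConstant {t} ns = if t ≡ᵇ 2 then 95412 ⊓ wholeFactor ns else wholeFactor ns

  ratio-bound : ∀ {t} (ns : Vec ℕ (suc t)) → square (ratio ns) * logRatio ns ≤ square (wholeConstant ns)
  ratio-bound {t} ns = cases (suc t ≡ᵇ 2) refl
    where
    general : square (ratio ns) * logRatio ns ≤ square (wholeFactor ns)
    general = ratio-bound′ (#odd ns) (#even ns) (subst (0 <_) (sym (#odd+#even ns)) z<s)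
    cases : ∀ b → (suc t ≡ᵇ 2) ≡ b → square (ratio ns) * logRatio ns ≤
            square (if b then 95412 ⊓ wholeFactor ns else wholeFactor ns)
    cases false _ = general
    cases true t≡2 = ≤-square-⊓ (square (ratio ns) * logRatio ns) 95412 (wholeFactor ns)
      (two-colours (#odd ns) (#even ns)
        (trans (#odd+#even ns) (≡ᵇ⇒≡ (suc t) 2 (subst T (sym t≡2) _)))) general

  -- Follows from the bound on squares because `logRatio` is positive. It puts the number
  -- `ratio ns * n` of vertices below `n c`, hence below the power of two in the hypothesis on the
  -- lengths.
  ratio≤wholeConstant : ∀ {t} (ns : Vec ℕ (suc t)) → ratio ns ≤ wholeConstant ns
  ratio≤wholeConstant ns = square-cancel (≤-trans (m≤m*n (square (ratio ns)) (logRatio ns)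
    {{>-nonZero (≤-trans (0<bits (#odd ns)) (m≤m+n (bits (#odd ns)) (4 * #even ns)))}}) (ratio-bound ns))

-- Transfer of the integer bounds to rationals and reals.

module Rationals where

  open import Data.Bool using (true; false; if_then_else_)
  open import Data.Integer as ℤ using (+_; -[1+_])
  import Data.Integer.Properties as ℤ
  open import Data.Nat as ℕ using (ℕ; zero; suc)
  import Data.Nat.Coprimality as Coprime
  import Data.Nat.Properties as ℕ
  open import Data.Product using (_,_)
  open import Data.Rational
  open import Data.Rational.Properties
  open import Data.Vec using (Vec)
  open import Function.Bundles using (Equivalence)
  open import Relation.Binary.PropositionalEquality
  open import Relation.Nullary using (toWitness)

  open import Defs
  open Numbers using (oddFactor; wholeFactor; wholeConstant)

  fromℕ≡mkℚ : ∀ n → fromℕ n ≡ mkℚ (+ n) 0 (Coprime.sym (Coprime.1-coprimeTo n))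
  fromℕ≡mkℚ n = normalize-coprime (Coprime.sym (Coprime.1-coprimeTo n))

  fromℕ-nonNeg : ∀ n → NonNegative (fromℕ n)
  fromℕ-nonNeg n = normalize-nonNeg n 1

  fromℕ-mono : ∀ {m n} → m ℕ.≤ n → fromℕ m ≤ fromℕ n
  fromℕ-mono {m} {n} m≤n rewrite fromℕ≡mkℚ m | fromℕ≡mkℚ n =
    *≤* (ℤ.*-monoʳ-≤-nonNeg (+ 1) (ℤ.+≤+ m≤n))

  fromℕ-cancel : ∀ {m n} → fromℕ m ≤ fromℕ n → m ℕ.≤ n
  fromℕ-cancel {m} {n} h rewrite fromℕ≡mkℚ m | fromℕ≡mkℚ n =
    ℤ.drop‿+≤+ (subst₂ ℤ._≤_ (ℤ.*-identityʳ (+ m)) (ℤ.*-identityʳ (+ n)) (drop-*≤* h))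

  fromℕ-* : ∀ m n → fromℕ (m ℕ.* n) ≡ fromℕ m * fromℕ n
  fromℕ-* m n rewrite fromℕ≡mkℚ m | fromℕ≡mkℚ n = cong (_/ 1) (ℤ.pos-* m n)

  fromℕ-^ : ∀ m k → fromℕ (m ℕ.^ k) ≡ fromℕ m ^ k
  fromℕ-^ m zero    = refl
  fromℕ-^ m (suc k) = trans (fromℕ-* m (m ℕ.^ k)) (cong (fromℕ m *_) (fromℕ-^ m k))

  *-mono-≤-nonNeg : ∀ {p q r s} → 0ℚ ≤ p → 0ℚ ≤ s → p ≤ q → r ≤ s → p * r ≤ q * s
  *-mono-≤-nonNeg {p} {q} {r} {s} 0≤p 0≤s p≤q r≤s = begin
    p * r    ≤⟨ *-monoˡ-≤-nonNeg p {{nonNegative 0≤p}} r≤s ⟩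
    p * s    ≤⟨ *-monoʳ-≤-nonNeg s {{nonNegative 0≤s}} p≤q ⟩
    q * s    ∎
    where open ≤-Reasoning

  0≤fromℕ : ∀ n → 0ℚ ≤ fromℕ n
  0≤fromℕ n = nonNegative⁻¹ (fromℕ n) {{fromℕ-nonNeg n}}

  fromℕ-oddFactor : ∀ o → fromℕ (oddFactor o) ≤ fromℕ 82 * fromℕ 35 ^ℤ (+ (2 ℕ.^ o) ℤ.- + 2)
  fromℕ-oddFactor zero = toWitness {a? = fromℕ 2 ≤? fromℕ 82 * fromℕ 35 ^ℤ -[1+ 0 ]} _
  fromℕ-oddFactor (suc o) = ≤-reflexive (trans (fromℕ-* 82 (35 ℕ.^ (2 ℕ.^ suc o ℕ.∸ 2)))
    (cong (fromℕ 82 *_) (trans (fromℕ-^ 35 (2 ℕ.^ suc o ℕ.∸ 2))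
      (cong (fromℕ 35 ^ℤ_) (sym (ℤ.⊖-≥ {2 ℕ.^ suc o} {2} (ℕ.*-monoʳ-≤ 2 (ℕ.m^n>0 2 o))))))))

  fromℕ-wholeFactor : ∀ {t} (ns : Vec ℕ t) → fromℕ (wholeFactor ns) ≤ factor ns
  fromℕ-wholeFactor ns = begin
    fromℕ (oddFactor (#odd ns) ℕ.* 81 ℕ.^ #even ns)           ≡⟨ fromℕ-* (oddFactor (#odd ns)) (81 ℕ.^ #even ns) ⟩
    fromℕ (oddFactor (#odd ns)) * fromℕ (81 ℕ.^ #even ns)     ≤⟨ *-mono-≤-nonNeg (0≤fromℕ (oddFactor (#odd ns)))
                                                                  (subst (0ℚ ≤_) (fromℕ-^ 81 (#even ns)) (0≤fromℕ (81 ℕ.^ #even ns)))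
                                                                  (fromℕ-oddFactor (#odd ns)) (≤-reflexive (fromℕ-^ 81 (#even ns))) ⟩
    factor ns                                                 ∎
    where open ≤-Reasoning

  fromℕ-wholeConstant : ∀ {t} (ns : Vec ℕ t) → fromℕ (wholeConstant ns) ≤ constant ns
  fromℕ-wholeConstant {t} ns = cases (t ℕ.≡ᵇ 2) 95412 (fromℕ-wholeFactor ns)
    where
    cases : ∀ b a {f g} → fromℕ f ≤ g →
            fromℕ (if b then a ℕ.⊓ f else f) ≤ (if b then fromℕ a ⊓ g else g)
    cases false a h = h
    cases true  a {f} h = ⊓-glb (fromℕ-mono (ℕ.m⊓n≤m a f)) (≤-trans (fromℕ-mono (ℕ.m⊓n≤n a f)) h)

  ∑-nonNeg : ∀ n {f} → (∀ j → 0ℚ ≤ f j) → 0ℚ ≤ ∑ n f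
  ∑-nonNeg zero    f≥0 = ≤-refl
  ∑-nonNeg (suc n) f≥0 = +-mono-≤ (∑-nonNeg n f≥0) (f≥0 n)

  0≤rightSum : ∀ h .{{_ : NonNegative h}} n → 0ℚ ≤ Riemann.rightSum h n
  0≤rightSum h n = ∑-nonNeg n λ j → nonNegative⁻¹ (h * 1/node (suc j)) {{nonNeg*nonNeg⇒nonNeg h (1/node (suc j))
    {{pos⇒nonNeg (1/node (suc j)) {{1/pos⇒pos (node (suc j)) {{node-pos (suc j)}}}}}}}}
    where open Riemann h

  ½^-nonNeg : ∀ k → NonNegative (½ ^ k)
  ½^-nonNeg zero    = _
  ½^-nonNeg (suc k) = nonNeg*nonNeg⇒nonNeg ½ (½ ^ k) {{½^-nonNeg k}}

  0≤lnSum : ∀ x (1≤x : 1ℚ ≤ x) k → 0ℚ ≤ lnSum x 1≤x k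
  0≤lnSum x 1≤x k = 0≤rightSum (mesh x k) {{nonNeg*nonNeg⇒nonNeg (x - 1ℚ) {{nonNegative 0≤x-1}} (½ ^ k) {{½^-nonNeg k}}}} (2 ℕ.^ k)
    where
    0≤x-1 : 0ℚ ≤ x - 1ℚ
    0≤x-1 = subst (_≤ x - 1ℚ) (+-inverseʳ 1ℚ) (+-monoˡ-≤ (- 1ℚ) 1≤x)

  -- Every Riemann sum for `ln c` is nonnegative, so the inequality holds at each index of the
  -- approximations and the starting index can be `0`.
  ≤ln-bound : ∀ m c (1≤c : 1ℚ ≤ c) n → fromℕ m ≤ c * c * fromℕ n →
              fromℚ (fromℕ m) ≤ℝ (ln c 1≤c +ℝ fromℚ 1ℚ) *ℚ (c * c) *ℚ fromℕ n
  ≤ln-bound m c 1≤c n m≤ ε 0<ε = 0 , λ k _ → begin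
    fromℕ m                                                 ≤⟨ m≤ ⟩
    c * c * fromℕ n                                         ≡⟨ cong (_* fromℕ n) (*-identityˡ (c * c)) ⟨
    1ℚ * (c * c) * fromℕ n                                  ≤⟨ *-monoʳ-≤-nonNeg (fromℕ n) {{fromℕ-nonNeg n}}
                                                                (*-monoʳ-≤-nonNeg (c * c) {{nonNegative 0≤c²}} (1≤ k)) ⟩
    (lnSum c 1≤c k + 1ℚ) * (c * c) * fromℕ n                ≡⟨ +-identityʳ ((lnSum c 1≤c k + 1ℚ) * (c * c) * fromℕ n) ⟨
    (lnSum c 1≤c k + 1ℚ) * (c * c) * fromℕ n + 0ℚ           ≤⟨ +-monoʳ-≤ ((lnSum c 1≤c k + 1ℚ) * (c * c) * fromℕ n) (<⇒≤ 0<ε) ⟩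
    (lnSum c 1≤c k + 1ℚ) * (c * c) * fromℕ n + ε            ∎
    where
    open ≤-Reasoning
    0≤c : 0ℚ ≤ c
    0≤c = ≤-trans (0≤fromℕ 1) 1≤c
    0≤c² : 0ℚ ≤ c * c
    0≤c² = *-mono-≤-nonNeg {0ℚ} {c} {0ℚ} {c} ≤-refl 0≤c 0≤c 0≤c
    1≤ : ∀ k → 1ℚ ≤ lnSum c 1≤c k + 1ℚ
    1≤ k = subst (_≤ lnSum c 1≤c k + 1ℚ) (+-identityˡ 1ℚ) (+-monoˡ-≤ 1ℚ (0≤lnSum c 1≤c k))

  n*c≤2^⌈log₂⌉ : ∀ n w c → 1 ℕ.≤ n → 1ℚ ≤ c → fromℕ w ≤ c → w ℕ.* n ℕ.≤ 2 ℕ.^ ⌈log₂ fromℕ n * c ⌉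
  n*c≤2^⌈log₂⌉ n w c 1≤n 1≤c w≤c = fromℕ-cancel (begin
    fromℕ (w ℕ.* n)                          ≡⟨ trans (cong fromℕ (ℕ.*-comm w n)) (fromℕ-* n w) ⟩
    fromℕ n * fromℕ w                        ≤⟨ *-monoˡ-≤-nonNeg (fromℕ n) {{fromℕ-nonNeg n}} w≤c ⟩
    fromℕ n * c                              ≤⟨ Equivalence.from (⌈log₂⌉-correct (fromℕ n * c) 1≤nc ⌈log₂ fromℕ n * c ⌉) ℕ.≤-refl ⟩
    fromℕ (2 ℕ.^ ⌈log₂ fromℕ n * c ⌉)        ∎)
    where
    open ≤-Reasoning
    1≤nc : 1ℚ ≤ fromℕ n * c
    1≤nc = *-mono-≤-nonNeg {fromℕ 1} {fromℕ n} {1ℚ} {c} (0≤fromℕ 1) (≤-trans (0≤fromℕ 1) 1≤c) (fromℕ-mono 1≤n) 1≤c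

-- Assembly of the size-Ramsey bound.

open import Defs
open import Data.Nat as ℕ using (ℕ; NonZero)
open import Data.Product using (∃-syntax; _×_)
open import Data.Rational using (1ℚ; _*_)
open import Data.Vec using (Vec; lookup)
open import Relation.Binary.PropositionalEquality using (_≡_)

open import Data.Nat using (zero; suc)
import Data.Nat.Properties as ℕ
open import Data.Product using (_,_)
open import Data.Rational using (_≤_)
import Data.Rational.Properties as ℚ
open import Data.Vec using ([])
open import Relation.Binary.PropositionalEquality using (refl; cong)

open CycleRamsey using (ratio; sizeRamsey-cycles)
open Numbers
open Rationals

ratio²*logRatio*n≤c²*n : ∀ {t} (ns : Vec ℕ (suc t)) n →
  fromℕ (ratio ns ℕ.* ratio ns ℕ.* logRatio ns ℕ.* n) ≤ constant ns * constant ns * fromℕ n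
ratio²*logRatio*n≤c²*n ns n = begin
  fromℕ (ratio ns ℕ.* ratio ns ℕ.* logRatio ns ℕ.* n)     ≤⟨ fromℕ-mono (ℕ.*-monoˡ-≤ n (ratio-bound ns)) ⟩
  fromℕ (w ℕ.* w ℕ.* n)                                   ≡⟨ fromℕ-* (w ℕ.* w) n ⟩
  fromℕ (w ℕ.* w) * fromℕ n                               ≡⟨ cong (_* fromℕ n) (fromℕ-* w w) ⟩
  fromℕ w * fromℕ w * fromℕ n                             ≤⟨ ℚ.*-monoʳ-≤-nonNeg (fromℕ n) {{fromℕ-nonNeg n}}
                                                              (*-mono-≤-nonNeg (0≤fromℕ w) 0≤c w≤c w≤c) ⟩
  constant ns * constant ns * fromℕ n                     ∎
  where
  open ℚ.≤-Reasoning
  w : ℕ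
  w = wholeConstant ns
  w≤c : fromℕ w ≤ constant ns
  w≤c = fromℕ-wholeConstant ns
  0≤c : fromℕ 0 ≤ constant ns
  0≤c = ℚ.≤-trans (0≤fromℕ w) w≤c

theorem3p2 : ∀ (t : ℕ) .{{_ : NonZero t}} →
    ∃[ n₀ ] ∀ (ns : Vec ℕ t) → (∀ i → 1 ℕ.≤ lookup ns i) →
    ∀ (n : ℕ) → n ≡ maximum ns → n₀ ℕ.≤ n →
    let c = constant ns in
    (∀ i → 2 ℕ.* ⌈log₂ fromℕ n * c ⌉ ℕ.+ 2 ℕ.≤ lookup ns i) →
    ∃[ m ] IsSizeRamseyNumber (λ i → C (lookup ns i)) m ×
    fromℚ (fromℕ m) ≤ℝ (ln c (1≤constant ns) +ℝ fromℚ 1ℚ) *ℚ (c * c) *ℚ fromℕ n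
-- For the empty sequence `maximum` is `0`, so the threshold `1` leaves nothing to prove.
theorem3p2 zero    = 1 , λ { [] _ n refl () }
theorem3p2 (suc t) = 1 , λ ns _ n n≡max 1≤n L≤ns →
  let c = constant ns
      Kn≤2^L = ℕ.≤-trans (ℕ.*-monoˡ-≤ n (ratio≤wholeConstant ns))
        (n*c≤2^⌈log₂⌉ n (wholeConstant ns) c 1≤n (1≤constant ns) (fromℕ-wholeConstant ns))
      (m , m≤ , isRamsey) = sizeRamsey-cycles ns n ⌈log₂ fromℕ n * c ⌉ (logRatio ns) 1≤n n≡max
        Kn≤2^L L≤ns (4*ratio≤2^logRatio ns)
  in m , isRamsey , ≤ln-bound m c (1≤constant ns) n
       (ℚ.≤-trans (fromℕ-mono m≤) (ratio²*logRatio*n≤c²*n ns n))
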